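{- Let $G$ be a finite simple connected graph and let $n$ be a positive integer. If $|S(G)|<\binom{n}{4}$, then $\max(\chi(G),h(G))<n$.
   Context: All graphs are finite and simple. $\chi(G)$ is the chromatic number, and the Hadwiger number $h(G)$ is the maximum $t$ such that the complete graph $K^{t}$ is a minor of $G$. Solid graphs are the graphs of the following four kinds. (1) Pyramid: a graph consisting of a cycle $C$ and a vertex $w\notin V(C)$ together with at least three edges between $w$ and $C$. (2) Trihedron: the union of three paths $P_1,P_2,P_3$, each of length at least 2, having the same two (distinct) endpoints, such that no interior vertex of any of the paths is used in another of the paths. (3) Stamp: the union of a triangle $T$ and three paths $P_1,P_2,P_3$ of length $\ge 1$ that start at the three different vertices of $T$ and all end at the same vertex $x\notin V(T)$, such that the $P_i-x$ are pairwise vertex-disjoint and each $P_i$ meets $T$ only in its starting vertex. (4) Prism: $T\cup T'\cup P_1\cup P_2\cup P_3$ where $T,T'$ are vertex-disjoint triangles with vertices $x_1,x_2,x_3$ and $y_1,y_2,y_3$ respectively, and the $P_i$ are pairwise vertex-disjoint paths from $x_i$ to $y_i$ (so $P_i$ meets $T\cup T'$ only in $x_i,y_i$). A solid in $G$ is an induced subgraph of $G$ that is isomorphic to a solid graph; $S(G)$ is the set of all solids in $G$. -}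

module Defs where

open import Data.Fin.Base using (Fin; zero; suc; inject₁; fromℕ)
open import Data.Fin.Subset using (Subset; Nonempty; _∈_; _∉_)
open import Data.List.Base using (List; length)
import Data.List.Membership.Propositional as List
open import Data.List.Relation.Unary.Unique.Propositional using (Unique)
open import Data.Nat.Base using (ℕ; suc; _≤_)
open import Data.Product.Base using (Σ; ∃-syntax; _×_; proj₁)
open import Data.Sum.Base using (_⊎_)
import Data.Fin.Properties as Fin
open import Function.Bundles using (_⇔_; _↔_; module Inverse)
open import Function.Definitions using (Injective)
open import Level using (Level; 0ℓ)
open import Relation.Binary.Construct.Closure.ReflexiveTransitive using (Star)
open import Relation.Binary.Core using (Rel)
open import Relation.Binary.Definitions using (Decidable; Irreflexive; Symmetric)
open import Relation.Binary.PropositionalEquality.Core using (_≡_; _≢_; ≢-sym)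
open import Relation.Nullary.Decidable.Core using (¬?)
open import Relation.Nullary.Negation.Core using (¬_)
open import Relation.Unary using (Pred)

private
  variable
    a ℓ : Level
    m k : ℕ
    V W : Set

-- Simple graphs; a finite simple graph is a Graph (Fin m).  Decidability of
-- adjacency is no restriction classically: it says the edge set is given as data.
record Graph (V : Set) : Set₁ where
  field
    Adj    : Rel V 0ℓ
    sym    : Symmetric Adj
    irrefl : Irreflexive _≡_ Adj
    _adj?_ : Decidable Adj

open Graph public using (Adj)

K : ∀ t → Graph (Fin t)
K t = record
  { Adj    = _≢_
  ; sym    = ≢-sym
  ; irrefl = λ u≡v u≢v → u≢v u≡v
  ; _adj?_ = λ u v → ¬? (u Fin.≟ v)
  }

infix 8 _[_]
_[_] : Graph (Fin m) → (S : Subset m) → Graph (∃[ v ] v ∈ S)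
G [ S ] = record
  { Adj    = λ u v → Adj G (proj₁ u) (proj₁ v)
  ; sym    = G.sym
  ; irrefl = λ { _≡_.refl → G.irrefl _≡_.refl }
  ; _adj?_ = λ u v → proj₁ u G.adj? proj₁ v
  }
  where module G = Graph G

infix 4 _≅_
record _≅_ (G : Graph V) (H : Graph W) : Set where
  field
    vertices : V ↔ W
    adjacent : ∀ u v → Adj G u v ⇔ Adj H (Inverse.to vertices u) (Inverse.to vertices v)

-- The graph without vertices counts as connected here.
Connected : Graph V → Set
Connected G = ∀ u v → Star (Adj G) u v

Colourable : Graph V → ℕ → Set
Colourable {V} G k = Σ (V → Fin k) λ c → ∀ {u v} → Adj G u v → c u ≢ c v

IsChromaticNumber : Graph V → ℕ → Set
IsChromaticNumber G χ = Colourable G χ × (∀ k → Colourable G k → χ ≤ k)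

infix 4 _≼_
record _≼_ (H : Graph (Fin k)) (G : Graph (Fin m)) : Set where
  field
    branch    : Fin k → Subset m
    nonempty  : ∀ i → Nonempty (branch i)
    connected : ∀ i → Connected (G [ branch i ])
    disjoint  : ∀ {i j} → i ≢ j → ∀ {v} → v ∈ branch i → v ∉ branch j
    linked    : ∀ {i j} → Adj H i j →
                ∃[ u ] ∃[ v ] u ∈ branch i × v ∈ branch j × Adj G u v

IsHadwigerNumber : Graph (Fin m) → ℕ → Set
IsHadwigerNumber G h = K h ≼ G × (∀ t → K t ≼ G → t ≤ h)

record Path (G : Graph V) (x y : V) : Set where
  field
    len       : ℕ
    vertex    : Fin (suc len) → V
    injective : Injective _≡_ _≡_ vertex
    start     : vertex zero ≡ x
    end       : vertex (fromℕ len) ≡ y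
    step      : ∀ i → Adj G (vertex (inject₁ i)) (vertex (suc i))

  OnPath : V → Set
  OnPath v = ∃[ i ] vertex i ≡ v

  Interior : V → Set
  Interior v = OnPath v × v ≢ x × v ≢ y

  PathEdge : V → V → Set
  PathEdge u v = ∃[ i ] ( (vertex (inject₁ i) ≡ u × vertex (suc i) ≡ v)
                        ⊎ (vertex (inject₁ i) ≡ v × vertex (suc i) ≡ u))

open Path public using (len; OnPath; Interior; PathEdge)

-- A path on at least three vertices together with an edge joining its ends.
record Cycle (G : Graph V) : Set where
  field
    {first last} : V
    path         : Path G first last
    long         : 2 ≤ len path
    closing      : Adj G last first

  OnCycle : V → Set
  OnCycle = OnPath path

  CycleEdge : V → V → Set
  CycleEdge u v = PathEdge path u v ⊎ (u ≡ last × v ≡ first) ⊎ (u ≡ first × v ≡ last)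

open Cycle public using (OnCycle; CycleEdge)

record Triangle (G : Graph V) : Set where
  field
    corner : Fin 3 → V
    adj    : ∀ {i j} → i ≢ j → Adj G (corner i) (corner j)

  OnTriangle : V → Set
  OnTriangle v = ∃[ i ] corner i ≡ v

open Triangle public using (corner; OnTriangle)

-- In the four records below, the fields all-vertices and all-edges say that the
-- graph has no vertices or edges other than those of the listed parts.

record Pyramid (G : Graph V) : Set where
  field
    C            : Cycle G
    w            : V
    w∉C          : ¬ OnCycle C w
    foot         : Fin 3 → V
    foot-inj     : Injective _≡_ _≡_ foot
    foot∈C       : ∀ i → OnCycle C (foot i)
    spoke        : ∀ i → Adj G w (foot i)
    all-vertices : ∀ v → v ≡ w ⊎ OnCycle C v
    all-edges    : ∀ {u v} → Adj G u v →
                   CycleEdge C u v ⊎ (u ≡ w × OnCycle C v) ⊎ (v ≡ w × OnCycle C u)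

record Trihedron (G : Graph V) : Set where
  field
    {x y}        : V
    x≢y          : x ≢ y
    P            : Fin 3 → Path G x y
    long         : ∀ i → 2 ≤ len (P i)
    disjoint     : ∀ {i j} → i ≢ j → ∀ {v} → Interior (P i) v → ¬ OnPath (P j) v
    all-vertices : ∀ v → ∃[ i ] OnPath (P i) v
    all-edges    : ∀ {u v} → Adj G u v → ∃[ i ] PathEdge (P i) u v

record Stamp (G : Graph V) : Set where
  field
    T            : Triangle G
    {x}          : V
    x∉T          : ¬ OnTriangle T x
    P            : ∀ i → Path G (corner T i) x
    long         : ∀ i → 1 ≤ len (P i)
    disjoint     : ∀ {i j} → i ≢ j → ∀ {v} → v ≢ x → OnPath (P i) v → ¬ OnPath (P j) v
    P∩T          : ∀ i {v} → OnPath (P i) v → OnTriangle T v → v ≡ corner T i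
    all-vertices : ∀ v → ∃[ i ] OnPath (P i) v
    all-edges    : ∀ {u v} → Adj G u v →
                   (OnTriangle T u × OnTriangle T v) ⊎ (∃[ i ] PathEdge (P i) u v)

record Prism (G : Graph V) : Set where
  field
    T T′         : Triangle G
    T∩T′         : ∀ {v} → OnTriangle T v → ¬ OnTriangle T′ v
    P            : ∀ i → Path G (corner T i) (corner T′ i)
    disjoint     : ∀ {i j} → i ≢ j → ∀ {v} → OnPath (P i) v → ¬ OnPath (P j) v
    all-vertices : ∀ v → ∃[ i ] OnPath (P i) v
    all-edges    : ∀ {u v} → Adj G u v →
                   (OnTriangle T u × OnTriangle T v) ⊎
                   (OnTriangle T′ u × OnTriangle T′ v) ⊎
                   (∃[ i ] PathEdge (P i) u v)

SolidGraph : Graph V → Set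
SolidGraph G = Pyramid G ⊎ Trihedron G ⊎ Stamp G ⊎ Prism G

-- An induced subgraph is identified with its vertex set, so that S(G) is a set
-- of subsets of the vertices.
IsSolid : Graph (Fin m) → Pred (Subset m) _
IsSolid G S = Σ Set λ V → Σ (Graph V) λ H → SolidGraph H × H ≅ G [ S ]

HasCardinality : {A : Set a} → Pred A ℓ → ℕ → Set _
HasCardinality {A = A} P n =
  Σ (List A) λ xs → Unique xs × (∀ x → (x List.∈ xs) ⇔ P x) × length xs ≡ n

{-# OPTIONS --safe #-}
-- A solid is a wheel (pyramid) or a configuration of three paths, each end of which is
-- a point or a triangle.  Such configurations can be lifted along contractions: if an
-- edge yy′ of G is contracted to a vertex u of a solid, then replacing u by y, by y′ or by
-- both again gives a solid, after a case distinction on the neighbours of y and y′.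
--
-- Hadwiger number: contracting four branch sets of a K^n minor gives a K^4, which is a
-- solid.  It lifts to a solid of G that meets exactly these four branch sets.
--
-- Chromatic number: enlarge a connected set D as long as this leaves some vertices outside
-- of D ∪ N(D).  In the end, these vertices are adjacent to all of N(D).
-- Recursing into them gives a vertex v any two neighbours of which are adjacent or linked
-- by a path without further neighbours of v.  Then any three neighbours of v lie in a solid
-- that contains v and no fourth neighbour: contract the linking set and lift.  If v has
-- fewer than n − 1 neighbours, then G − v still is not (n − 1)-colourable.  Otherwise there
-- are C(n − 1, 3) solids through v and, by induction, C(n − 1, 4) solids of G − v.
module Submission where

open import Data.Empty using (⊥-elim)
open import Data.Fin.Base using (Fin; zero; suc; fromℕ<; toℕ)
import Data.Fin.Properties as Fin
import Data.Fin.Subset as Subset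
open import Data.Fin.Subset using (Subset)
open import Data.Fin.Subset.Properties using () renaming (_∈?_ to _∈ˢ?_)
open import Data.List.Base using (List; []; _∷_; _++_; map; length; filter; lookup; allFin; take; upTo)
import Data.List.Membership.DecPropositional as DecMembership
open import Data.List.Membership.Propositional using (_∈_; _∉_)
open import Data.List.Membership.Propositional.Properties
  using (∈-++⁺ˡ; ∈-++⁺ʳ; ∈-++⁻; ∈-map⁺; ∈-map⁻; ∈-filter⁺; ∈-filter⁻; ∈-∃++; ∈-allFin; ∈-upTo⁻; ∈-lookup)
open import Data.List.Properties using (length-filter; length-take; take++drop≡id; length-++; length-map; length-upTo; length-tabulate; ++-assoc; ++-identityʳ; ∷-injective)
open import Data.List.Relation.Binary.Subset.Propositional using (_⊆_)
open import Data.List.Relation.Unary.All as All using (All; []; _∷_)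
import Data.List.Relation.Unary.All.Properties as All
open import Data.List.Relation.Unary.AllPairs using ([]; _∷_)
open import Data.List.Relation.Unary.Any using (here; there; index)
open import Data.List.Relation.Unary.Any.Properties using (lookup-index)
open import Data.List.Relation.Unary.Unique.Propositional using (Unique)
open import Data.List.Relation.Unary.Unique.Propositional.Properties using (++⁺; take⁺; upTo⁺; allFin⁺; filter⁺)
open import Data.Nat.Base using (ℕ; zero; suc; _+_; _≤_; _<_; _>_; _⊔_; z≤n; s≤s)
import Data.Nat.Properties as ℕ
open import Data.Product.Base using (Σ; ∃-syntax; _×_; _,_; proj₁; proj₂; map₂)
open import Data.Sum.Base using (_⊎_; inj₁; inj₂; [_,_]′; swap)
open import Data.Unit.Base using (tt)
import Data.Vec.Base as Vec
open import Data.Vec.Properties using (lookup∘tabulate; lookup⇒[]=; []=⇒lookup)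
open import Data.Vec.Properties.WithK using ([]=-irrelevant)
open import Function.Base using (_∘_; id; case_of_)
open import Function.Bundles using (mk⇔; module Equivalence)
open import Function.Construct.Identity using (↔-id)
open import Relation.Binary.Construct.Closure.ReflexiveTransitive using (Star; ε; _◅_)
open import Relation.Binary.PropositionalEquality
  using (_≡_; _≢_; refl; sym; trans; cong; cong₂; subst)
open import Relation.Nullary using (¬_; Dec; does; yes; no; contradiction; ¬?; _×-dec_)
open import Relation.Nullary.Decidable using (dec-true)
open import Defs

-- The solids are counted by their traces. Each one is built for a set of three neighbours of a
-- vertex or of four branch sets, and this set can be read off from the neighbours it contains or
-- the branch sets it meets. So a lift must lose nothing: every vertex other than the split one
-- stays, and at least one of its two successors is used. It would not do to find some small solid
-- inside the contracted set.
--
-- If one successor sees all neighbours of `u` in the configuration, it takes the place of `u`. The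
-- case distinction is about both missing one. Then the kind of solid can change: the common end of
-- three paths may open into a triangle, a triangle may break up and leave a common end, and a hub
-- may become an ear of its rim, which yields a wheel, a stamp or a prism. Hence all kinds have to
-- be lifted together.
--
-- Stamps with a path of length one are also wheels and are split as such, because splitting them as
-- three paths could leave a trihedron with a path of length one.

private
  variable
    m : ℕ
    G H : Graph (Fin m)
    d e f g h k p q r s t u v w x y z : Fin m
    ps qs rs : List (Fin m)

adj-sym : (G : Graph (Fin m)) → Adj G p q → Adj G q p
adj-sym G = Graph.sym G

no-loop : (G : Graph (Fin m)) → ¬ Adj G p p
no-loop G = Graph.irrefl G refl

adj⇒≢ : (G : Graph (Fin m)) → Adj G p q → p ≢ q
adj⇒≢ G e refl = no-loop G e

infix 4 _∈?_
_∈?_ : (p : Fin m) (ps : List (Fin m)) → Dec (p ∈ ps)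
_∈?_ = DecMembership._∈?_ Fin._≟_

∉-single : p ≢ q → p ∉ (q ∷ [])
∉-single p≢q (here p≡q) = p≢q p≡q

infix 4 _≐_
_≐_ : List (Fin m) → List (Fin m) → Set
ps ≐ qs = ps ⊆ qs × qs ⊆ ps

-- Induced paths

-- Each vertex is compared with the later ones only. As adjacency is symmetric, this makes the whole
-- list induced, and prepending a vertex never reopens earlier conditions.
data InducedPath (G : Graph (Fin m)) : Fin m → Fin m → List (Fin m) → Set where
  stop : InducedPath G f f (f ∷ [])
  step : Adj G f p → f ∉ ps → (∀ {q} → q ∈ ps → Adj G f q → q ≡ p) →
         InducedPath G p g ps → InducedPath G f g (f ∷ ps)

source∈ : InducedPath G f g ps → f ∈ ps
source∈ stop           = here refl
source∈ (step _ _ _ _) = here refl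

target∈ : InducedPath G f g ps → g ∈ ps
target∈ stop           = here refl
target∈ (step _ _ _ P) = there (target∈ P)

retarget : g ≡ h → InducedPath G f g ps → InducedPath G f h ps
retarget refl P = P

resource : f ≡ h → InducedPath G f g ps → InducedPath G h g ps
resource refl P = P

trivial-path : InducedPath G f f ps → p ∈ ps → p ≡ f
trivial-path stop           (here p≡f) = p≡f
trivial-path (step _ n _ P) _          = contradiction (target∈ P) n

snoc : InducedPath G f g ps → Adj G g h → h ∉ ps →
       (∀ {q} → q ∈ ps → Adj G h q → q ≡ g) → InducedPath G f h (ps ++ (h ∷ []))
snoc stop e n u = step e (∉-single (n ∘ here ∘ sym)) (λ { (here q≡h) _ → q≡h }) stop
snoc {G = G} {h = h} (step {f = f} {p = p} {ps = ps} e′ n′ u′ P) e n u =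
  step e′ fresh only (snoc P e (n ∘ there) (u ∘ there))
  where
  fresh : f ∉ ps ++ (h ∷ [])
  fresh i with ∈-++⁻ ps i
  ... | inj₁ j           = n′ j
  ... | inj₂ (here refl) = n (here refl)
  only : ∀ {q} → q ∈ ps ++ (h ∷ []) → Adj G f q → q ≡ p
  only i a with ∈-++⁻ ps i
  ... | inj₁ j           = u′ j a
  ... | inj₂ (here refl) = contradiction (subst (_∈ ps) (sym (u (here refl) (adj-sym G a))) (target∈ P)) n′

reverse-path : InducedPath G f g ps → ∃[ qs ] InducedPath G g f qs × qs ≐ ps
reverse-path stop = _ , stop , id , id
reverse-path {G = G} (step {f = f} {ps = ps} e n u P) with reverse-path P
... | qs , Q , qs⊆ps , ps⊆qs =
  qs ++ (f ∷ [])
  , snoc Q (adj-sym G e) (n ∘ qs⊆ps) (λ i a → u (qs⊆ps i) a)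
  , (λ i → [ there ∘ qs⊆ps , (λ { (here eq) → here eq }) ]′ (∈-++⁻ qs i))
  , (λ { (here eq) → ∈-++⁺ʳ qs (here eq) ; (there i) → ∈-++⁺ˡ (ps⊆qs i) })

append : InducedPath G f g ps → InducedPath G h k qs → Adj G g h →
         (∀ {p} → p ∈ ps → p ∉ qs) →
         (∀ {p q} → p ∈ ps → q ∈ qs → Adj G p q → p ≡ g × q ≡ h) →
         InducedPath G f k (ps ++ qs)
append stop Q e d c = step e (d (here refl)) (λ i a → proj₂ (c (here refl) i a)) Q
append {G = G} {qs = qs} (step {f = f} {p = p} {ps = ps} e′ n u P) Q e d c =
  step e′ fresh only (append P Q e (d ∘ there) (c ∘ there))
  where
  fresh : f ∉ ps ++ qs
  fresh i = [ n , d (here refl) ]′ (∈-++⁻ ps i)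
  only : ∀ {q} → q ∈ ps ++ qs → Adj G f q → q ≡ p
  only i a with ∈-++⁻ ps i
  ... | inj₁ j = u j a
  ... | inj₂ j = contradiction (subst (_∈ ps) (sym (proj₁ (c (here refl) j a))) (target∈ P)) n

-- Reduces to `append` by dropping `t` from the second path, whose next vertex is then the only one
-- that `t` sees there.
join : InducedPath G f t ps → InducedPath G t g qs →
       (∀ {p} → p ∈ ps → p ∈ qs → p ≡ t) →
       (∀ {p q} → p ∈ ps → q ∈ qs → Adj G p q → p ≡ t ⊎ q ≡ t) →
       ∃[ rs ] InducedPath G f g rs × (∀ {p} → p ∈ rs → p ∈ ps ⊎ p ∈ qs) × ps ⊆ rs × qs ⊆ rs
join P stop d c = _ , P , inj₁ , id , (λ { (here refl) → target∈ P })
join {t = t} {ps = ps} P (step {ps = qs} e n u Q) d c =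
  ps ++ qs
  , append P Q e
      (λ i j → n (subst (_∈ qs) (d i (there j)) j))
      (λ i j a → case c i (there j) a of λ
        { (inj₁ refl) → refl , u j a
        ; (inj₂ refl) → contradiction j n })
  , (λ i → [ inj₁ , inj₂ ∘ there ]′ (∈-++⁻ ps i))
  , ∈-++⁺ˡ
  , (λ { (here refl) → ∈-++⁺ˡ (target∈ P) ; (there i) → ∈-++⁺ʳ ps i })

-- The vertex `z` belongs to both parts, so that each of them is a path with end `z`; this is why
-- `cross` admits edges at `z`.
record Cut (G : Graph (Fin m)) (f g z : Fin m) (ps : List (Fin m)) : Set where
  field
    {left right} : List (Fin m)
    path-left    : InducedPath G f z left
    path-right   : InducedPath G z g right
    left⊆        : left ⊆ ps
    right⊆       : right ⊆ ps
    cover        : p ∈ ps → p ∈ left ⊎ p ∈ right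
    meet         : p ∈ left → p ∈ right → p ≡ z
    cross        : p ∈ left → q ∈ right → Adj G p q → p ≡ z ⊎ q ≡ z

cut : InducedPath G f g ps → z ∈ ps → Cut G f g z ps
cut P@stop (here refl) = record
  { path-left  = stop
  ; path-right = P
  ; left⊆      = id
  ; right⊆     = id
  ; cover      = inj₁
  ; meet       = λ { (here eq) _ → eq }
  ; cross      = λ { (here eq) _ _ → inj₁ eq }
  }
cut P@(step _ _ _ _) (here refl) = record
  { path-left  = stop
  ; path-right = P
  ; left⊆      = λ { (here eq) → here eq }
  ; right⊆     = id
  ; cover      = inj₂
  ; meet       = λ { (here eq) _ → eq }
  ; cross      = λ { (here eq) _ _ → inj₁ eq }
  }
cut {G = G} (step e n u P) (there i) = record
  { path-left  = step e (n ∘ C.left⊆) (λ j → u (C.left⊆ j)) C.path-left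
  ; path-right = C.path-right
  ; left⊆      = λ { (here eq) → here eq ; (there j) → there (C.left⊆ j) }
  ; right⊆     = there ∘ C.right⊆
  ; cover      = λ { (here eq) → inj₁ (here eq) ; (there j) → [ inj₁ ∘ there , inj₂ ]′ (C.cover j) }
  ; meet       = λ { (here refl) j → contradiction (C.right⊆ j) n ; (there i) j → C.meet i j }
  ; cross      = λ { (here refl) j a → inj₂ (C.meet (subst (_∈ C.left) (sym (u (C.right⊆ j) a)) (source∈ C.path-left)) j)
                   ; (there i) j a → C.cross i j a }
  }
  where module C = Cut (cut P i)

record CutEdge (G : Graph (Fin m)) (f g x y : Fin m) (ps : List (Fin m)) : Set where
  field
    {left right} : List (Fin m)
    path-left    : InducedPath G f x left
    path-right   : InducedPath G y g right
    left⊆        : left ⊆ ps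
    right⊆       : right ⊆ ps
    cover        : p ∈ ps → p ∈ left ⊎ p ∈ right
    disjoint     : p ∈ left → p ∉ right
    cross        : p ∈ left → q ∈ right → Adj G p q → p ≡ x × q ≡ y

prolong : Adj G f p → f ∉ ps → (∀ {q} → q ∈ ps → Adj G f q → q ≡ p) →
          CutEdge G p g x y ps → CutEdge G f g x y (f ∷ ps)
prolong e n u C = record
  { path-left  = step e (n ∘ left⊆) (λ k → u (left⊆ k)) path-left
  ; path-right = path-right
  ; left⊆      = λ { (here eq) → here eq ; (there k) → there (left⊆ k) }
  ; right⊆     = there ∘ right⊆
  ; cover      = λ { (here eq) → inj₁ (here eq) ; (there k) → [ inj₁ ∘ there , inj₂ ]′ (cover k) }
  ; disjoint   = λ { (here refl) k → n (right⊆ k) ; (there i) → disjoint i }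
  ; cross      = λ { (here refl) k b → contradiction k (disjoint (subst (_∈ left) (sym (u (right⊆ k) b)) (source∈ path-left)))
                   ; (there i) → cross i }
  }
  where open CutEdge C

-- The alternatives tell which end of the edge comes first. On an induced path adjacent vertices are
-- consecutive, so no vertex is lost between the two parts.
cut-edge : InducedPath G f g ps → x ∈ ps → y ∈ ps → Adj G x y →
           CutEdge G f g x y ps ⊎ CutEdge G f g y x ps
cut-edge {G = G} stop (here refl) (here refl) a = contradiction a (no-loop G)
cut-edge {G = G} (step _ _ _ _) (here refl) (here refl) a = contradiction a (no-loop G)
cut-edge {G = G} (step e n u P) (here refl) (there j) a with refl ← u j a = inj₁ record
  { path-left  = stop
  ; path-right = P
  ; left⊆      = λ { (here eq) → here eq }
  ; right⊆     = there
  ; cover      = λ { (here eq) → inj₁ (here eq) ; (there k) → inj₂ k }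
  ; disjoint   = λ { (here refl) → n }
  ; cross      = λ { (here refl) k b → refl , u k b }
  }
cut-edge {G = G} P@(step _ _ _ _) (there i) (here refl) a = swap (cut-edge P (here refl) (there i) (adj-sym G a))
cut-edge (step e n u P) (there i) (there j) a with cut-edge P i j a
... | inj₁ C = inj₁ (prolong e n u C)
... | inj₂ C = inj₂ (prolong e n u C)

-- Wheels and three-path configurations

three : ∀ {ℓ} {A : Set ℓ} → A → A → A → Fin 3 → A
three a b c zero             = a
three a b c (suc zero)       = b
three a b c (suc (suc zero)) = c

all-three : ∀ {ℓ} {P : Fin 3 → Set ℓ} → P zero → P (suc zero) → P (suc (suc zero)) → ∀ i → P i
all-three a b c zero             = a
all-three a b c (suc zero)       = b
all-three a b c (suc (suc zero)) = c

pairwise : {R : Fin 3 → Fin 3 → Set} → (∀ {i j} → R i j → R j i) →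
           R zero (suc zero) → R zero (suc (suc zero)) → R (suc zero) (suc (suc zero)) →
           ∀ {i j} → i ≢ j → R i j
pairwise σ a b c {zero}             {zero}             i≢j = contradiction refl i≢j
pairwise σ a b c {zero}             {suc zero}         i≢j = a
pairwise σ a b c {zero}             {suc (suc zero)}   i≢j = b
pairwise σ a b c {suc zero}         {zero}             i≢j = σ a
pairwise σ a b c {suc zero}         {suc zero}         i≢j = contradiction refl i≢j
pairwise σ a b c {suc zero}         {suc (suc zero)}   i≢j = c
pairwise σ a b c {suc (suc zero)}   {zero}             i≢j = σ b
pairwise σ a b c {suc (suc zero)}   {suc zero}         i≢j = σ c
pairwise σ a b c {suc (suc zero)}   {suc (suc zero)}   i≢j = contradiction refl i≢j

record Three (P : Fin m → Set) : Set where
  field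
    {a b c}     : Fin m
    Pa          : P a
    Pb          : P b
    Pc          : P c
    a≢b         : a ≢ b
    a≢c         : a ≢ c
    b≢c         : b ≢ c

three-map : {P Q : Fin m → Set} (φ : Fin m → Fin m) →
            (∀ {p} → P p → Q (φ p)) → (∀ {p q} → P p → P q → φ p ≡ φ q → p ≡ q) → Three P → Three Q
three-map φ F inj T = record
  { Pa  = F Pa
  ; Pb  = F Pb
  ; Pc  = F Pc
  ; a≢b = a≢b ∘ inj Pa Pb
  ; a≢c = a≢c ∘ inj Pa Pc
  ; b≢c = b≢c ∘ inj Pb Pc
  }
  where open Three T

-- Pigeonhole. It refutes the cases in which two attached vertices together see at most two vertices
-- of a cycle.
three-exceeds : {P : Fin m → Set} → Three P → ∀ p q → ¬ (∀ {r} → P r → r ≡ p ⊎ r ≡ q)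
three-exceeds T p q F with F (Three.Pa T) | F (Three.Pb T) | F (Three.Pc T)
... | inj₁ a≡ | inj₁ b≡ | _       = Three.a≢b T (trans a≡ (sym b≡))
... | inj₁ a≡ | inj₂ b≡ | inj₁ c≡ = Three.a≢c T (trans a≡ (sym c≡))
... | inj₁ a≡ | inj₂ b≡ | inj₂ c≡ = Three.b≢c T (trans b≡ (sym c≡))
... | inj₂ a≡ | inj₁ b≡ | inj₁ c≡ = Three.b≢c T (trans b≡ (sym c≡))
... | inj₂ a≡ | inj₁ b≡ | inj₂ c≡ = Three.a≢c T (trans a≡ (sym c≡))
... | inj₂ a≡ | inj₂ b≡ | _       = Three.a≢b T (trans a≡ (sym b≡))

-- An induced cycle, opened at the vertex apex.
record Rim (G : Graph (Fin m)) : Set where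
  field
    {apex first last} : Fin m
    {ring}            : List (Fin m)
    ring-path         : InducedPath G first last ring
    first≢last        : first ≢ last
    apex∉             : apex ∉ ring
    apex-first        : Adj G apex first
    apex-last         : Adj G apex last
    apex-only         : q ∈ ring → Adj G apex q → q ≡ first ⊎ q ≡ last

  circle : List (Fin m)
  circle = apex ∷ ring

record Wheel (G : Graph (Fin m)) : Set where
  field
    rim  : Rim G
    hub  : Fin m
    hub∉ : hub ∉ Rim.circle rim
    feet : Three (λ p → p ∈ Rim.circle rim × Adj G hub p)

record Arc (G : Graph (Fin m)) : Set where
  field
    {source target} : Fin m
    {verts}         : List (Fin m)
    path            : InducedPath G source target verts

open Arc

infix 4 _∈ᵃ_ _∉ᵃ_
_∈ᵃ_ _∉ᵃ_ : {G : Graph (Fin m)} → Fin m → Arc G → Set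
p ∈ᵃ P = p ∈ verts P
p ∉ᵃ P = p ∉ verts P

-- The ways in which adjacent vertices p ∈ P and q ∈ Q may lie in arcs P and Q that
-- are disjoint and without edges between them, except at their ends.
data Contact {m : ℕ} {G : Graph (Fin m)} (P Q : Arc G) (p q : Fin m) : Set where
  on-right : p ∈ᵃ Q → Contact P Q p q
  on-left  : q ∈ᵃ P → Contact P Q p q
  starts   : p ≡ source P → q ≡ source Q → Contact P Q p q
  ends     : p ≡ target P → q ≡ target Q → Contact P Q p q

record Meet {m : ℕ} {G : Graph (Fin m)} (P Q : Arc G) : Set where
  field
    apart : ∀ {p} → p ∈ᵃ P → p ∈ᵃ Q → (p ≡ source P × p ≡ source Q) ⊎ (p ≡ target P × p ≡ target Q)
    edge  : ∀ {p q} → p ∈ᵃ P → q ∈ᵃ Q → Adj G p q → Contact P Q p q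

meet-sym : {P Q : Arc G} → Meet P Q → Meet Q P
meet-sym {G = G} M = record
  { apart = λ i j → case apart j i of λ { (inj₁ (a , b)) → inj₁ (b , a) ; (inj₂ (a , b)) → inj₂ (b , a) }
  ; edge  = λ i j e → case edge j i (adj-sym G e) of λ
      { (on-right a) → on-left a ; (on-left a) → on-right a ; (starts a b) → starts b a ; (ends a b) → ends b a }
  }
  where open Meet M

data Joined (G : Graph (Fin m)) (φ : Fin 3 → Fin m) : Set where
  point   : (∀ i j → φ i ≡ φ j) → Joined G φ
  corners : (∀ {i j} → i ≢ j → Adj G (φ i) (φ j)) → Joined G φ

-- A stamp may contain a path of length one, a trihedron may not; hence `thin` speaks only of the
-- case of two common ends. There an edge between the ends would, as the arcs are induced, make all
-- three arcs equal to that edge.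
record ThreePaths (G : Graph (Fin m)) : Set where
  field
    arcs  : Fin 3 → Arc G
    meet  : ∀ {i j} → i ≢ j → Meet (arcs i) (arcs j)
    start : Joined G (λ i → source (arcs i))
    end   : Joined G (λ i → target (arcs i))
    long  : ∀ i → source (arcs i) ≢ target (arcs i)
    thin  : (∀ i j → source (arcs i) ≡ source (arcs j)) → (∀ i j → target (arcs i) ≡ target (arcs j)) →
            ∀ i → ¬ Adj G (source (arcs i)) (target (arcs i))

data Config (G : Graph (Fin m)) : Set where
  wheel       : Wheel G → Config G
  three-paths : ThreePaths G → Config G

infix 4 _∈ʷ_ _∈ᵗ_ _∈ᶜ_
_∈ʷ_ : {G : Graph (Fin m)} → Fin m → Wheel G → Set
p ∈ʷ W = p ∈ Wheel.hub W ∷ Rim.circle (Wheel.rim W)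

_∈ᵗ_ : {G : Graph (Fin m)} → Fin m → ThreePaths G → Set
p ∈ᵗ T = ∃[ i ] p ∈ᵃ ThreePaths.arcs T i

_∈ᶜ_ : {G : Graph (Fin m)} → Fin m → Config G → Set
p ∈ᶜ wheel W       = p ∈ʷ W
p ∈ᶜ three-paths T = p ∈ᵗ T

_∈ᶜ?_ : {G : Graph (Fin m)} (p : Fin m) (C : Config G) → Dec (p ∈ᶜ C)
p ∈ᶜ? wheel W       = p ∈? _
p ∈ᶜ? three-paths T = Fin.any? (λ i → p ∈? verts (ThreePaths.arcs T i))

-- Three-path configurations without their starting points

record Meetₜ {m : ℕ} {G : Graph (Fin m)} (P Q : Arc G) : Set where
  field
    apart : ∀ {p} → p ∈ᵃ P → p ∈ᵃ Q → p ≡ target P × p ≡ target Q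
    edge  : ∀ {p q} → p ∈ᵃ P → q ∈ᵃ Q → Adj G p q → p ∈ᵃ Q ⊎ q ∈ᵃ P ⊎ (p ≡ target P × q ≡ target Q)

meetₜ-sym : {P Q : Arc G} → Meetₜ P Q → Meetₜ Q P
meetₜ-sym {G = G} M = record
  { apart = λ i j → case apart j i of λ { (a , b) → b , a }
  ; edge  = λ i j e → case edge j i (adj-sym G e) of λ
      { (inj₁ a) → inj₂ (inj₁ a) ; (inj₂ (inj₁ a)) → inj₁ a ; (inj₂ (inj₂ (a , b))) → inj₂ (inj₂ (b , a)) }
  }
  where open Meetₜ M

-- What remains when a starting vertex is split. Only the targets are constrained, so `attach` is
-- free to put a start of another kind in front.
record Legs (G : Graph (Fin m)) : Set where
  field
    legs  : Fin 3 → Arc G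
    meetₜ : ∀ {i j} → i ≢ j → Meetₜ (legs i) (legs j)
    end   : Joined G (λ i → target (legs i))

-- `heads-only` has two alternatives because an edge from a head into another leg arises in two
-- ways: it ends in a vertex shared with the leg of that head, or the two heads coincide.
record Heads {m : ℕ} {G : Graph (Fin m)} (L : Legs G) (head : Fin 3 → Fin m) : Set where
  open Legs L
  field
    heads-adj   : ∀ i → Adj G (head i) (source (legs i))
    heads-fresh : ∀ i j → head i ∉ᵃ legs j
    heads-only  : ∀ {i j q} → q ∈ᵃ legs j → Adj G (head i) q →
                  q ≡ source (legs i) ⊎ (head i ≡ head j × q ≡ source (legs j))

attach : (L : Legs G) (head : Fin 3 → Fin m) → Heads L head → Joined G head →
         ((∀ i j → head i ≡ head j) → (∀ i j → target (Legs.legs L i) ≡ target (Legs.legs L j)) →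
          ∀ i → ¬ Adj G (head i) (target (Legs.legs L i))) →
         ThreePaths G
attach {G = G} L head Hd J thin = record
  { arcs  = arcs
  ; meet  = λ i≢j → record { apart = apart i≢j ; edge = edge i≢j }
  ; start = J
  ; end   = end
  ; long  = λ i eq → heads-fresh i i (subst (_∈ᵃ legs i) (sym eq) (target∈ (path (legs i))))
  ; thin  = thin
  }
  where
  open Legs L
  open Heads Hd
  arcs : Fin 3 → Arc G
  arcs i = record
    { path = step (heads-adj i) (heads-fresh i i) (λ q∈ a → [ id , proj₂ ]′ (heads-only {i} {i} q∈ a)) (path (legs i)) }
  apart : ∀ {i j p} → i ≢ j → p ∈ᵃ arcs i → p ∈ᵃ arcs j →
          (p ≡ head i × p ≡ head j) ⊎ (p ≡ target (legs i) × p ≡ target (legs j))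
  apart i≢j (here a)     (here b)     = inj₁ (a , b)
  apart {i} {j} i≢j (here refl)  (there b)    = contradiction b (heads-fresh i j)
  apart {i} {j} i≢j (there a)    (here refl)  = contradiction a (heads-fresh j i)
  apart i≢j (there a)    (there b)    = inj₂ (Meetₜ.apart (meetₜ i≢j) a b)
  edge : ∀ {i j p q} → i ≢ j → p ∈ᵃ arcs i → q ∈ᵃ arcs j → Adj G p q → Contact (arcs i) (arcs j) p q
  edge i≢j (here a) (here b) e = starts a b
  edge {i} {j} i≢j (here refl) (there b) e with heads-only {i} {j} b e
  ... | inj₁ refl     = on-left (there (source∈ (path (legs i))))
  ... | inj₂ (eq , _) = on-right (here eq)
  edge {i} {j} i≢j (there a) (here refl) e with heads-only {j} {i} a (adj-sym G e)
  ... | inj₁ refl     = on-right (there (source∈ (path (legs j))))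
  ... | inj₂ (eq , _) = on-left (here eq)
  edge i≢j (there a) (there b) e with Meetₜ.edge (meetₜ i≢j) a b e
  ... | inj₁ c              = on-right (there c)
  ... | inj₂ (inj₁ c)       = on-left (there c)
  ... | inj₂ (inj₂ (c , d)) = ends c d

record Uncons (G : Graph (Fin m)) (f g : Fin m) (ps : List (Fin m)) : Set where
  field
    {next} : Fin m
    {rest} : List (Fin m)
    split  : ps ≡ f ∷ rest
    adj    : Adj G f next
    fresh  : f ∉ rest
    only   : q ∈ rest → Adj G f q → q ≡ next
    path   : InducedPath G next g rest

  rest⊆ : rest ⊆ ps
  rest⊆ i rewrite split = there i

  cover : p ∈ ps → p ≡ f ⊎ p ∈ rest
  cover i rewrite split with i
  ... | here eq = inj₁ eq
  ... | there j = inj₂ j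

uncons : InducedPath G f g ps → f ≢ g → Uncons G f g ps
uncons stop f≢f = contradiction refl f≢f
uncons (step e n u P) _ = record { split = refl ; adj = e ; fresh = n ; only = u ; path = P }

record Stripped {m : ℕ} {G : Graph (Fin m)} (T : ThreePaths G) : Set where
  open ThreePaths T using (arcs)
  field
    rest    : Legs G
    heads   : Heads rest (λ i → source (arcs i))
    target≡ : ∀ i → target (Legs.legs rest i) ≡ target (arcs i)
    split   : ∀ i → verts (arcs i) ≡ source (arcs i) ∷ verts (Legs.legs rest i)

  open Legs rest public using (legs ; meetₜ)
  open Heads heads public

  legs⊆ : ∀ {p} i → p ∈ᵃ legs i → p ∈ᵃ arcs i
  legs⊆ i p∈ rewrite split i = there p∈

  cover : ∀ {p} i → p ∈ᵃ arcs i → p ≡ source (arcs i) ⊎ p ∈ᵃ legs i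
  cover i p∈ rewrite split i with p∈
  ... | here eq = inj₁ eq
  ... | there j = inj₂ j

strip : (T : ThreePaths G) → Stripped T
strip {G = G} T = record
  { rest    = record { legs = legs ; meetₜ = meetₜ ; end = end }
  ; heads   = record { heads-adj = U.adj ; heads-fresh = fresh ; heads-only = only }
  ; target≡ = λ i → refl
  ; split   = U.split
  }
  where
  open ThreePaths T
  unconsᵢ : ∀ i → Uncons G (source (arcs i)) (target (arcs i)) (verts (arcs i))
  unconsᵢ i = uncons (path (arcs i)) (long i)
  module U i = Uncons (unconsᵢ i)
  legs : Fin 3 → Arc G
  legs i = record { path = U.path i }
  fresh : ∀ i j → source (arcs i) ∉ᵃ legs j
  fresh i j b with i Fin.≟ j
  ... | yes refl = U.fresh i b
  ... | no i≢j with Meet.apart (meet i≢j) (source∈ (path (arcs i))) (U.rest⊆ j b)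
  ...   | inj₁ (_ , eq) = U.fresh j (subst (_∈ᵃ legs j) eq b)
  ...   | inj₂ (eq , _) = long i eq
  only : ∀ {i j q} → q ∈ᵃ legs j → Adj G (source (arcs i)) q →
         q ≡ U.next i ⊎ (source (arcs i) ≡ source (arcs j) × q ≡ U.next j)
  only {i} {j} b e with i Fin.≟ j
  ... | yes refl = inj₁ (U.only i b e)
  ... | no i≢j with Meet.edge (meet i≢j) (source∈ (path (arcs i))) (U.rest⊆ j b) e
  ...   | starts _ refl = contradiction b (U.fresh j)
  ...   | ends eq _     = contradiction eq (long i)
  ...   | on-left c with U.cover i c
  ...     | inj₁ refl = contradiction b (fresh i j)
  ...     | inj₂ d    = inj₁ (U.only i d e)
  only {i} {j} b e | no i≢j | on-right c with Meet.apart (meet i≢j) (source∈ (path (arcs i))) c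
  ...     | inj₁ (_ , eq) = inj₂ (eq , U.only j b (subst (λ r → Adj G r _) eq e))
  ...     | inj₂ (eq , _) = contradiction eq (long i)
  meetₜ : ∀ {i j} → i ≢ j → Meetₜ (legs i) (legs j)
  meetₜ {i} {j} i≢j = record { apart = apart ; edge = edge }
    where
    apart : p ∈ᵃ legs i → p ∈ᵃ legs j → p ≡ target (arcs i) × p ≡ target (arcs j)
    apart a b with Meet.apart (meet i≢j) (U.rest⊆ i a) (U.rest⊆ j b)
    ... | inj₁ (refl , _) = contradiction a (U.fresh i)
    ... | inj₂ c          = c
    edge : p ∈ᵃ legs i → q ∈ᵃ legs j → Adj G p q →
           p ∈ᵃ legs j ⊎ q ∈ᵃ legs i ⊎ (p ≡ target (arcs i) × q ≡ target (arcs j))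
    edge a b e with Meet.edge (meet i≢j) (U.rest⊆ i a) (U.rest⊆ j b) e
    ... | starts refl _ = contradiction a (U.fresh i)
    ... | ends c d      = inj₂ (inj₂ (c , d))
    ... | on-right c with U.cover j c
    ...   | inj₁ refl = contradiction a (fresh j i)
    ...   | inj₂ d    = inj₁ d
    edge a b e | on-left c with U.cover i c
    ...   | inj₁ refl = contradiction b (fresh i j)
    ...   | inj₂ d    = inj₂ (inj₁ d)

-- Permuting and reversing the three paths

permute : (σ : Fin 3 → Fin 3) → (∀ i → σ (σ i) ≡ i) → ThreePaths G → ThreePaths G
permute {G = G} σ σσ T = record
  { arcs  = arcs ∘ σ
  ; meet  = λ i≢j → meet (λ eq → i≢j (inj eq))
  ; start = permute-joined start
  ; end   = permute-joined end
  ; long  = long ∘ σ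
  ; thin  = λ s t i → thin (λ i j → unpermute {source ∘ arcs} s i j) (λ i j → unpermute {target ∘ arcs} t i j) (σ i)
  }
  where
  open ThreePaths T
  inj : ∀ {i j} → σ i ≡ σ j → i ≡ j
  inj {i} {j} eq = trans (sym (σσ i)) (trans (cong σ eq) (σσ j))
  permute-joined : {φ : Fin 3 → Fin _} → Joined G φ → Joined G (φ ∘ σ)
  permute-joined (point e)   = point (λ i j → e (σ i) (σ j))
  permute-joined (corners e) = corners (λ i≢j → e (i≢j ∘ inj))
  unpermute : {φ : Fin 3 → Fin _} → (∀ i j → φ (σ i) ≡ φ (σ j)) → ∀ i j → φ i ≡ φ j
  unpermute {φ} s i j = trans (cong φ (sym (σσ i))) (trans (s (σ i) (σ j)) (cong φ (σσ j)))

-- The transposition of `zero` and the given index. It moves an arbitrary arc to the front, and,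
-- being an involution, it also moves it back.
exchange : Fin 3 → Fin 3 → Fin 3
exchange zero             = id
exchange (suc zero)       = three (suc zero) zero (suc (suc zero))
exchange (suc (suc zero)) = three (suc (suc zero)) (suc zero) zero

exchange-involutive : ∀ i j → exchange i (exchange i j) ≡ j
exchange-involutive zero             _                = refl
exchange-involutive (suc zero)       zero             = refl
exchange-involutive (suc zero)       (suc zero)       = refl
exchange-involutive (suc zero)       (suc (suc zero)) = refl
exchange-involutive (suc (suc zero)) zero             = refl
exchange-involutive (suc (suc zero)) (suc zero)       = refl
exchange-involutive (suc (suc zero)) (suc (suc zero)) = refl

exchange-zero : ∀ i → exchange i zero ≡ i
exchange-zero zero             = refl
exchange-zero (suc zero)       = refl
exchange-zero (suc (suc zero)) = refl

∈-permute : (σ : Fin 3 → Fin 3) (σσ : ∀ i → σ (σ i) ≡ i) (T : ThreePaths G) →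
            p ∈ᵗ T → p ∈ᵗ permute σ σσ T
∈-permute {p = p} σ σσ T (i , p∈) = σ i , subst (λ j → p ∈ᵃ ThreePaths.arcs T j) (sym (σσ i)) p∈

reverse-arc : Arc G → Arc G
reverse-arc P = record { path = proj₁ (proj₂ (reverse-path (path P))) }

∈-reverse : (P : Arc G) → p ∈ᵃ P → p ∈ᵃ reverse-arc P
∈-reverse P = proj₂ (proj₂ (proj₂ (reverse-path (path P))))

∈-reverse⁻ : (P : Arc G) → p ∈ᵃ reverse-arc P → p ∈ᵃ P
∈-reverse⁻ P = proj₁ (proj₂ (proj₂ (reverse-path (path P))))

reverse-all : ThreePaths G → ThreePaths G
reverse-all {G = G} T = record
  { arcs  = arcs′
  ; meet  = λ i≢j → record { apart = apart i≢j ; edge = edge i≢j }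
  ; start = end
  ; end   = start
  ; long  = λ i eq → long i (sym eq)
  ; thin  = λ s t i e → thin t s i (adj-sym G e)
  }
  where
  open ThreePaths T
  arcs′ : Fin 3 → Arc G
  arcs′ i = reverse-arc (arcs i)
  apart : ∀ {i j p} → i ≢ j → p ∈ᵃ arcs′ i → p ∈ᵃ arcs′ j →
          (p ≡ target (arcs i) × p ≡ target (arcs j)) ⊎ (p ≡ source (arcs i) × p ≡ source (arcs j))
  apart {i} {j} i≢j a b = swap (Meet.apart (meet i≢j) (∈-reverse⁻ (arcs i) a) (∈-reverse⁻ (arcs j) b))
  edge : ∀ {i j p q} → i ≢ j → p ∈ᵃ arcs′ i → q ∈ᵃ arcs′ j → Adj G p q → Contact (arcs′ i) (arcs′ j) p q
  edge {i} {j} i≢j a b e with Meet.edge (meet i≢j) (∈-reverse⁻ (arcs i) a) (∈-reverse⁻ (arcs j) b) e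
  ... | on-right c = on-right (∈-reverse (arcs j) c)
  ... | on-left c  = on-left (∈-reverse (arcs i) c)
  ... | starts c d = ends c d
  ... | ends c d   = starts c d

-- If one of the paths from a triangle to a point has length 1, then its corner is
-- adjacent to the two other corners and to the point, and hence is a hub.
short⇒wheel : (T : ThreePaths G) → (∀ {i j} → i ≢ j → Adj G (source (ThreePaths.arcs T i)) (source (ThreePaths.arcs T j))) →
              (∀ i j → target (ThreePaths.arcs T i) ≡ target (ThreePaths.arcs T j)) →
              Adj G (source (ThreePaths.arcs T zero)) (target (ThreePaths.arcs T zero)) →
              ∃[ W ] (∀ {p} → p ∈ᵗ T → p ∈ʷ W) × (∀ {p} → p ∈ʷ W → p ∈ᵗ T)
short⇒wheel {m} {G = G} T corner tip short = W , to , from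
  where
  open ThreePaths T
  open Stripped (strip T)
  one two : Fin 3
  one = suc zero
  two = suc (suc zero)
  h₀ h₁ h₂ : Fin m
  h₀ = source (arcs zero)
  h₁ = source (arcs one)
  h₂ = source (arcs two)
  back : InducedPath G (target (arcs two)) (source (legs one)) (verts (reverse-arc (legs one)))
  back = resource (trans (target≡ one) (tip one two)) (path (reverse-arc (legs one)))
  only-tip : p ∈ᵃ arcs two → p ∈ᵃ arcs one → p ≡ target (arcs two)
  only-tip a b with Meet.apart (meet {two} {one} (λ ())) a b
  ... | inj₁ (eq , eq′) = contradiction (trans (sym eq) eq′) (adj⇒≢ G (corner {two} {one} (λ ())))
  ... | inj₂ (eq , _)   = eq
  crossing : p ∈ᵃ arcs two → q ∈ᵃ legs one → Adj G p q → p ≡ target (arcs two) ⊎ q ≡ target (arcs two)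
  crossing a b e with Meet.edge (meet {two} {one} (λ ())) a (legs⊆ one b) e
  ... | on-right c    = inj₁ (only-tip a c)
  ... | on-left c     = inj₂ (only-tip c (legs⊆ one b))
  ... | starts _ refl = contradiction b (heads-fresh one one)
  ... | ends c _      = inj₁ c
  -- The rim opened at `h₁`: out along arc two to the common target and back along leg one.
  joined : ∃[ rs ] InducedPath G h₂ (source (legs one)) rs
           × (∀ {p} → p ∈ rs → p ∈ᵃ arcs two ⊎ p ∈ᵃ reverse-arc (legs one))
           × verts (arcs two) ⊆ rs × verts (reverse-arc (legs one)) ⊆ rs
  joined = join (path (arcs two)) back
    (λ i j → only-tip i (legs⊆ one (∈-reverse⁻ (legs one) j)))
    (λ i j → crossing i (∈-reverse⁻ (legs one) j))
  round : List (Fin m)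
  round = proj₁ joined
  round⁻ : p ∈ round → p ∈ᵃ arcs two ⊎ p ∈ᵃ legs one
  round⁻ i = [ inj₁ , inj₂ ∘ ∈-reverse⁻ (legs one) ]′ (proj₁ (proj₂ (proj₂ joined)) i)
  arc⊆round : p ∈ᵃ arcs two → p ∈ round
  arc⊆round = proj₁ (proj₂ (proj₂ (proj₂ joined)))
  leg⊆round : p ∈ᵃ legs one → p ∈ round
  leg⊆round i = proj₂ (proj₂ (proj₂ (proj₂ joined))) (∈-reverse (legs one) i)
  fresh : ∀ {i} → i ≢ two → source (arcs i) ∉ round
  fresh {i} i≢2 r with round⁻ r
  ... | inj₂ b = heads-fresh i one b
  ... | inj₁ b with cover two b
  ...   | inj₁ eq = adj⇒≢ G (corner i≢2) eq
  ...   | inj₂ c  = heads-fresh i two c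
  apex-only : q ∈ round → Adj G h₁ q → q ≡ h₂ ⊎ q ≡ source (legs one)
  apex-only r e with round⁻ r
  ... | inj₂ b = inj₂ ([ id , proj₂ ]′ (heads-only {one} {one} b e))
  ... | inj₁ b with cover two b
  ...   | inj₁ eq = inj₁ eq
  ...   | inj₂ c with heads-only {one} {two} c e
  ...     | inj₁ eq       = inj₂ eq
  ...     | inj₂ (eq , _) = contradiction eq (adj⇒≢ G (corner {one} {two} (λ ())))
  W : Wheel G
  W = record
    { rim  = record
      { ring-path     = proj₁ (proj₂ joined)
      ; first≢last    = λ eq → heads-fresh two one (subst (_∈ᵃ legs one) (sym eq) (source∈ (path (legs one))))
      ; apex∉         = fresh {one} (λ ())
      ; apex-first    = corner {one} {two} (λ ())
      ; apex-last     = heads-adj one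
      ; apex-only     = apex-only
      }
    ; hub  = h₀
    ; hub∉ = λ { (here eq) → adj⇒≢ G (corner {zero} {one} (λ ())) eq ; (there i) → fresh {zero} (λ ()) i }
    ; feet = record
      { Pa  = here refl , corner {zero} {one} (λ ())
      ; Pb  = there (arc⊆round (source∈ (path (arcs two)))) , corner {zero} {two} (λ ())
      ; Pc  = there (arc⊆round (target∈ (path (arcs two)))) , subst (Adj G h₀) (tip zero two) short
      ; a≢b = adj⇒≢ G (corner {one} {two} (λ ()))
      ; a≢c = λ eq → long one (trans eq (tip two one))
      ; b≢c = long two
      }
    }
  -- Arc zero is induced and its ends are adjacent, so its leg is the common target alone and lies
  -- on the rim already.
  leg₀ : p ∈ᵃ legs zero → p ≡ target (arcs two)
  leg₀ p∈ = trans (trivial-path trivial p∈) (trans (sym eq) (tip zero two))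
    where
    eq : target (arcs zero) ≡ source (legs zero)
    eq = [ id , proj₂ ]′ (heads-only {zero} {zero}
           (subst (_∈ᵃ legs zero) (target≡ zero) (target∈ (path (legs zero)))) short)
    trivial : InducedPath G (source (legs zero)) (source (legs zero)) (verts (legs zero))
    trivial = retarget (trans (target≡ zero) eq) (path (legs zero))
  to : p ∈ᵗ T → p ∈ʷ W
  to (zero , p∈) with cover zero p∈
  ... | inj₁ eq = here eq
  ... | inj₂ j  = there (there (subst (_∈ round) (sym (leg₀ j)) (arc⊆round (target∈ (path (arcs two))))))
  to (suc zero , p∈) with cover one p∈
  ... | inj₁ eq = there (here eq)
  ... | inj₂ j  = there (there (leg⊆round j))
  to (suc (suc zero) , p∈) = there (there (arc⊆round p∈))
  from : p ∈ʷ W → p ∈ᵗ T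
  from (here refl)         = zero , source∈ (path (arcs zero))
  from (there (here refl)) = one , source∈ (path (arcs one))
  from (there (there i))   = [ (λ j → two , j) , (λ j → one , legs⊆ one j) ]′ (round⁻ i)

-- Rotating and reversing an induced cycle

rotate₁ : (R : Rim G) → Σ (Rim G) λ R′ →
          Rim.apex R′ ≡ Rim.first R ×
          ∃[ ps ] Rim.ring R ≡ Rim.first R ∷ ps × Rim.ring R′ ≡ ps ++ (Rim.apex R ∷ [])
rotate₁ {m} {G = G} R = R′ , refl , U.rest , U.split , refl
  where
  open Rim R
  module U = Uncons (uncons ring-path first≢last)
  R′ : Rim G
  R′ = record
    { apex          = first
    ; ring-path     = snoc U.path (adj-sym G apex-last) (apex∉ ∘ U.rest⊆)
        (λ i e → case apex-only (U.rest⊆ i) e of λ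
          { (inj₁ refl) → contradiction i U.fresh ; (inj₂ eq) → eq })
    ; first≢last    = λ eq → apex∉ (U.rest⊆ (subst (_∈ U.rest) eq (source∈ U.path)))
    ; apex∉         = λ i → case ∈-++⁻ U.rest i of λ
        { (inj₁ j) → U.fresh j ; (inj₂ (here refl)) → no-loop G apex-first }
    ; apex-first    = U.adj
    ; apex-last     = adj-sym G apex-first
    ; apex-only     = λ i e → case ∈-++⁻ U.rest i of λ
        { (inj₁ j) → inj₁ (U.only j e) ; (inj₂ (here eq)) → inj₂ eq }
    }

≐-trans : ps ≐ qs → qs ≐ rs → ps ≐ rs
≐-trans (a , b) (c , d) = (λ i → c (a i)) , (λ i → b (d i))

rotate : (R : Rim G) → z ∈ Rim.circle R → Σ (Rim G) λ R′ → Rim.apex R′ ≡ z × Rim.circle R ≐ Rim.circle R′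
rotate R (here refl) = R , refl , id , id
rotate {G = G} {z = z} R (there i) = along (Rim.ring R) [] R (sym (++-identityʳ (Rim.ring R))) i
  where
  -- `qs` is the part of the original ring still to come, and `rs` collects the former apices that
  -- `rotate₁` has put at the end.
  along : ∀ qs rs (R : Rim G) → Rim.ring R ≡ qs ++ rs → z ∈ qs →
          Σ (Rim G) λ R′ → Rim.apex R′ ≡ z × Rim.circle R ≐ Rim.circle R′
  along (q ∷ qs) rs R eq i with rotate₁ R
  ... | R′ , apex≡ , ps , split , ring≡ with ∷-injective (trans (sym split) eq)
  ...   | first≡q , ps≡ = go i
    where
    same : Rim.circle R ≐ Rim.circle R′
    same rewrite split | ring≡ | apex≡ =
      (λ { (here refl) → there (∈-++⁺ʳ ps (here refl)) ; (there (here refl)) → here refl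
         ; (there (there j)) → there (∈-++⁺ˡ j) })
      , (λ { (here refl) → there (here refl)
           ; (there j) → [ there ∘ there , (λ { (here refl) → here refl }) ]′ (∈-++⁻ ps j) })
    go : z ∈ q ∷ qs → Σ (Rim G) λ R″ → Rim.apex R″ ≡ z × Rim.circle R ≐ Rim.circle R″
    go (here refl) = R′ , trans apex≡ first≡q , same
    go (there j) with along qs (rs ++ (Rim.apex R ∷ [])) R′
                        (trans ring≡ (trans (cong (_++ (Rim.apex R ∷ [])) ps≡) (++-assoc qs rs _))) j
    ... | R″ , apex≡z , same′ = R″ , apex≡z , ≐-trans same same′

-- Configurations consisting of an induced cycle and at most two further vertices

ConfigOn : (G : Graph (Fin m)) → (Fin m → Set) → Set
ConfigOn G P = Σ (Config G) λ C → (∀ {p} → p ∈ᶜ C → P p) × (∀ {p} → P p → p ∈ᶜ C)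

configOn-resp : {P Q : Fin m → Set} → (∀ {p} → P p → Q p) → (∀ {p} → Q p → P p) →
                ConfigOn G P → ConfigOn G Q
configOn-resp to from (C , a , b) = C , to ∘ a , b ∘ from

edge-path : Adj G p q → InducedPath G p q (p ∷ q ∷ [])
edge-path {G = G} e = step e (∉-single (adj⇒≢ G e)) (λ { (here eq) _ → eq }) stop

all-equal : {φ : Fin 3 → Fin m} → (∀ i → φ i ≡ p) → ∀ i j → φ i ≡ φ j
all-equal e i j = trans (e i) (sym (e j))

reverse-rim : (R : Rim G) → Σ (Rim G) λ R′ → Rim.apex R′ ≡ Rim.apex R × Rim.first R′ ≡ Rim.last R ×
              Rim.last R′ ≡ Rim.first R × Rim.circle R ≐ Rim.circle R′
reverse-rim {G = G} R with reverse-path (Rim.ring-path R)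
... | qs , Q , to , from = R′ , refl , refl , refl , under from , under to
  where
  open Rim R
  R′ : Rim G
  R′ = record
    { ring-path  = Q
    ; first≢last = first≢last ∘ sym
    ; apex∉      = apex∉ ∘ to
    ; apex-first = apex-last
    ; apex-last  = apex-first
    ; apex-only  = λ i e → swap (apex-only (to i) e)
    }
  under : ∀ {ps qs} → ps ⊆ qs → apex ∷ ps ⊆ apex ∷ qs
  under F (here eq) = here eq
  under F (there i) = there (F i)

-- The two neighbours of `d` on the cycle are not adjacent. They are the ends of three paths: the
-- one through `d` and the two sides of the cycle.
theta-at-apex : (R : Rim G) → d ∉ Rim.circle R → Adj G d (Rim.apex R) → g ∈ Rim.ring R → Adj G d g →
                (∀ {q} → q ∈ Rim.circle R → Adj G d q → q ≡ Rim.apex R ⊎ q ≡ g) →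
                ¬ Adj G (Rim.apex R) g → ConfigOn G (λ p → p ∈ d ∷ Rim.circle R)
theta-at-apex {m} {G = G} {d = d} {g = g} R d∉ da g∈ dg only ¬ag =
  three-paths (attach L (λ _ → apex) heads (point (λ _ _ → refl)) (λ _ _ → thin)) , to , from
  where
  open Rim R
  module C = Cut (cut ring-path g∈)
  P₀ P₁ P₂ : Arc G
  P₀ = record { path = edge-path dg }
  P₁ = record { path = C.path-left }
  P₂ = reverse-arc (record { path = C.path-right })
  right : p ∈ᵃ P₂ → p ∈ C.right
  right = ∈-reverse⁻ (record { path = C.path-right })
  right⁻ : p ∈ C.right → p ∈ᵃ P₂
  right⁻ = ∈-reverse (record { path = C.path-right })
  legs : Fin 3 → Arc G
  legs = three P₀ P₁ P₂
  g≢a : g ≢ apex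
  g≢a refl = apex∉ g∈
  via-d : {P : Arc G} → target P ≡ g → (∀ {p} → p ∈ᵃ P → p ∈ ring) → Meetₜ P₀ P
  via-d {P} refl P⊆ = record
    { apart = λ { (here refl) i → contradiction (there (P⊆ i)) d∉ ; (there (here refl)) _ → refl , refl }
    ; edge  = λ { (here refl) i e → case only (there (P⊆ i)) e of λ
                    { (inj₁ refl) → contradiction (P⊆ i) apex∉
                    ; (inj₂ eq) → inj₂ (inj₁ (there (here eq))) }
                ; (there (here refl)) _ _ → inj₁ (target∈ (path P)) }
    }
  sides : Meetₜ P₁ P₂
  sides = record
    { apart = λ i j → let eq = C.meet i (right j) in eq , eq
    ; edge  = λ i j e → case C.cross i (right j) e of λ
        { (inj₁ refl) → inj₁ (right⁻ (source∈ C.path-right))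
        ; (inj₂ refl) → inj₂ (inj₁ (target∈ C.path-left)) }
    }
  targets : ∀ i → target (legs i) ≡ g
  targets = all-three refl refl refl
  L : Legs G
  L = record
    { legs  = legs
    ; meetₜ = pairwise {R = λ i j → Meetₜ (legs i) (legs j)} meetₜ-sym
        (via-d {P₁} refl C.left⊆) (via-d {P₂} refl (C.right⊆ ∘ right)) sides
    ; end   = point (all-equal targets)
    }
  only-source : ∀ j {q} → q ∈ᵃ legs j → Adj G apex q → q ≡ source (legs j)
  only-source zero             (here eq)          e = eq
  only-source zero             (there (here refl)) e = contradiction e ¬ag
  only-source (suc zero)       i                  e = case apex-only (C.left⊆ i) e of λ
    { (inj₁ eq)   → eq
    ; (inj₂ refl) → contradiction (subst (Adj G apex) (C.meet i (target∈ C.path-right)) e) ¬ag }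
  only-source (suc (suc zero)) i                  e = case apex-only (C.right⊆ (right i)) e of λ
    { (inj₂ eq)   → eq
    ; (inj₁ refl) → contradiction (subst (Adj G apex) (C.meet (source∈ C.path-left) (right i)) e) ¬ag }
  heads : Heads L (λ _ → apex)
  heads = record
    { heads-adj   = all-three (adj-sym G da) apex-first apex-last
    ; heads-fresh = λ _ → all-three
        (λ { (here eq) → adj⇒≢ G da (sym eq) ; (there (here eq)) → g≢a (sym eq) })
        (apex∉ ∘ C.left⊆) (apex∉ ∘ C.right⊆ ∘ right)
    ; heads-only  = λ {i} {j} i∈ e → inj₂ (refl , only-source j i∈ e)
    }
  thin : ∀ i → ¬ Adj G apex (target (legs i))
  thin i = ¬ag ∘ subst (Adj G apex) (targets i)
  T : ThreePaths G
  T = attach L (λ _ → apex) heads (point (λ _ _ → refl)) (λ _ _ → thin)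
  to : p ∈ᵗ T → p ∈ d ∷ circle
  to (_ , here eq)                               = there (here eq)
  to (zero , there (here eq))                    = here eq
  to (zero , there (there (here refl)))          = there (there g∈)
  to (suc zero , there i)                        = there (there (C.left⊆ i))
  to (suc (suc zero) , there i)                  = there (there (C.right⊆ (right i)))
  from : p ∈ d ∷ circle → p ∈ᵗ T
  from (here eq)         = zero , there (here eq)
  from (there (here eq)) = zero , here eq
  from (there (there i)) = [ (λ j → suc zero , there j) , (λ j → suc (suc zero) , there (right⁻ j)) ]′ (C.cover i)

-- The triangle is `d`, `p`, `q`, the tip is the apex. One path goes through `e`; the other two are
-- the sides of the cycle, obtained by cutting the edge `p q`.
stamp-at-apex : (R : Rim G) → d ∉ Rim.circle R → e ∉ Rim.circle R → Adj G d e →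
                CutEdge G (Rim.first R) (Rim.last R) p q (Rim.ring R) → Adj G p q →
                Adj G d p → Adj G d q →
                (∀ {r} → r ∈ Rim.circle R → Adj G d r → r ≡ p ⊎ r ≡ q) →
                Adj G e (Rim.apex R) → (∀ {r} → r ∈ Rim.circle R → Adj G e r → r ≡ Rim.apex R) →
                ConfigOn G (λ r → r ∈ d ∷ e ∷ Rim.circle R)
stamp-at-apex {m} {G = G} {d = d} {e = e} {p = p} {q = q} R d∉ e∉ de C pq dp dq d-only ea e-only =
  three-paths T , to , from
  where
  open Rim R
  module C = CutEdge C
  P₀ P₁ P₂ : Arc G
  P₀ = record { path = edge-path (adj-sym G de) }
  P₁ = record { path = C.path-left }
  P₂ = reverse-arc (record { path = C.path-right })
  right : r ∈ᵃ P₂ → r ∈ C.right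
  right = ∈-reverse⁻ (record { path = C.path-right })
  right⁻ : r ∈ C.right → r ∈ᵃ P₂
  right⁻ = ∈-reverse (record { path = C.path-right })
  legs : Fin 3 → Arc G
  legs = three P₀ P₁ P₂
  ear : {P : Arc G} → (∀ {r} → r ∈ᵃ P → r ∈ ring) → (∀ {r} → r ∈ᵃ P → Adj G d r → r ≡ target P) → Meetₜ P₀ P
  ear P⊆ only = record
    { apart = λ { (here refl) i → contradiction (there (P⊆ i)) e∉ ; (there (here refl)) i → contradiction (there (P⊆ i)) d∉ }
    ; edge  = λ { (here refl) i a → contradiction (subst (_∈ ring) (e-only (there (P⊆ i)) a) (P⊆ i)) apex∉
                ; (there (here refl)) i a → inj₂ (inj₂ (refl , only i a)) }
    }
  left-only : r ∈ C.left → Adj G d r → r ≡ p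
  left-only i a = case d-only (there (C.left⊆ i)) a of λ
    { (inj₁ eq) → eq ; (inj₂ refl) → contradiction (source∈ C.path-right) (C.disjoint i) }
  right-only : r ∈ C.right → Adj G d r → r ≡ q
  right-only i a = case d-only (there (C.right⊆ i)) a of λ
    { (inj₂ eq) → eq ; (inj₁ refl) → contradiction i (C.disjoint (target∈ C.path-left)) }
  sides : Meetₜ P₁ P₂
  sides = record
    { apart = λ i j → contradiction (right j) (C.disjoint i)
    ; edge  = λ i j a → inj₂ (inj₂ (C.cross i (right j) a))
    }
  L : Legs G
  L = record
    { legs  = legs
    ; meetₜ = pairwise {R = λ i j → Meetₜ (legs i) (legs j)} meetₜ-sym
        (ear {P₁} C.left⊆ left-only) (ear {P₂} (C.right⊆ ∘ right) (right-only ∘ right)) sides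
    ; end   = corners (pairwise {R = λ i j → Adj G (target (legs i)) (target (legs j))} (adj-sym G) dp dq pq)
    }
  only-source : ∀ j {r} → r ∈ᵃ legs j → Adj G apex r → r ≡ source (legs j)
  only-source zero             (here eq)           a = eq
  only-source zero             (there (here refl)) a = ⊥-elim (case d-only (here refl) (adj-sym G a) of λ
    { (inj₁ refl) → apex∉ (C.left⊆ (target∈ C.path-left)) ; (inj₂ refl) → apex∉ (C.right⊆ (source∈ C.path-right)) })
  only-source (suc zero)       i                   a = case apex-only (C.left⊆ i) a of λ
    { (inj₁ eq) → eq ; (inj₂ refl) → contradiction (target∈ C.path-right) (C.disjoint i) }
  only-source (suc (suc zero)) i                   a = case apex-only (C.right⊆ (right i)) a of λ
    { (inj₂ eq) → eq ; (inj₁ refl) → contradiction (right i) (C.disjoint (source∈ C.path-left)) }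
  heads : Heads L (λ _ → apex)
  heads = record
    { heads-adj   = all-three (adj-sym G ea) apex-first apex-last
    ; heads-fresh = λ _ → all-three
        (λ { (here eq) → e∉ (here (sym eq)) ; (there (here eq)) → d∉ (here (sym eq)) })
        (apex∉ ∘ C.left⊆) (apex∉ ∘ C.right⊆ ∘ right)
    ; heads-only  = λ {i} {j} i∈ a → inj₂ (refl , only-source j i∈ a)
    }
  T : ThreePaths G
  T = attach L (λ _ → apex) heads (point (λ _ _ → refl))
        (λ _ tip _ → contradiction (tip zero (suc zero)) (adj⇒≢ G dp))
  to : r ∈ᵗ T → r ∈ d ∷ e ∷ circle
  to (_ , here eq)                             = there (there (here eq))
  to (zero , there (here eq))                  = there (here eq)
  to (zero , there (there (here eq)))          = here eq
  to (suc zero , there i)                      = there (there (there (C.left⊆ i)))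
  to (suc (suc zero) , there i)                = there (there (there (C.right⊆ (right i))))
  from : r ∈ d ∷ e ∷ circle → r ∈ᵗ T
  from (here eq)                 = zero , there (there (here eq))
  from (there (here eq))         = zero , there (here eq)
  from (there (there (here eq))) = zero , here eq
  from (there (there (there i))) = [ (λ j → suc zero , there j) , (λ j → suc (suc zero) , there (right⁻ j)) ]′ (C.cover i)

-- The triangles are `d`, apex, `last` and `e`, `p`, `q`. The paths are the edge `d e` and the two
-- parts of the cycle left between its edges in the triangles; `q ≢ last` keeps the third path
-- nontrivial.
prism-at-apex : (R : Rim G) → d ∉ Rim.circle R → e ∉ Rim.circle R → Adj G d e →
                Adj G (Rim.apex R) (Rim.last R) → Adj G d (Rim.apex R) → Adj G d (Rim.last R) →
                (∀ {r} → r ∈ Rim.circle R → Adj G d r → r ≡ Rim.apex R ⊎ r ≡ Rim.last R) →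
                CutEdge G (Rim.first R) (Rim.last R) p q (Rim.ring R) → q ≢ Rim.last R →
                Adj G p q → Adj G e p → Adj G e q →
                (∀ {r} → r ∈ Rim.circle R → Adj G e r → r ≡ p ⊎ r ≡ q) →
                ConfigOn G (λ r → r ∈ d ∷ e ∷ Rim.circle R)
prism-at-apex {m} {G = G} {d = d} {e = e} {p = p} {q = q} R d∉ e∉ de al da dl d-only C q≢l pq ep eq e-only =
  three-paths T , to , from
  where
  open Rim R
  module C = CutEdge C
  P₀ P₁ P₂ : Arc G
  P₀ = record { path = edge-path de }
  P₁ = record { path = step apex-first (apex∉ ∘ C.left⊆)
         (λ i a → case apex-only (C.left⊆ i) a of λ
           { (inj₁ eq) → eq ; (inj₂ refl) → contradiction (target∈ C.path-right) (C.disjoint i) }) C.path-left }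
  P₂ = reverse-arc (record { path = C.path-right })
  right : r ∈ᵃ P₂ → r ∈ C.right
  right = ∈-reverse⁻ (record { path = C.path-right })
  right⁻ : r ∈ C.right → r ∈ᵃ P₂
  right⁻ = ∈-reverse (record { path = C.path-right })
  P₁⊆ : r ∈ᵃ P₁ → r ∈ circle
  P₁⊆ (here eq) = here eq
  P₁⊆ (there i) = there (C.left⊆ i)
  P₁-P₂ : r ∈ᵃ P₁ → r ∉ C.right
  P₁-P₂ (here refl) j = apex∉ (C.right⊆ j)
  P₁-P₂ (there i)   j = C.disjoint i j
  arcs : Fin 3 → Arc G
  arcs = three P₀ P₁ P₂
  ear : {P : Arc G} → (∀ {r} → r ∈ᵃ P → r ∈ circle) → (∀ {r} → r ∈ᵃ P → Adj G d r → r ≡ source P) →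
        (∀ {r} → r ∈ᵃ P → Adj G e r → r ≡ target P) → Meet P₀ P
  ear P⊆ from-d from-e = record
    { apart = λ { (here refl) i → contradiction (P⊆ i) d∉ ; (there (here refl)) i → contradiction (P⊆ i) e∉ }
    ; edge  = λ { (here refl) i a → starts refl (from-d i a) ; (there (here refl)) i a → ends refl (from-e i a) }
    }
  sides : Meet P₁ P₂
  sides = record
    { apart = λ i j → contradiction (right j) (P₁-P₂ i)
    ; edge  = λ { (here refl) j a → case apex-only (C.right⊆ (right j)) a of λ
                    { (inj₁ refl) → contradiction (right j) (C.disjoint (source∈ C.path-left))
                    ; (inj₂ eq) → starts refl eq }
                ; (there i) j a → case C.cross i (right j) a of λ { (x , y) → ends x y } }
    }
  T : ThreePaths G
  T = record
    { arcs  = arcs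
    ; meet  = pairwise {R = λ i j → Meet (arcs i) (arcs j)} meet-sym
        (ear {P₁} P₁⊆
          (λ i a → case d-only (P₁⊆ i) a of λ
            { (inj₁ eq) → eq ; (inj₂ refl) → contradiction (target∈ C.path-right) (P₁-P₂ i) })
          (λ i a → case e-only (P₁⊆ i) a of λ
            { (inj₁ eq) → eq ; (inj₂ refl) → contradiction (source∈ C.path-right) (P₁-P₂ i) }))
        (ear {P₂} (there ∘ C.right⊆ ∘ right)
          (λ i a → case d-only (there (C.right⊆ (right i))) a of λ
            { (inj₂ eq) → eq ; (inj₁ refl) → contradiction (C.right⊆ (right i)) apex∉ })
          (λ i a → case e-only (there (C.right⊆ (right i))) a of λ
            { (inj₂ eq) → eq ; (inj₁ refl) → contradiction (right i) (C.disjoint (target∈ C.path-left)) }))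
        sides
    ; start = corners (pairwise {R = λ i j → Adj G (source (arcs i)) (source (arcs j))} (adj-sym G) da dl al)
    ; end   = corners (pairwise {R = λ i j → Adj G (target (arcs i)) (target (arcs j))} (adj-sym G) ep eq pq)
    ; long  = all-three (adj⇒≢ G de) (λ { refl → apex∉ (C.left⊆ (target∈ C.path-left)) }) (q≢l ∘ sym)
    ; thin  = λ tip _ _ → contradiction (tip zero (suc zero)) (adj⇒≢ G da)
    }
  to : r ∈ᵗ T → r ∈ d ∷ e ∷ circle
  to (zero , here eq)         = here eq
  to (zero , there (here eq)) = there (here eq)
  to (suc zero , i)           = there (there (P₁⊆ i))
  to (suc (suc zero) , i)     = there (there (there (C.right⊆ (right i))))
  from : r ∈ d ∷ e ∷ circle → r ∈ᵗ T
  from (here eq)                 = zero , here eq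
  from (there (here eq))         = zero , there (here eq)
  from (there (there (here eq))) = suc zero , here eq
  from (there (there (there i))) = [ (λ j → suc zero , there j) , (λ j → suc (suc zero) , right⁻ j) ]′ (C.cover i)

-- The common neighbour of `d` and `e` becomes the hub. On the cycle the edge `d e` replaces it, and
-- it sees `d`, `e` and `first`.
wheel-at-apex : (R : Rim G) → d ∉ Rim.circle R → e ∉ Rim.circle R → Adj G d e →
                Adj G d (Rim.apex R) → Adj G d (Rim.first R) →
                (∀ {r} → r ∈ Rim.circle R → Adj G d r → r ≡ Rim.apex R ⊎ r ≡ Rim.first R) →
                Adj G e (Rim.apex R) → Adj G e (Rim.last R) →
                (∀ {r} → r ∈ Rim.circle R → Adj G e r → r ≡ Rim.apex R ⊎ r ≡ Rim.last R) →
                ConfigOn G (λ r → r ∈ d ∷ e ∷ Rim.circle R)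
wheel-at-apex {m} {G = G} {d = d} {e = e} R d∉ e∉ de da df d-only ea el e-only =
  wheel W , to , from
  where
  open Rim R
  ring≢apex : r ∈ ring → r ≢ apex
  ring≢apex i refl = apex∉ i
  W : Wheel G
  W = record
    { rim  = record
      { apex       = e
      ; ring-path  = step df (d∉ ∘ there)
          (λ i a → [ (λ eq → contradiction eq (ring≢apex i)) , id ]′ (d-only (there i) a)) ring-path
      ; first≢last = λ { refl → d∉ (there (target∈ ring-path)) }
      ; apex∉      = λ { (here eq) → adj⇒≢ G de (sym eq) ; (there i) → e∉ (there i) }
      ; apex-first = adj-sym G de
      ; apex-last  = el
      ; apex-only  = λ { (here eq) _ → inj₁ eq
                       ; (there i) a → inj₂ ([ (λ eq → contradiction eq (ring≢apex i)) , id ]′ (e-only (there i) a)) }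
      }
    ; hub  = apex
    ; hub∉ = λ { (here eq) → e∉ (here (sym eq)) ; (there (here eq)) → d∉ (here (sym eq)) ; (there (there i)) → apex∉ i }
    ; feet = record
      { Pa  = here refl , adj-sym G ea
      ; Pb  = there (here refl) , adj-sym G da
      ; Pc  = there (there (source∈ ring-path)) , apex-first
      ; a≢b = adj⇒≢ G (adj-sym G de)
      ; a≢c = λ { refl → e∉ (there (source∈ ring-path)) }
      ; b≢c = λ { refl → d∉ (there (source∈ ring-path)) }
      }
    }
  to : r ∈ʷ W → r ∈ d ∷ e ∷ circle
  to (here eq)                 = there (there (here eq))
  to (there (here eq))         = there (here eq)
  to (there (there (here eq))) = here eq
  to (there (there (there i))) = there (there (there i))
  from : r ∈ d ∷ e ∷ circle → r ∈ʷ W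
  from (here eq)                 = there (there (here eq))
  from (there (here eq))         = there (here eq)
  from (there (there (here eq))) = here eq
  from (there (there (there i))) = there (there (there i))

-- Attachments of one or two vertices to an induced cycle

data Att {m : ℕ} {G : Graph (Fin m)} (R : Rim G) (d : Fin m) : Set where
  none : (∀ {q} → q ∈ Rim.circle R → ¬ Adj G d q) → Att R d
  one  : ∀ p → p ∈ Rim.circle R → Adj G d p → (∀ {q} → q ∈ Rim.circle R → Adj G d q → q ≡ p) → Att R d
  two  : ∀ p q → p ∈ Rim.circle R → q ∈ Rim.circle R → Adj G p q → Adj G d p → Adj G d q →
         (∀ {r} → r ∈ Rim.circle R → Adj G d r → r ≡ p ⊎ r ≡ q) → Att R d

data Few (P : Fin m → Set) (ps : List (Fin m)) : Set where
  none : (∀ {q} → q ∈ ps → ¬ P q) → Few P ps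
  one  : ∀ p → p ∈ ps → P p → (∀ {q} → q ∈ ps → P q → q ≡ p) → Few P ps
  two  : ∀ p q → p ∈ ps → q ∈ ps → p ≢ q → P p → P q → (∀ {r} → r ∈ ps → P r → r ≡ p ⊎ r ≡ q) → Few P ps
  many : Three (λ p → p ∈ ps × P p) → Few P ps

few : {P : Fin m → Set} → (∀ p → Dec (P p)) → ∀ ps → Few P ps
few P? [] = none λ ()
few {P = P} P? (p ∷ ps) with few P? ps | P? p
... | none n | no ¬Pp = none λ { (here refl) → ¬Pp ; (there i) → n i }
... | none n | yes Pp = one p (here refl) Pp λ { (here eq) _ → eq ; (there i) Pq → contradiction Pq (n i) }
... | one q i Pq u | no ¬Pp = one q (there i) Pq λ { (here refl) Pp → contradiction Pp ¬Pp ; (there i) → u i }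
... | one q i Pq u | yes Pp with p Fin.≟ q
...   | yes refl = one q (there i) Pq λ { (here eq) _ → eq ; (there i) → u i }
...   | no p≢q   = two p q (here refl) (there i) p≢q Pp Pq
                     λ { (here eq) _ → inj₁ eq ; (there i) Pr → inj₂ (u i Pr) }
few P? (p ∷ ps) | two q r i j q≢r Pq Pr u | no ¬Pp =
  two q r (there i) (there j) q≢r Pq Pr λ { (here refl) Pp → contradiction Pp ¬Pp ; (there i) → u i }
few P? (p ∷ ps) | two q r i j q≢r Pq Pr u | yes Pp with p Fin.≟ q | p Fin.≟ r
... | yes refl | _        = two q r (there i) (there j) q≢r Pq Pr λ { (here eq) _ → inj₁ eq ; (there i) → u i }
... | no _     | yes refl = two q r (there i) (there j) q≢r Pq Pr λ { (here eq) _ → inj₂ eq ; (there i) → u i }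
... | no p≢q   | no p≢r   = many record
  { Pa = here refl , Pp ; Pb = there i , Pq ; Pc = there j , Pr ; a≢b = p≢q ; a≢c = p≢r ; b≢c = q≢r }
few P? (p ∷ ps) | many T | _ = many (three-map id (λ (i , Pq) → there i , Pq) (λ _ _ → id) T)

-- Three neighbours on the cycle make `d` a hub, and two nonadjacent ones give a trihedron. `Att`
-- lists what is left, where `d` needs the help of a second vertex.
classify : (R : Rim G) → d ∉ Rim.circle R → ConfigOn G (λ p → p ∈ d ∷ Rim.circle R) ⊎ Att R d
classify {G = G} {d = d} R d∉ with few (Graph._adj?_ G d) (Rim.circle R)
... | none n      = inj₂ (none n)
... | one p i a u = inj₂ (one p i a u)
... | many T      = inj₁ (wheel (record { rim = R ; hub = d ; hub∉ = d∉ ; feet = T }) , id , id)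
... | two p q i j p≢q a b u with Graph._adj?_ G p q
...   | yes c = inj₂ (two p q i j c a b u)
...   | no ¬c with rotate R i
...     | R′ , refl , to , from = inj₁ (configOn-resp
          (λ { (here eq) → here eq ; (there k) → there (from k) })
          (λ { (here eq) → here eq ; (there k) → there (to k) })
          (theta-at-apex R′ (d∉ ∘ from) a
            (case to j of λ { (here eq) → contradiction (sym eq) p≢q ; (there k) → k }) b (u ∘ from) ¬c))

private
  on-ring : (R : Rim G) → p ∈ Rim.circle R → p ≢ Rim.apex R → p ∈ Rim.ring R
  on-ring R (here eq) p≢a = contradiction eq p≢a
  on-ring R (there i) _   = i

  relist : ∀ {m} {G : Graph (Fin m)} {d e ps qs} → ps ≐ qs → ConfigOn G (λ r → r ∈ d ∷ e ∷ qs) → ConfigOn G (λ r → r ∈ d ∷ e ∷ ps)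
  relist (to , from) = configOn-resp
    (λ { (here eq) → here eq ; (there (here eq)) → there (here eq) ; (there (there k)) → there (there (from k)) })
    (λ { (here eq) → here eq ; (there (here eq)) → there (here eq) ; (there (there k)) → there (there (to k)) })

  exchange-ear : ∀ {m} {G : Graph (Fin m)} {d e ps} → ConfigOn G (λ r → r ∈ e ∷ d ∷ ps) → ConfigOn G (λ r → r ∈ d ∷ e ∷ ps)
  exchange-ear = configOn-resp swap₂ swap₂
    where
    swap₂ : ∀ {d e r : Fin m} {ps} → r ∈ d ∷ e ∷ ps → r ∈ e ∷ d ∷ ps
    swap₂ (here eq)         = there (here eq)
    swap₂ (there (here eq)) = here eq
    swap₂ (there (there i)) = there (there i)

stamp-ear : (R : Rim G) → d ∉ Rim.circle R → e ∉ Rim.circle R → Adj G d e →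
            p ∈ Rim.circle R → q ∈ Rim.circle R → Adj G p q → Adj G d p → Adj G d q →
            (∀ {r} → r ∈ Rim.circle R → Adj G d r → r ≡ p ⊎ r ≡ q) →
            s ∈ Rim.circle R → Adj G e s → (∀ {r} → r ∈ Rim.circle R → Adj G e r → r ≡ s) →
            s ≢ p → s ≢ q → ConfigOn G (λ r → r ∈ d ∷ e ∷ Rim.circle R)
stamp-ear {G = G} R d∉ e∉ de i j pq dp dq d-only k es e-only s≢p s≢q with rotate R k
... | R′ , refl , to , from
  with cut-edge (Rim.ring-path R′) (on-ring R′ (to i) (s≢p ∘ sym)) (on-ring R′ (to j) (s≢q ∘ sym)) pq
... | inj₁ C = relist (to , from)
      (stamp-at-apex R′ (d∉ ∘ from) (e∉ ∘ from) de C pq dp dq (d-only ∘ from) es (e-only ∘ from))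
... | inj₂ C = relist (to , from)
      (stamp-at-apex R′ (d∉ ∘ from) (e∉ ∘ from) de C (adj-sym G pq) dq dp (λ r → swap ∘ d-only (from r)) es (e-only ∘ from))

wheel-ear : (R : Rim G) → d ∉ Rim.circle R → e ∉ Rim.circle R → Adj G d e →
            p ∈ Rim.circle R → q ∈ Rim.circle R → Adj G p q → Adj G d p → Adj G d q →
            (∀ {r} → r ∈ Rim.circle R → Adj G d r → r ≡ p ⊎ r ≡ q) →
            s ∈ Rim.circle R → Adj G p s → Adj G e p → Adj G e s →
            (∀ {r} → r ∈ Rim.circle R → Adj G e r → r ≡ p ⊎ r ≡ s) →
            q ≢ s → ConfigOn G (λ r → r ∈ d ∷ e ∷ Rim.circle R)
wheel-ear {G = G} R d∉ e∉ de i j pq dp dq d-only k ps ep es e-only q≢s with rotate R i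
... | R′ , refl , to , from
  with Rim.apex-only R′ (on-ring R′ (to j) (adj⇒≢ G (adj-sym G pq))) pq
     | Rim.apex-only R′ (on-ring R′ (to k) (adj⇒≢ G (adj-sym G ps))) ps
... | inj₁ refl | inj₁ refl = contradiction refl q≢s
... | inj₂ refl | inj₂ refl = contradiction refl q≢s
... | inj₁ refl | inj₂ refl = relist (to , from)
      (wheel-at-apex R′ (d∉ ∘ from) (e∉ ∘ from) de dp dq (d-only ∘ from) ep es (e-only ∘ from))
... | inj₂ refl | inj₁ refl = relist (to , from) (exchange-ear
      (wheel-at-apex R′ (e∉ ∘ from) (d∉ ∘ from) (adj-sym G de) ep es (e-only ∘ from) dp dq (d-only ∘ from)))

prism-ear : (R : Rim G) → d ∉ Rim.circle R → e ∉ Rim.circle R → Adj G d e →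
            p ∈ Rim.circle R → q ∈ Rim.circle R → Adj G p q → Adj G d p → Adj G d q →
            (∀ {r} → r ∈ Rim.circle R → Adj G d r → r ≡ p ⊎ r ≡ q) →
            s ∈ Rim.circle R → t ∈ Rim.circle R → Adj G s t → Adj G e s → Adj G e t →
            (∀ {r} → r ∈ Rim.circle R → Adj G e r → r ≡ s ⊎ r ≡ t) →
            s ≢ p → s ≢ q → t ≢ p → t ≢ q → ConfigOn G (λ r → r ∈ d ∷ e ∷ Rim.circle R)
prism-ear {G = G} {d = d} {e = e} {p = p} {q = q} {s = s} {t = t} R d∉ e∉ de i j pq dp dq d-only k l st es et e-only s≢p s≢q t≢p t≢q
  with rotate R i
... | R′ , refl , to , from = relist (to , from)
  (case Rim.apex-only R′ (on-ring R′ (to j) (adj⇒≢ G (adj-sym G pq))) pq of λ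
    -- `prism-at-apex` expects the edge `p q` to join the apex to the last vertex; in the other case
    -- the rim is reversed first.
    { (inj₂ eq) → at-last R′ (to , from) refl eq
    ; (inj₁ eq) → case reverse-rim R′ of λ
        { (R″ , apex≡ , _ , last≡ , same) → relist same
            (at-last R″ (≐-trans (to , from) same) (sym apex≡) (trans eq (sym last≡))) } })
  where
  at-last : (R′ : Rim G) → Rim.circle R ≐ Rim.circle R′ → p ≡ Rim.apex R′ → q ≡ Rim.last R′ →
            ConfigOn G (λ r → r ∈ d ∷ e ∷ Rim.circle R′)
  at-last R′ (to , from) refl refl
    with cut-edge (Rim.ring-path R′) (on-ring R′ (to k) s≢p) (on-ring R′ (to l) t≢p) st
  ... | inj₁ C = prism-at-apex R′ (d∉ ∘ from) (e∉ ∘ from) de pq dp dq (d-only ∘ from)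
                   C t≢q st es et (e-only ∘ from)
  ... | inj₂ C = prism-at-apex R′ (d∉ ∘ from) (e∉ ∘ from) de pq dp dq (d-only ∘ from)
                   C s≢q (adj-sym G st) et es (λ r → swap ∘ e-only (from r))

-- At least three vertices of the cycle are seen in total, so one of `d` and `e` sees the ends of an
-- edge. A further single vertex seen by the other gives a stamp, a disjoint edge a prism, and an
-- edge with one end in common a wheel.
ear : (R : Rim G) → d ∉ Rim.circle R → e ∉ Rim.circle R → Adj G d e → Att R d → Att R e →
      Three (λ p → p ∈ Rim.circle R × (Adj G d p ⊎ Adj G e p)) →
      ConfigOn G (λ r → r ∈ d ∷ e ∷ Rim.circle R)
ear R d∉ e∉ de (none a) (none b) T = ⊥-elim (three-exceeds T (Rim.apex R) (Rim.apex R)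
  λ { (i , inj₁ x) → contradiction x (a i) ; (i , inj₂ x) → contradiction x (b i) })
ear R d∉ e∉ de (none a) (one p _ _ b) T = ⊥-elim (three-exceeds T p p
  λ { (i , inj₁ x) → contradiction x (a i) ; (i , inj₂ x) → inj₁ (b i x) })
ear R d∉ e∉ de (none a) (two p q _ _ _ _ _ b) T = ⊥-elim (three-exceeds T p q
  λ { (i , inj₁ x) → contradiction x (a i) ; (i , inj₂ x) → b i x })
ear R d∉ e∉ de (one p _ _ a) (none b) T = ⊥-elim (three-exceeds T p p
  λ { (i , inj₁ x) → inj₁ (a i x) ; (i , inj₂ x) → contradiction x (b i) })
ear R d∉ e∉ de (one p _ _ a) (one q _ _ b) T = ⊥-elim (three-exceeds T p q
  λ { (i , inj₁ x) → inj₁ (a i x) ; (i , inj₂ x) → inj₂ (b i x) })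
ear R d∉ e∉ de (two p q _ _ _ _ _ a) (none b) T = ⊥-elim (three-exceeds T p q
  λ { (i , inj₁ x) → a i x ; (i , inj₂ x) → contradiction x (b i) })
ear {G = G} R d∉ e∉ de (one s k ds d-only) (two p q i j pq ep eq e-only) T with s Fin.≟ p | s Fin.≟ q
... | yes refl | _ = ⊥-elim (three-exceeds T p q λ { (i , inj₁ x) → inj₁ (d-only i x) ; (i , inj₂ x) → e-only i x })
... | _ | yes refl = ⊥-elim (three-exceeds T p q λ { (i , inj₁ x) → inj₂ (d-only i x) ; (i , inj₂ x) → e-only i x })
... | no s≢p | no s≢q = exchange-ear (stamp-ear R e∉ d∉ (adj-sym G de) i j pq ep eq e-only k ds d-only s≢p s≢q)
ear R d∉ e∉ de (two p q i j pq dp dq d-only) (one s k es e-only) T with s Fin.≟ p | s Fin.≟ q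
... | yes refl | _ = ⊥-elim (three-exceeds T p q λ { (i , inj₁ x) → d-only i x ; (i , inj₂ x) → inj₁ (e-only i x) })
... | _ | yes refl = ⊥-elim (three-exceeds T p q λ { (i , inj₁ x) → d-only i x ; (i , inj₂ x) → inj₂ (e-only i x) })
... | no s≢p | no s≢q = stamp-ear R d∉ e∉ de i j pq dp dq d-only k es e-only s≢p s≢q
ear {G = G} R d∉ e∉ de (two p q i j pq dp dq d-only) (two s t k l st es et e-only) T
  with s Fin.≟ p | s Fin.≟ q | t Fin.≟ p | t Fin.≟ q
... | no s≢p | no s≢q | no t≢p | no t≢q = prism-ear R d∉ e∉ de i j pq dp dq d-only k l st es et e-only s≢p s≢q t≢p t≢q
... | yes refl | _ | _ | yes refl = ⊥-elim (three-exceeds T p q λ { (i , inj₁ x) → d-only i x ; (i , inj₂ x) → e-only i x })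
... | yes refl | _ | _ | no t≢q = wheel-ear R d∉ e∉ de i j pq dp dq d-only l st es et e-only (t≢q ∘ sym)
... | no _ | yes refl | yes refl | _ = ⊥-elim (three-exceeds T p q λ { (i , inj₁ x) → d-only i x ; (i , inj₂ x) → swap (e-only i x) })
... | no _ | yes refl | no t≢p | _ = wheel-ear R d∉ e∉ de j i (adj-sym G pq) dq dp (λ r → swap ∘ d-only r) l st es et e-only (t≢p ∘ sym)
... | no _ | no s≢q | yes refl | _ = wheel-ear R d∉ e∉ de i j pq dp dq d-only k (adj-sym G st) et es (λ r → swap ∘ e-only r) (s≢q ∘ sym)
... | no s≢p | no _ | no _ | yes refl = wheel-ear R d∉ e∉ de j i (adj-sym G pq) dq dp (λ r → swap ∘ d-only r) k (adj-sym G st) et es (λ r → swap ∘ e-only r) (s≢p ∘ sym)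

-- Splitting a vertex of a configuration

-- G′ arises from G by identifying the adjacent vertices y and y′ to u.  Since the vertex
-- set stays the same, u is one of the two, and G′ is only used away from the other one.
record Split (G′ G : Graph (Fin m)) (u y y′ : Fin m) : Set where
  Old : Fin m → Set
  Old p = p ≢ y × p ≢ y′
  field
    pair     : Adj G y y′
    keep     : ∀ {p q} → Old p → Old q → Adj G′ p q → Adj G p q
    keep⁻    : ∀ {p q} → Old p → Old q → Adj G p q → Adj G′ p q
    near     : ∀ {q} → Old q → Adj G′ u q → Adj G y q ⊎ Adj G y′ q
    near-y⁻  : ∀ {q} → Old q → Adj G y q → Adj G′ u q
    near-y′⁻ : ∀ {q} → Old q → Adj G y′ q → Adj G′ u q

split-swap : {y y′ : Fin m} → Split H G u y y′ → Split H G u y′ y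
split-swap {G = G} S = record
  { pair     = adj-sym G pair
  ; keep     = λ (a , b) (c , d) → keep (b , a) (d , c)
  ; keep⁻    = λ (a , b) (c , d) → keep⁻ (b , a) (d , c)
  ; near     = λ (a , b) e → swap (near (b , a) e)
  ; near-y⁻  = λ (a , b) → near-y′⁻ (b , a)
  ; near-y′⁻ = λ (a , b) → near-y⁻ (b , a)
  }
  where open Split S

-- `complete` and `hit` preserve traces: nothing but `u` disappears, and `u` is represented by `y`
-- or `y′`, of which the other one may be left out.
record Lifted (G : Graph (Fin m)) (u y y′ : Fin m) (P : Fin m → Set) : Set where
  field
    config   : Config G
    sound    : ∀ {p} → p ∈ᶜ config → p ≡ y ⊎ p ≡ y′ ⊎ (P p × p ≢ u)
    complete : ∀ {p} → P p → p ≢ u → p ∈ᶜ config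
    hit      : y ∈ᶜ config ⊎ y′ ∈ᶜ config

lifted-swap : {y y′ : Fin m} {P : Fin m → Set} → Lifted G u y y′ P → Lifted G u y′ y P
lifted-swap L = record
  { config   = config
  ; sound    = λ i → case sound i of λ { (inj₁ a) → inj₂ (inj₁ a) ; (inj₂ (inj₁ a)) → inj₁ a ; (inj₂ (inj₂ a)) → inj₂ (inj₂ a) }
  ; complete = complete
  ; hit      = swap hit
  }
  where open Lifted L

lifted-resp : {y y′ : Fin m} {P Q : Fin m → Set} → (∀ {p} → P p → Q p) → (∀ {p} → Q p → P p) →
              Lifted G u y y′ P → Lifted G u y y′ Q
lifted-resp to from L = record
  { config   = config
  ; sound    = λ i → case sound i of λ { (inj₁ a) → inj₁ a ; (inj₂ (inj₁ a)) → inj₂ (inj₁ a) ; (inj₂ (inj₂ (a , b))) → inj₂ (inj₂ (to a , b)) }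
  ; complete = complete ∘ from
  ; hit      = hit
  }
  where open Lifted L

Avoids : (y y′ u : Fin m) → (Fin m → Set) → Set
Avoids y y′ u P = ∀ {p} → P p → p ≢ u → p ≢ y × p ≢ y′

-- The obstruction to letting `y` alone take the place of `u`.
Misses : (G′ G : Graph (Fin m)) → (u y : Fin m) → (Fin m → Set) → Set
Misses G′ G u y P = ∃[ q ] P q × Adj G′ u q × ¬ Adj G y q

misses-resp : {P Q : Fin m → Set} → (∀ {p} → P p → Q p) → Misses H G u y P → Misses H G u y Q
misses-resp to (q , Pq , a) = q , to Pq , a

push-path : {y y′ : Fin m} (S : Split H G u y y′) → (∀ {p} → p ∈ ps → Split.Old S p) →
            InducedPath H f g ps → InducedPath G f g ps
push-path S old stop = stop
push-path S old (step a n u P) = step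
  (Split.keep S (old (here refl)) (old (there (source∈ P))) a) n
  (λ i a → u i (Split.keep⁻ S (old (here refl)) (old (there i)) a))
  (push-path S (old ∘ there) P)

redirect : (u c p : Fin m) → Fin m
redirect u c p with p Fin.≟ u
... | yes _ = c
... | no  _ = p

redirect-injective : (u c : Fin m) {P : Fin m → Set} → (∀ {p} → P p → p ≢ u → p ≢ c) →
                     ∀ {p q} → P p → P q → redirect u c p ≡ redirect u c q → p ≡ q
redirect-injective u c fresh {p} {q} Pp Pq eq with p Fin.≟ u | q Fin.≟ u
... | yes refl | yes refl = refl
... | yes refl | no q≢u   = contradiction (sym eq) (fresh Pq q≢u)
... | no p≢u   | yes refl = contradiction eq (fresh Pp p≢u)
... | no _     | no _     = eq

redirect-property : (u c : Fin m) {P Q : Fin m → Set} → (P u → Q c) → (∀ {p} → P p → p ≢ u → Q p) →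
                    ∀ {p} → P p → Q (redirect u c p)
redirect-property u c at-u else {p} Pp with p Fin.≟ u
... | yes refl = at-u Pp
... | no p≢u   = else Pp p≢u

-- Splitting the hub or a rim vertex of a wheel

-- If one of `y`, `y′` forms a configuration with the rim, the other is left out. Otherwise both
-- attachments are small and `y y′` is an ear; it sees three rim vertices because every foot of `u`
-- is seen by `y` or `y′`.
hub-split : {y y′ : Fin m} → Split H G u y y′ → (W : Wheel H) → Wheel.hub W ≡ u →
            Avoids y y′ u (_∈ʷ W) → Lifted G u y y′ (_∈ʷ W)
hub-split {m} {H = H} {G = G} {u = u} {y = y} {y′ = y′} S W refl avoid = result
  where
  open Wheel W
  open Split S
  module R′ = Rim rim
  ≢u : ∀ {p} → p ∈ R′.circle → p ≢ u
  ≢u i refl = hub∉ i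
  old : ∀ {p} → p ∈ R′.circle → Old p
  old i = avoid (there i) (≢u i)
  R : Rim G
  R = record
    { ring-path  = push-path S (old ∘ there) R′.ring-path
    ; first≢last = R′.first≢last
    ; apex∉      = R′.apex∉
    ; apex-first = keep (old (here refl)) (old (there (source∈ R′.ring-path))) R′.apex-first
    ; apex-last  = keep (old (here refl)) (old (there (target∈ R′.ring-path))) R′.apex-last
    ; apex-only  = λ i a → R′.apex-only i (keep⁻ (old (here refl)) (old (there i)) a)
    }
  y∉ : y ∉ R′.circle
  y∉ i = proj₁ (old i) refl
  y′∉ : y′ ∉ R′.circle
  y′∉ i = proj₂ (old i) refl
  result : Lifted G u y y′ (_∈ʷ W)
  result with classify R y∉ | classify R y′∉
  ... | inj₁ (C , to , from) | _ = record
    { config   = C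
    ; sound    = λ i → case to i of λ
        { (here eq) → inj₁ eq ; (there j) → inj₂ (inj₂ (there j , ≢u j)) }
    ; complete = λ { (here eq) p≢u → contradiction eq p≢u ; (there i) _ → from (there i) }
    ; hit      = inj₁ (from (here refl))
    }
  ... | inj₂ _ | inj₁ (C , to , from) = record
    { config   = C
    ; sound    = λ i → case to i of λ
        { (here eq) → inj₂ (inj₁ eq) ; (there j) → inj₂ (inj₂ (there j , ≢u j)) }
    ; complete = λ { (here eq) p≢u → contradiction eq p≢u ; (there i) _ → from (there i) }
    ; hit      = inj₂ (from (here refl))
    }
  ... | inj₂ a | inj₂ a′ with ear R y∉ y′∉ pair a a′
                                (three-map id (λ (i , b) → i , near (old i) b) (λ _ _ → id) feet)
  ...   | C , to , from = record
    { config   = C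
    ; sound    = λ i → case to i of λ
        { (here eq) → inj₁ eq ; (there (here eq)) → inj₂ (inj₁ eq)
        ; (there (there j)) → inj₂ (inj₂ (there j , ≢u j)) }
    ; complete = λ { (here eq) p≢u → contradiction eq p≢u ; (there i) _ → from (there (there i)) }
    ; hit      = inj₁ (from (here refl))
    }

record RimSplit (H G : Graph (Fin m)) (u y y′ : Fin m) : Set where
  field
    split : Split H G u y y′
    base  : Wheel H
  open Split split public
  open Wheel base public
  open Rim rim public
  field
    apex≡ : apex ≡ u
    avoid : Avoids y y′ u (_∈ʷ base)

  ring≢u : ∀ {p} → p ∈ ring → p ≢ u
  ring≢u i eq = apex∉ (subst (_∈ ring) (trans eq (sym apex≡)) i)

  old : ∀ {p} → p ∈ ring → Old p
  old i = avoid (there (there i)) (ring≢u i)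

  hub≢u : hub ≢ u
  hub≢u eq = hub∉ (here (trans eq (sym apex≡)))

  hub-old : Old hub
  hub-old = avoid (here refl) hub≢u

  u-first : Adj H u first
  u-first = subst (λ p → Adj H p first) apex≡ apex-first

  u-last : Adj H u last
  u-last = subst (λ p → Adj H p last) apex≡ apex-last

  only : ∀ {q} → q ∈ ring → Adj H u q → q ≡ first ⊎ q ≡ last
  only i a = apex-only i (subst (λ p → Adj H p _) (sym apex≡) a)

rimSplit-swap : {y y′ : Fin m} → RimSplit H G u y y′ → RimSplit H G u y′ y
rimSplit-swap X = record
  { split = split-swap split ; base = base ; apex≡ = apex≡ ; avoid = λ i n → case avoid i n of λ { (a , b) → b , a } }
  where open RimSplit X

-- On the rim `y` takes the place of `u`, but the hub may thereby lose a foot. If what it still sees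
-- is too little, the hub and `y′` form an ear of the new rim, where `y′` contributes `y` as a foot.
rim-replace : {y y′ : Fin m} (X : RimSplit H G u y y′) → let open RimSplit X in
              Adj G y first → Adj G y last → ¬ Adj G y hub → Adj G y′ hub →
              ¬ (Adj G y′ first × Adj G y′ last) → Lifted G u y y′ (_∈ʷ base)
rim-replace {m} {H = H} {G = G} {u = u} {y = y} {y′ = y′} X yf yl ¬yh y′h ¬both = result
  where
  open RimSplit X
  R : Rim G
  R = record
    { apex       = y
    ; ring-path  = push-path split old ring-path
    ; first≢last = first≢last
    ; apex∉      = λ i → proj₁ (old i) refl
    ; apex-first = yf
    ; apex-last  = yl
    ; apex-only  = λ i a → only i (near-y⁻ (old i) a)
    }
  hub∉R : hub ∉ Rim.circle R
  hub∉R (here eq) = proj₁ hub-old eq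
  hub∉R (there i) = hub∉ (there i)
  y′∉R : y′ ∉ Rim.circle R
  y′∉R (here eq) = adj⇒≢ G pair (sym eq)
  y′∉R (there i) = proj₂ (old i) refl
  first∈ : first ∈ ring
  first∈ = source∈ ring-path
  last∈ : last ∈ ring
  last∈ = target∈ ring-path
  att : Att R y′
  -- By `¬both`, `y′` sees `y` and at most one of the two neighbours of `y` on the rim, so its
  -- attachment is small.
  att with Graph._adj?_ G y′ first | Graph._adj?_ G y′ last
  ... | yes a | _ = two y first (here refl) (there first∈) yf (adj-sym G pair) a λ
    { (here eq) _ → inj₁ eq
    ; (there i) b → case only i (near-y′⁻ (old i) b) of λ
        { (inj₁ eq) → inj₂ eq ; (inj₂ refl) → contradiction (a , b) ¬both } }
  ... | no ¬a | yes a = two y last (here refl) (there last∈) yl (adj-sym G pair) a λ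
    { (here eq) _ → inj₁ eq
    ; (there i) b → case only i (near-y′⁻ (old i) b) of λ
        { (inj₁ refl) → contradiction b ¬a ; (inj₂ eq) → inj₂ eq } }
  ... | no ¬a | no ¬b = one y (here refl) (adj-sym G pair) λ
    { (here eq) _ → eq
    ; (there i) b → case only i (near-y′⁻ (old i) b) of λ
        { (inj₁ refl) → contradiction b ¬a ; (inj₂ refl) → contradiction b ¬b } }
  in-circle : ∀ {p} → p ∈ circle → p ≢ u → p ∈ ring
  in-circle (here eq) p≢u = contradiction (trans eq apex≡) p≢u
  in-circle (there i) _   = i
  result : Lifted G u y y′ (_∈ʷ base)
  result with classify R hub∉R
  ... | inj₁ (C , to , from) = record
    { config   = C
    ; sound    = λ i → case to i of λ
        { (here refl) → inj₂ (inj₂ (here refl , hub≢u)) ; (there (here eq)) → inj₁ eq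
        ; (there (there j)) → inj₂ (inj₂ (there (there j) , ring≢u j)) }
    ; complete = λ { (here eq) _ → from (here eq) ; (there i) p≢u → from (there (there (in-circle i p≢u))) }
    ; hit      = inj₁ (from (there (here refl)))
    }
  ... | inj₂ a with ear R hub∉R y′∉R (adj-sym G y′h) a att
        (three-map (redirect u y)
          (redirect-property u y {P = λ p → p ∈ circle × Adj H hub p}
            {Q = λ p → p ∈ Rim.circle R × (Adj G hub p ⊎ Adj G y′ p)} (λ _ → here refl , inj₂ (adj-sym G pair))
            (λ (i , b) p≢u → let j = in-circle i p≢u in there j , inj₁ (keep hub-old (old j) b)))
          (redirect-injective u y {P = λ p → p ∈ circle × Adj H hub p} (λ (i , _) p≢u → proj₁ (old (in-circle i p≢u)))) feet)
  ...   | C , to , from = record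
    { config   = C
    ; sound    = λ i → case to i of λ
        { (here refl) → inj₂ (inj₂ (here refl , hub≢u)) ; (there (here eq)) → inj₂ (inj₁ eq)
        ; (there (there (here eq))) → inj₁ eq
        ; (there (there (there j))) → inj₂ (inj₂ (there (there j) , ring≢u j)) }
    ; complete = λ { (here eq) _ → from (here eq) ; (there i) p≢u → from (there (there (there (in-circle i p≢u)))) }
    ; hit      = inj₁ (from (there (there (here refl))))
    }

-- Each of `y` and `y′` sees one rim neighbour of `u`, so the edge `y y′` replaces `u` on the rim.
-- If `u` was a foot, the hub sees one of the two, which becomes a foot instead.
rim-subdivide : {y y′ : Fin m} (X : RimSplit H G u y y′) → let open RimSplit X in
                Adj G y first → ¬ Adj G y last → Adj G y′ last → ¬ Adj G y′ first →
                Lifted G u y y′ (_∈ʷ base)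
rim-subdivide {m} {H = H} {G = G} {u = u} {y = y} {y′ = y′} X yf ¬yl y′l ¬y′f = record
  { config   = wheel (record { rim = R ; hub = hub ; hub∉ = hub∉R ; feet = feet′ })
  ; sound    = λ
      { (here refl) → inj₂ (inj₂ (here refl , hub≢u)) ; (there (here eq)) → inj₂ (inj₁ eq)
      ; (there (there (here eq))) → inj₁ eq ; (there (there (there i))) → inj₂ (inj₂ (there (there i) , ring≢u i)) }
  ; complete = λ { (here eq) _ → here eq ; (there i) p≢u → there (there (there (in-circle i p≢u))) }
  ; hit      = inj₁ (there (there (here refl)))
  }
  where
  open RimSplit X
  R : Rim G
  R = record
    { apex       = y′
    ; ring-path  = step yf (λ i → proj₁ (old i) refl)
        (λ i a → case only i (near-y⁻ (old i) a) of λ { (inj₁ eq) → eq ; (inj₂ refl) → contradiction a ¬yl })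
        (push-path split old ring-path)
    ; first≢last = λ eq → proj₁ (old (target∈ ring-path)) (sym eq)
    ; apex∉      = λ { (here eq) → adj⇒≢ G pair (sym eq) ; (there i) → proj₂ (old i) refl }
    ; apex-first = adj-sym G pair
    ; apex-last  = y′l
    ; apex-only  = λ { (here eq) _ → inj₁ eq
                     ; (there i) a → case only i (near-y′⁻ (old i) a) of λ
                         { (inj₁ refl) → contradiction a ¬y′f ; (inj₂ eq) → inj₂ eq } }
    }
  in-circle : ∀ {p} → p ∈ circle → p ≢ u → p ∈ ring
  in-circle (here eq) p≢u = contradiction (trans eq apex≡) p≢u
  in-circle (there i) _   = i
  hub∉R : hub ∉ Rim.circle R
  hub∉R (here eq)         = proj₂ hub-old eq
  hub∉R (there (here eq)) = proj₁ hub-old eq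
  hub∉R (there (there i)) = hub∉ (there i)
  plant : ∀ {c} → c ∈ Rim.circle R → (c ≡ y ⊎ c ≡ y′) → (Adj H hub u → Adj G hub c) →
          Three (λ p → p ∈ Rim.circle R × Adj G hub p)
  plant {c} i c≡ a = three-map (redirect u c)
    (redirect-property u c {P = λ p → p ∈ circle × Adj H hub p}
      {Q = λ p → p ∈ Rim.circle R × Adj G hub p} (λ (_ , b) → i , a b)
      (λ (j , b) p≢u → let k = in-circle j p≢u in there (there k) , keep hub-old (old k) b))
    (redirect-injective u c {P = λ p → p ∈ circle × Adj H hub p} (λ (j , _) p≢u → case c≡ of λ
      { (inj₁ refl) → proj₁ (old (in-circle j p≢u)) ; (inj₂ refl) → proj₂ (old (in-circle j p≢u)) })) feet
  feet′ : Three (λ p → p ∈ Rim.circle R × Adj G hub p)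
  feet′ with Graph._adj?_ G hub y
  ... | yes a = plant (there (here refl)) (inj₁ refl) (λ _ → a)
  ... | no ¬a = plant (here refl) (inj₂ refl) (λ b → case near hub-old (adj-sym H b) of λ
    { (inj₁ c) → contradiction (adj-sym G c) ¬a ; (inj₂ c) → adj-sym G c })

rim-missed : {y y′ : Fin m} (X : RimSplit H G u y y′) → let open RimSplit X in
             Misses H G u y (_∈ʷ base) →
             (Adj H u hub × ¬ Adj G y hub) ⊎ ¬ Adj G y first ⊎ ¬ Adj G y last
rim-missed X (q , here refl , a , ¬b) = inj₁ (a , ¬b)
rim-missed {H = H} X (q , there (here eq) , a , ¬b) =
  contradiction (trans (sym (RimSplit.apex≡ X)) (sym eq)) (adj⇒≢ H a)
rim-missed X (q , there (there i) , a , ¬b) = case RimSplit.only X i a of λ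
  { (inj₁ refl) → inj₂ (inj₁ ¬b) ; (inj₂ refl) → inj₂ (inj₂ ¬b) }

-- As `y` sees both rim neighbours, it can only miss the hub, which is therefore seen by `y′`. Since
-- `y′` misses something too, it does not see both rim neighbours.
rim-full : {y y′ : Fin m} (X : RimSplit H G u y y′) → let open RimSplit X in
           Misses H G u y (_∈ʷ base) → Misses H G u y′ (_∈ʷ base) →
           Adj G y first → Adj G y last → Lifted G u y y′ (_∈ʷ base)
rim-full X M M′ yf yl with rim-missed X M
... | inj₂ (inj₁ ¬yf) = contradiction yf ¬yf
... | inj₂ (inj₂ ¬yl) = contradiction yl ¬yl
... | inj₁ (a , ¬yh) with RimSplit.near X (RimSplit.hub-old X) a
...   | inj₁ yh  = contradiction yh ¬yh
...   | inj₂ y′h = rim-replace X yf yl ¬yh y′h λ (y′f , y′l) → case rim-missed (rimSplit-swap X) M′ of λ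
  { (inj₁ (_ , ¬y′h)) → ¬y′h y′h ; (inj₂ (inj₁ ¬y′f)) → ¬y′f y′f ; (inj₂ (inj₂ ¬y′l)) → ¬y′l y′l }

-- Every rim neighbour of `u` is seen by `y` or `y′`: either one of them sees both, or they see one
-- each.
rim-split : {y y′ : Fin m} (X : RimSplit H G u y y′) →
            Misses H G u y (_∈ʷ RimSplit.base X) → Misses H G u y′ (_∈ʷ RimSplit.base X) →
            Lifted G u y y′ (_∈ʷ RimSplit.base X)
rim-split {H = H} {G = G} {u = u} {y = y} {y′ = y′} X M M′ = result
  where
  open RimSplit X
  near-first : Adj G y first ⊎ Adj G y′ first
  near-first = near (old (source∈ ring-path)) u-first
  near-last : Adj G y last ⊎ Adj G y′ last
  near-last = near (old (target∈ ring-path)) u-last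
  result : Lifted G u y y′ (_∈ʷ base)
  result with Graph._adj?_ G y first | Graph._adj?_ G y last | Graph._adj?_ G y′ first | Graph._adj?_ G y′ last
  ... | yes yf | yes yl | _ | _ = rim-full X M M′ yf yl
  ... | _ | _ | yes y′f | yes y′l = lifted-swap (rim-full (rimSplit-swap X) M′ M y′f y′l)
  ... | yes yf | no ¬yl | no ¬y′f | yes y′l = rim-subdivide X yf ¬yl y′l ¬y′f
  ... | no ¬yf | yes yl | yes y′f | no ¬y′l = lifted-swap (rim-subdivide (rimSplit-swap X) y′f ¬y′l yl ¬yf)
  ... | no ¬yf | _ | no ¬y′f | _ = contradiction near-first [ ¬yf , ¬y′f ]′
  ... | _ | no ¬yl | _ | no ¬y′l = contradiction near-last [ ¬yl , ¬y′l ]′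

-- Splitting a vertex of a three-path configuration

push-arc : {y y′ : Fin m} (S : Split H G u y y′) (P : Arc H) → (∀ {p} → p ∈ᵃ P → Split.Old S p) → Arc G
push-arc S P old = record { path = push-path S old (path P) }

push-joined : {y y′ : Fin m} (S : Split H G u y y′) {φ : Fin 3 → Fin m} → (∀ i → Split.Old S (φ i)) →
              Joined H φ → Joined G φ
push-joined S old (point e)   = point e
push-joined S old (corners c) = corners (λ {i} {j} i≢j → Split.keep S (old i) (old j) (c i≢j))

push-legs : {y y′ : Fin m} (S : Split H G u y y′) (L : Legs H) →
            (∀ j {p} → p ∈ᵃ Legs.legs L j → Split.Old S p) → Legs G
push-legs S L old = record
  { legs  = λ j → push-arc S (legs j) (old j)
  ; meetₜ = λ {i} {j} i≢j → record
    { apart = Meetₜ.apart (meetₜ i≢j)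
    ; edge  = λ a b e → Meetₜ.edge (meetₜ i≢j) a b (Split.keep⁻ S (old i a) (old j b) e)
    }
  ; end   = push-joined S (λ i → old i (target∈ (path (legs i)))) end
  }
  where open Legs L

extend : (L : Legs G) (k : Fin 3) → Adj G z (source (Legs.legs L k)) → (∀ j → z ∉ᵃ Legs.legs L j) →
         (∀ {j q} → q ∈ᵃ Legs.legs L j → Adj G z q → q ≡ source (Legs.legs L k)) → Legs G
extend {m} {G = G} {z = z} L k a fresh only = record
  { legs  = λ j → extended j (j Fin.≟ k)
  ; meetₜ = λ {i} {j} i≢j → extended-meetₜ i j (i Fin.≟ k) (j Fin.≟ k) i≢j
  ; end   = extended-end end
  }
  where
  open Legs L
  extended : ∀ j → Dec (j ≡ k) → Arc G
  extended j (no _)     = legs j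
  extended j (yes refl) = record { path = step a (fresh j) (only {j}) (path (legs j)) }
  target-extended : ∀ j d → target (extended j d) ≡ target (legs j)
  target-extended j (no _)     = refl
  target-extended j (yes refl) = refl
  one-extended : ∀ j → k ≢ j → (d : Dec (k ≡ k)) → Meetₜ (extended k d) (legs j)
  one-extended j k≢j (no k≢k)   = contradiction refl k≢k
  one-extended j k≢j (yes refl) = record
    { apart = λ { (here refl) i → contradiction i (fresh j) ; (there i) → Meetₜ.apart (meetₜ k≢j) i }
    ; edge  = λ { (here refl) i e → inj₂ (inj₁ (there (subst (_∈ᵃ legs k) (sym (only {j} i e)) (source∈ (path (legs k))))))
                ; (there i) i′ e → case Meetₜ.edge (meetₜ k≢j) i i′ e of λ
                    { (inj₁ b) → inj₁ b ; (inj₂ (inj₁ b)) → inj₂ (inj₁ (there b)) ; (inj₂ (inj₂ b)) → inj₂ (inj₂ b) } }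
    }
  extended-meetₜ : ∀ i j d d′ → i ≢ j → Meetₜ (extended i d) (extended j d′)
  extended-meetₜ i j (no _)     (no _)     i≢j = meetₜ i≢j
  extended-meetₜ i j (yes refl) (yes refl) i≢j = contradiction refl i≢j
  extended-meetₜ i j (yes refl) (no _)     i≢j = one-extended j i≢j (yes refl)
  extended-meetₜ i j (no _)     (yes refl) i≢j = meetₜ-sym (one-extended i (i≢j ∘ sym) (yes refl))
  extended-end : Joined G (λ i → target (legs i)) → Joined G (λ i → target (extended i (i Fin.≟ k)))
  extended-end (point e) = point λ i j →
    trans (target-extended i (i Fin.≟ k)) (trans (e i j) (sym (target-extended j (j Fin.≟ k))))
  extended-end (corners c) = corners λ {i} {j} i≢j →
    subst (λ p → Adj G p _) (sym (target-extended i (i Fin.≟ k)))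
      (subst (λ p → Adj G _ p) (sym (target-extended j (j Fin.≟ k))) (c i≢j))

-- Extends `thin` to configurations with just one common end, so that no path of a stamp is a single
-- edge. The stamps excluded here are wheels, see `wheel-or-strict`.
Strict : ThreePaths G → Set
Strict {G = G} T = (∀ i j → source (arcs i) ≡ source (arcs j)) ⊎ (∀ i j → target (arcs i) ≡ target (arcs j)) →
                   ∀ i → ¬ Adj G (source (arcs i)) (target (arcs i))
  where open ThreePaths T

strict-permute : (σ : Fin 3 → Fin 3) (σσ : ∀ i → σ (σ i) ≡ i) (T : ThreePaths G) → Strict T → Strict (permute σ σσ T)
strict-permute σ σσ T s eqs i = s (case eqs of λ
  { (inj₁ e) → inj₁ (back source e) ; (inj₂ e) → inj₂ (back target e) }) (σ i)
  where
  open ThreePaths T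
  back : (φ : Arc _ → Fin _) → (∀ i j → φ (arcs (σ i)) ≡ φ (arcs (σ j))) → ∀ i j → φ (arcs i) ≡ φ (arcs j)
  back φ e i j = trans (cong (φ ∘ arcs) (sym (σσ i))) (trans (e (σ i) (σ j)) (cong (φ ∘ arcs) (σσ j)))

∈-permute⁻ : (σ : Fin 3 → Fin 3) (σσ : ∀ i → σ (σ i) ≡ i) (T : ThreePaths G) →
             p ∈ᵗ permute σ σσ T → p ∈ᵗ T
∈-permute⁻ σ σσ T (i , p∈) = σ i , p∈

record ThreeSplit (H G : Graph (Fin m)) (u y y′ : Fin m) : Set where
  field
    split : Split H G u y y′
    base  : ThreePaths H
    avoid : Avoids y y′ u (_∈ᵗ base)
    strict : Strict base

  open Split split public
  open ThreePaths base public

threeSplit-swap : {y y′ : Fin m} → ThreeSplit H G u y y′ → ThreeSplit H G u y′ y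
threeSplit-swap X = record
  { split = split-swap split ; base = base ; avoid = λ i n → case avoid i n of λ { (a , b) → b , a } ; strict = strict }
  where open ThreeSplit X

threeSplit-permute : {y y′ : Fin m} (σ : Fin 3 → Fin 3) → (∀ i → σ (σ i) ≡ i) → ThreeSplit H G u y y′ → ThreeSplit H G u y y′
threeSplit-permute σ σσ X = record
  { split = split ; base = permute σ σσ base ; avoid = λ i → avoid (∈-permute⁻ σ σσ base i)
  ; strict = strict-permute σ σσ base strict }
  where open ThreeSplit X

-- An interior vertex of an arc has only its two neighbours on this arc in the whole configuration.
-- So when `y` and `y′` see one of them each, they can be put in series.
module Interior {m : ℕ} {H G : Graph (Fin m)} {u y y′ : Fin m} (X : ThreeSplit H G u y y′)
  (u∈ : u ∈ᵃ ThreePaths.arcs (ThreeSplit.base X) zero)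
  (u≢source : u ≢ source (ThreePaths.arcs (ThreeSplit.base X) zero))
  (u≢target : u ≢ target (ThreePaths.arcs (ThreeSplit.base X) zero)) where

  open ThreeSplit X

  P : Arc H
  P = arcs zero

  module C = Cut (cut (path P) u∈)
  -- Reversed, the left part starts at `u` like the right part, and `uncons` exposes the neighbour
  -- of `u` on each side.
  module L = Uncons (uncons (proj₁ (proj₂ (reverse-path C.path-left))) u≢source)
  module R = Uncons (uncons C.path-right u≢target)

  left : p ∈ L.rest → p ∈ C.left
  left i = proj₁ (proj₂ (proj₂ (reverse-path C.path-left))) (L.rest⊆ i)

  right : p ∈ R.rest → p ∈ C.right
  right = R.rest⊆

  in-left : p ∈ C.left → p ≢ u → p ∈ L.rest
  in-left i p≢u = [ (λ eq → contradiction eq p≢u) , id ]′ (L.cover (proj₂ (proj₂ (proj₂ (reverse-path C.path-left))) i))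

  in-right : p ∈ C.right → p ≢ u → p ∈ R.rest
  in-right i p≢u = [ (λ eq → contradiction eq p≢u) , id ]′ (R.cover i)

  left≢u : p ∈ L.rest → p ≢ u
  left≢u i refl = L.fresh i

  right≢u : p ∈ R.rest → p ≢ u
  right≢u i refl = R.fresh i

  left-old : p ∈ L.rest → Old p
  left-old i = avoid (zero , C.left⊆ (left i)) (left≢u i)

  right-old : p ∈ R.rest → Old p
  right-old i = avoid (zero , C.right⊆ (right i)) (right≢u i)

  not-other : ∀ k → zero ≢ k → u ∉ᵃ arcs k
  not-other k 0≢k i = [ u≢source ∘ proj₁ , u≢target ∘ proj₁ ]′ (Meet.apart (meet 0≢k) u∈ i)

  along : ∀ {q} → q ∈ᵃ P → Adj H u q → q ≡ L.next ⊎ q ≡ R.next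
  along i a = [ (λ j → inj₁ (L.only (in-left j (adj⇒≢ H a ∘ sym)) a)) , (λ j → inj₂ (R.only (in-right j (adj⇒≢ H a ∘ sym)) a)) ]′ (C.cover i)

  on-path : ∀ {k q} → zero ≢ k → q ∈ᵃ arcs k → Adj H u q → q ∈ᵃ P
  on-path {k} 0≢k i a with Meet.edge (meet 0≢k) u∈ i a
  ... | on-right b = contradiction b (not-other k 0≢k)
  ... | on-left b  = b
  ... | starts b _ = contradiction b u≢source
  ... | ends b _   = contradiction b u≢target

  neighbour : ∀ {q} → q ∈ᵗ base → Adj H u q → q ≡ L.next ⊎ q ≡ R.next
  neighbour (zero , i)  a = along i a
  neighbour (suc k , i) a = along (on-path (λ ()) i a) a

  subdivide : Adj G y L.next → ¬ Adj G y R.next → Adj G y′ R.next → ¬ Adj G y′ L.next → Lifted G u y y′ (_∈ᵗ base)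
  subdivide yl ¬yr y′r ¬y′l = record
    { config   = three-paths T
    ; sound    = sound
    ; complete = λ { (zero , i) p≢u → zero , onto i p≢u
                   ; (suc zero , i) _ → suc zero , i ; (suc (suc zero) , i) _ → suc (suc zero) , i }
    ; hit      = inj₁ (zero , ∈-++⁺ʳ before (here refl))
    }
    where
    reversed : ∃[ ps ] InducedPath G (source P) L.next ps × ps ≐ L.rest
    reversed = reverse-path (push-path split left-old L.path)
    before : List (Fin m)
    before = proj₁ reversed
    before⊆ : before ⊆ L.rest
    before⊆ = proj₁ (proj₂ (proj₂ reversed))
    ⊆before : L.rest ⊆ before
    ⊆before = proj₂ (proj₂ (proj₂ reversed))
    via-y : ∀ {q} → q ∈ᵃ P → Old q → Adj G y q → q ≡ L.next
    via-y i o a = case along i (near-y⁻ o a) of λ { (inj₁ eq) → eq ; (inj₂ refl) → contradiction a ¬yr }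
    via-y′ : ∀ {q} → q ∈ᵃ P → Old q → Adj G y′ q → q ≡ R.next
    via-y′ i o a = case along i (near-y′⁻ o a) of λ { (inj₂ eq) → eq ; (inj₁ refl) → contradiction a ¬y′l }
    left-P : ∀ {p} → p ∈ L.rest → p ∈ᵃ P
    left-P = C.left⊆ ∘ left
    right-P : ∀ {p} → p ∈ R.rest → p ∈ᵃ P
    right-P = C.right⊆ ∘ right
    left≢right : ∀ {p q} → p ∈ L.rest → q ∈ R.rest → p ≢ q
    left≢right i j refl = left≢u i (C.meet (left i) (right j))
    second : InducedPath G y (target P) (y ∷ y′ ∷ R.rest)
    second = step pair
      (λ { (here eq) → adj⇒≢ G pair eq ; (there i) → proj₁ (right-old i) refl })
      (λ { (here eq) _ → eq
         ; (there i) a → contradiction (via-y (right-P i) (right-old i) a) (left≢right (source∈ L.path) i ∘ sym) })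
      (step y′r (λ i → proj₂ (right-old i) refl) (λ i → via-y′ (right-P i) (right-old i)) (push-path split right-old R.path))
    whole : InducedPath G (source P) (target P) (before ++ y ∷ y′ ∷ R.rest)
    whole = append (proj₁ (proj₂ reversed)) second (adj-sym G yl)
      (λ { i (here refl) → proj₁ (left-old (before⊆ i)) refl
         ; i (there (here refl)) → proj₂ (left-old (before⊆ i)) refl
         ; i (there (there j)) → left≢right (before⊆ i) j refl })
      (λ { i (here refl) a → via-y (left-P (before⊆ i)) (left-old (before⊆ i)) (adj-sym G a) , refl
         ; i (there (here refl)) a → contradiction
             (via-y′ (left-P (before⊆ i)) (left-old (before⊆ i)) (adj-sym G a)) (left≢right (before⊆ i) (source∈ R.path))
         ; i (there (there j)) a →
             case C.cross (left (before⊆ i)) (right j) (keep⁻ (left-old (before⊆ i)) (right-old j) a) of λ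
               { (inj₁ eq) → contradiction eq (left≢u (before⊆ i)) ; (inj₂ eq) → contradiction eq (right≢u j) } })
    Q : Arc G
    Q = record { path = whole }
    members : ∀ {p} → p ∈ᵃ Q → p ≡ y ⊎ p ≡ y′ ⊎ (p ∈ᵃ P × p ≢ u)
    members i = case ∈-++⁻ before i of λ
      { (inj₁ j) → inj₂ (inj₂ (left-P (before⊆ j) , left≢u (before⊆ j)))
      ; (inj₂ (here eq)) → inj₁ eq
      ; (inj₂ (there (here eq))) → inj₂ (inj₁ eq)
      ; (inj₂ (there (there j))) → inj₂ (inj₂ (right-P j , right≢u j)) }
    onto : ∀ {p} → p ∈ᵃ P → p ≢ u → p ∈ᵃ Q
    onto i p≢u = [ (λ j → ∈-++⁺ˡ (⊆before (in-left j p≢u)))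
                 , (λ j → ∈-++⁺ʳ before (there (there (in-right j p≢u)))) ]′ (C.cover i)
    other-old : ∀ {k p} → zero ≢ k → p ∈ᵃ arcs k → Old p
    other-old {k} 0≢k i = avoid (k , i) λ { refl → not-other k 0≢k i }
    other : ∀ k → zero ≢ k → Arc G
    other k 0≢k = push-arc split (arcs k) (other-old 0≢k)
    first : ∀ k (0≢k : zero ≢ k) → Meet Q (other k 0≢k)
    first k 0≢k = record
      { apart = λ i j → case members i of λ
          { (inj₁ refl) → contradiction refl (proj₁ (other-old 0≢k j))
          ; (inj₂ (inj₁ refl)) → contradiction refl (proj₂ (other-old 0≢k j))
          ; (inj₂ (inj₂ (i′ , _))) → Meet.apart (meet 0≢k) i′ j }
      ; edge  = λ i j a → case members i of λ
          { (inj₁ refl) → new j (near-y⁻ (other-old 0≢k j) a)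
          ; (inj₂ (inj₁ refl)) → new j (near-y′⁻ (other-old 0≢k j) a)
          ; (inj₂ (inj₂ (i′ , p≢u))) →
              case Meet.edge (meet 0≢k) i′ j (keep⁻ (avoid (zero , i′) p≢u) (other-old 0≢k j) a) of λ
                { (on-right b) → on-right b
                ; (on-left b)  → on-left (onto b λ { refl → not-other k 0≢k j })
                ; (starts b c) → starts b c
                ; (ends b c)   → ends b c } }
      }
      where
      -- A vertex of another arc seen by `y` or `y′` was a neighbour of `u`, and hence lies on `P`
      -- as well.
      new : ∀ {p q} → q ∈ᵃ arcs k → Adj H u q → Contact Q (other k 0≢k) p q
      new j a = on-left (onto (on-path 0≢k j a) (adj⇒≢ H a ∘ sym))
    arcs′ : Fin 3 → Arc G
    arcs′ = three Q (other (suc zero) λ ()) (other (suc (suc zero)) λ ())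
    rest : Meet (arcs′ (suc zero)) (arcs′ (suc (suc zero)))
    rest = record
      { apart = Meet.apart (meet λ ())
      ; edge  = λ i j a → case Meet.edge (meet {suc zero} {suc (suc zero)} λ ()) i j
                  (keep⁻ (other-old (λ ()) i) (other-old (λ ()) j) a) of λ
          { (on-right b) → on-right b ; (on-left b) → on-left b ; (starts b c) → starts b c ; (ends b c) → ends b c }
      }
    sources : ∀ i → source (arcs′ i) ≡ source (arcs i)
    sources = all-three refl refl refl
    targets : ∀ i → target (arcs′ i) ≡ target (arcs i)
    targets = all-three refl refl refl
    source-old : ∀ i → Old (source (arcs i))
    source-old zero    = avoid (zero , source∈ (path P)) (u≢source ∘ sym)
    source-old (suc k) = other-old (λ ()) (source∈ (path (arcs (suc k))))
    target-old : ∀ i → Old (target (arcs i))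
    target-old zero    = avoid (zero , target∈ (path P)) (u≢target ∘ sym)
    target-old (suc k) = other-old (λ ()) (target∈ (path (arcs (suc k))))
    transfer : {φ ψ : Fin 3 → Fin m} → (∀ i → φ i ≡ ψ i) → Joined G ψ → Joined G φ
    transfer e (point f)   = point (λ i j → trans (e i) (trans (f i j) (sym (e j))))
    transfer e (corners c) = corners (λ {i} {j} i≢j →
      subst (λ p → Adj G p _) (sym (e i)) (subst (λ p → Adj G _ p) (sym (e j)) (c i≢j)))
    T : ThreePaths G
    T = record
      { arcs  = arcs′
      ; meet  = pairwise {R = λ i j → Meet (arcs′ i) (arcs′ j)} meet-sym (first (suc zero) λ ()) (first (suc (suc zero)) λ ()) rest
      ; start = transfer sources (push-joined split source-old start)
      ; end   = transfer targets (push-joined split target-old end)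
      ; long  = λ i eq → long i (trans (sym (sources i)) (trans eq (targets i)))
      ; thin  = λ s t i a → thin
          (λ j k → trans (sym (sources j)) (trans (s j k) (sources k)))
          (λ j k → trans (sym (targets j)) (trans (t j k) (targets k))) i
          (keep⁻ (source-old i) (target-old i)
            (subst (λ p → Adj G p _) (sources i) (subst (Adj G (source (arcs′ i))) (targets i) a)))
      }
    sound : ∀ {p} → p ∈ᵗ T → p ≡ y ⊎ p ≡ y′ ⊎ (p ∈ᵗ base × p ≢ u)
    sound (zero , i) = case members i of λ
      { (inj₁ a) → inj₁ a ; (inj₂ (inj₁ a)) → inj₂ (inj₁ a) ; (inj₂ (inj₂ (a , b))) → inj₂ (inj₂ ((zero , a) , b)) }
    sound (suc zero , i) = inj₂ (inj₂ ((suc zero , i) , λ { refl → not-other (suc zero) (λ ()) i }))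
    sound (suc (suc zero) , i) = inj₂ (inj₂ ((suc (suc zero) , i) , λ { refl → not-other (suc (suc zero)) (λ ()) i }))

-- A neighbour of `u` missed by one of `y`, `y′` is seen by the other. So they miss different
-- neighbours, and as there are only two, each sees exactly one.
interior-split : {y y′ : Fin m} (X : ThreeSplit H G u y y′) → let open ThreeSplit X in
                 u ∈ᵃ arcs zero → u ≢ source (arcs zero) → u ≢ target (arcs zero) →
                 Misses H G u y (_∈ᵗ base) → Misses H G u y′ (_∈ᵗ base) → Lifted G u y y′ (_∈ᵗ base)
interior-split {H = H} {G = G} {u = u} {y = y} {y′ = y′} X u∈ u≢s u≢t (q , i , a , ¬b) (q′ , i′ , a′ , ¬b′) =
  result (I.neighbour i a) (I.neighbour i′ a′)
  where
  open ThreeSplit X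
  module I = Interior X u∈ u≢s u≢t
  module J = Interior (threeSplit-swap X) u∈ u≢s u≢t
  old : ∀ {p} → p ≡ I.L.next ⊎ p ≡ I.R.next → Old p
  old (inj₁ refl) = I.left-old (source∈ I.L.path)
  old (inj₂ refl) = I.right-old (source∈ I.R.path)
  result : q ≡ I.L.next ⊎ q ≡ I.R.next → q′ ≡ I.L.next ⊎ q′ ≡ I.R.next → Lifted G u y y′ (_∈ᵗ base)
  result e e′ with near (old e) a | near (old e′) a′
  ... | inj₁ b | _       = contradiction b ¬b
  ... | _      | inj₂ b′ = contradiction b′ ¬b′
  result (inj₁ refl) (inj₁ refl) | inj₂ b | inj₁ b′ = contradiction b ¬b′
  result (inj₂ refl) (inj₂ refl) | inj₂ b | inj₁ b′ = contradiction b ¬b′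
  result (inj₂ refl) (inj₁ refl) | inj₂ b | inj₁ b′ = I.subdivide b′ ¬b b ¬b′
  result (inj₁ refl) (inj₂ refl) | inj₂ b | inj₁ b′ = lifted-swap (J.subdivide b ¬b′ b′ ¬b)

swap₁₂ : Fin 3 → Fin 3
swap₁₂ = three zero (suc (suc zero)) (suc zero)

swap₁₂-involutive : ∀ i → swap₁₂ (swap₁₂ i) ≡ i
swap₁₂-involutive = all-three refl refl refl

-- Splitting a common end of the three paths

-- With a common start, `strict` forbids arcs of length one. Hence every leg still has an edge
-- (`long-leg`), and its source lies on no other leg (`foreign`).
record PointSplit (H G : Graph (Fin m)) (u y y′ : Fin m) : Set where
  field
    threeSplit : ThreeSplit H G u y y′
  open ThreeSplit threeSplit public
  field
    sources : ∀ i → source (arcs i) ≡ u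
  open Stripped (strip base) public hiding (cover; heads; split)

  leg≢u : ∀ {j p} → p ∈ᵃ legs j → p ≢ u
  leg≢u {j} i refl = heads-fresh j j (subst (_∈ᵃ legs j) (sym (sources j)) i)

  leg-old : ∀ j {p} → p ∈ᵃ legs j → Old p
  leg-old j i = avoid (j , legs⊆ j i) (leg≢u i)

  spoke : ∀ j → Adj H u (source (legs j))
  spoke j = subst (λ p → Adj H p (source (legs j))) (sources j) (heads-adj j)

  leg-only : ∀ {j q} → q ∈ᵃ legs j → Adj H u q → q ≡ source (legs j)
  leg-only {j} i a = [ id , proj₂ ]′ (heads-only {j} {j} i (subst (λ p → Adj H p _) (sym (sources j)) a))

  no-tip : ∀ j → ¬ Adj H u (target (arcs j))
  no-tip j a = strict (inj₁ (all-equal sources)) j (subst (λ p → Adj H p _) (sym (sources j)) a)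

  long-leg : ∀ j → source (legs j) ≢ target (legs j)
  long-leg j eq = no-tip j (subst (Adj H u) (trans eq (target≡ j)) (spoke j))

  foreign : ∀ {i j} → i ≢ j → source (legs i) ∉ᵃ legs j
  foreign {i} i≢j b = long-leg i (proj₁ (Meetₜ.apart (meetₜ i≢j) (source∈ (path (legs i))) b))

  pushed : Legs G
  pushed = push-legs split rest leg-old

  spoke-old : ∀ j → Old (source (legs j))
  spoke-old j = leg-old j (source∈ (path (legs j)))

  near-spoke : ∀ j → Adj G y (source (legs j)) ⊎ Adj G y′ (source (legs j))
  near-spoke j = near (spoke-old j) (spoke j)

  members : ∀ {p} → p ∈ᵗ base → p ≢ u → ∃[ j ] p ∈ᵃ legs j
  members (j , i) p≢u = [ (λ eq → contradiction (trans eq (sources j)) p≢u) , (λ i → j , i) ]′ (Stripped.cover (strip base) j i)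

  missed : ∀ {w} → Misses H G u w (_∈ᵗ base) → ∃[ k ] ¬ Adj G w (source (legs k))
  missed (q , i , a , ¬b) with members i (adj⇒≢ H a ∘ sym)
  ... | j , i′ = j , λ b → ¬b (subst (Adj G _) (sym (leg-only i′ a)) b)

pointSplit-swap : {y y′ : Fin m} → PointSplit H G u y y′ → PointSplit H G u y′ y
pointSplit-swap X = record { threeSplit = threeSplit-swap threeSplit ; sources = sources }
  where open PointSplit X

pointSplit-permute : {y y′ : Fin m} (σ : Fin 3 → Fin 3) → (∀ i → σ (σ i) ≡ i) → PointSplit H G u y y′ → PointSplit H G u y y′
pointSplit-permute σ σσ X = record { threeSplit = threeSplit-permute σ σσ threeSplit ; sources = sources ∘ σ }
  where open PointSplit X

unpermute : {y y′ : Fin m} (σ : Fin 3 → Fin 3) (σσ : ∀ i → σ (σ i) ≡ i) (T : ThreePaths H) →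
            Lifted G u y y′ (_∈ᵗ permute σ σσ T) → Lifted G u y y′ (_∈ᵗ T)
unpermute σ σσ T = lifted-resp (∈-permute⁻ σ σσ T) (∈-permute σ σσ T)

i₁ i₂ : Fin 3
i₁ = suc zero
i₂ = suc (suc zero)

-- Here `y′` sees only leg zero: it becomes the first vertex of this leg, and `y` is the new common
-- start.
point-to-point : {y y′ : Fin m} (X : PointSplit H G u y y′) → let open PointSplit X in
                 ¬ Adj G y (source (legs zero)) → Adj G y (source (legs i₁)) → Adj G y (source (legs i₂)) →
                 ¬ Adj G y′ (source (legs i₁)) → ¬ Adj G y′ (source (legs i₂)) →
                 Lifted G u y y′ (_∈ᵗ base)
point-to-point {H = H} {G = G} {u = u} {y = y} {y′ = y′} X ¬y₀ y₁ y₂ ¬y′₁ ¬y′₂ = record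
  { config   = three-paths T
  ; sound    = λ
      { (_ , here eq) → inj₁ eq
      ; (zero , there (here eq)) → inj₂ (inj₁ eq)
      ; (zero , there (there i)) → old zero i
      ; (suc zero , there i) → old i₁ i
      ; (suc (suc zero) , there i) → old i₂ i }
  ; complete = λ i p≢u → case members i p≢u of λ
      { (zero , j) → zero , there (there j) ; (suc zero , j) → i₁ , there j ; (suc (suc zero) , j) → i₂ , there j }
  ; hit      = inj₁ (zero , here refl)
  }
  where
  open PointSplit X
  y′₀ : Adj G y′ (source (legs zero))
  y′₀ = [ (λ a → contradiction a ¬y₀) , id ]′ (near-spoke zero)
  L : Legs G
  L = extend pushed zero y′₀ (λ j i → proj₂ (leg-old j i) refl) λ {j} i a →
    all-three {P = λ j → ∀ {q} → q ∈ᵃ legs j → Adj G y′ q → q ≡ source (legs zero)}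
      (λ i a → leg-only i (near-y′⁻ (leg-old zero i) a))
      (λ i a → contradiction (subst (Adj G y′) (leg-only i (near-y′⁻ (leg-old i₁ i) a)) a) ¬y′₁)
      (λ i a → contradiction (subst (Adj G y′) (leg-only i (near-y′⁻ (leg-old i₂ i) a)) a) ¬y′₂) j i a
  only-source : ∀ j {q} → q ∈ᵃ Legs.legs L j → Adj G y q → q ≡ source (Legs.legs L j)
  only-source zero (here eq) a = eq
  only-source zero (there i) a = contradiction (subst (Adj G y) (leg-only i (near-y⁻ (leg-old zero i) a)) a) ¬y₀
  only-source (suc zero) i a = leg-only i (near-y⁻ (leg-old i₁ i) a)
  only-source (suc (suc zero)) i a = leg-only i (near-y⁻ (leg-old i₂ i) a)
  heads : Heads L (λ _ → y)
  heads = record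
    { heads-adj   = all-three pair y₁ y₂
    ; heads-fresh = λ _ → all-three
        (λ { (here eq) → adj⇒≢ G pair eq ; (there i) → proj₁ (leg-old zero i) refl })
        (λ i → proj₁ (leg-old i₁ i) refl) (λ i → proj₁ (leg-old i₂ i) refl)
    ; heads-only  = λ {i} {j} i∈ a → inj₂ (refl , only-source j i∈ a)
    }
  T : ThreePaths G
  T = attach L (λ _ → y) heads (point (λ _ _ → refl)) λ _ _ → all-three (tip zero) (tip i₁) (tip i₂)
    where
    tip : ∀ j → ¬ Adj G y (target (legs j))
    tip j a = no-tip j (subst (Adj H u) (target≡ j) (near-y⁻ (leg-old j (target∈ (path (legs j)))) a))
  old : ∀ j {p} → p ∈ᵃ legs j → p ≡ y ⊎ p ≡ y′ ⊎ (p ∈ᵗ base × p ≢ u)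
  old j i = inj₂ (inj₂ ((j , legs⊆ j i) , leg≢u i))

-- The source `c` of leg two is seen by both, so `y′`, `y` and `c` form a triangle of starts. Leg
-- two loses `c`, which `long-leg` permits.
point-to-triangle : {y y′ : Fin m} (X : PointSplit H G u y y′) → let open PointSplit X in
                    ¬ Adj G y (source (legs zero)) → Adj G y (source (legs i₁)) → Adj G y (source (legs i₂)) →
                    ¬ Adj G y′ (source (legs i₁)) → Adj G y′ (source (legs i₂)) →
                    Lifted G u y y′ (_∈ᵗ base)
point-to-triangle {m} {H = H} {G = G} {u = u} {y = y} {y′ = y′} X ¬y₀ y₁ y₂ ¬y′₁ y′₂ = record
  { config   = three-paths T
  ; sound    = λ
      { (zero , here eq) → inj₂ (inj₁ eq)
      ; (suc zero , here eq) → inj₁ eq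
      ; (suc (suc zero) , here refl) → old i₂ (source∈ (path (legs i₂)))
      ; (zero , there i) → old zero i
      ; (suc zero , there i) → old i₁ i
      ; (suc (suc zero) , there i) → old i₂ (U.rest⊆ i) }
  ; complete = λ i p≢u → case members i p≢u of λ
      { (zero , j) → zero , there j
      ; (suc zero , j) → i₁ , there j
      ; (suc (suc zero) , j) → i₂ , [ here , there ]′ (U.cover j) }
  ; hit      = inj₁ (i₁ , here refl)
  }
  where
  open PointSplit X
  y′₀ : Adj G y′ (source (legs zero))
  y′₀ = [ (λ a → contradiction a ¬y₀) , id ]′ (near-spoke zero)
  c : Fin m
  c = source (legs i₂)
  module U = Uncons (uncons (path (Legs.legs pushed i₂)) (long-leg i₂))
  short : Arc G
  short = record { path = U.path }
  legs′ : Fin 3 → Arc G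
  legs′ = three (Legs.legs pushed zero) (Legs.legs pushed i₁) short
  legs′⊆ : ∀ j {p} → p ∈ᵃ legs′ j → p ∈ᵃ legs j
  legs′⊆ = all-three id id U.rest⊆
  shorten : ∀ {k} → k ≢ i₂ → Meetₜ (Legs.legs pushed k) short
  shorten {k} k≢2 = record
    { apart = λ i j → Meetₜ.apart (meetₜ k≢2) i (U.rest⊆ j)
    ; edge  = λ i j a → case Meetₜ.edge (Legs.meetₜ pushed k≢2) i (U.rest⊆ j) a of λ
        { (inj₁ b) → inj₁ ([ (λ { refl → contradiction i (foreign (k≢2 ∘ sym)) }) , id ]′ (U.cover b))
        ; (inj₂ b) → inj₂ b }
    }
  L : Legs G
  L = record
    { legs  = legs′
    ; meetₜ = pairwise {R = λ i j → Meetₜ (legs′ i) (legs′ j)} meetₜ-sym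
        (Legs.meetₜ pushed λ ()) (shorten λ ()) (shorten λ ())
    ; end   = retip (Legs.end pushed)
    }
    where
    tips : ∀ j → target (legs′ j) ≡ target (legs j)
    tips = all-three refl refl refl
    retip : Joined G (λ j → target (legs j)) → Joined G (λ j → target (legs′ j))
    retip (point e)   = point (λ i j → trans (tips i) (trans (e i j) (sym (tips j))))
    retip (corners e) = corners (pairwise {R = λ i j → Adj G (target (legs′ i)) (target (legs′ j))} (adj-sym G)
                          (e λ ()) (e λ ()) (e λ ()))
  head : Fin 3 → Fin m
  head = three y′ y c
  y-only : ∀ j {q} → q ∈ᵃ legs′ j → Adj G y q → q ≡ source (legs i₁)
  y-only zero i a = contradiction (subst (Adj G y) (leg-only i (near-y⁻ (leg-old zero i) a)) a) ¬y₀
  y-only (suc zero) i a = leg-only i (near-y⁻ (leg-old i₁ i) a)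
  y-only (suc (suc zero)) i a = contradiction
    (subst (_∈ U.rest) (leg-only (U.rest⊆ i) (near-y⁻ (leg-old i₂ (U.rest⊆ i)) a)) i) U.fresh
  y′-only : ∀ j {q} → q ∈ᵃ legs′ j → Adj G y′ q → q ≡ source (legs zero)
  y′-only zero i a = leg-only i (near-y′⁻ (leg-old zero i) a)
  y′-only (suc zero) i a = contradiction (subst (Adj G y′) (leg-only i (near-y′⁻ (leg-old i₁ i) a)) a) ¬y′₁
  y′-only (suc (suc zero)) i a = contradiction
    (subst (_∈ U.rest) (leg-only (U.rest⊆ i) (near-y′⁻ (leg-old i₂ (U.rest⊆ i)) a)) i) U.fresh
  c-other : ∀ k → k ≢ i₂ → ∀ {q} → q ∈ᵃ legs k → Adj G c q → q ≡ U.next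
  c-other k k≢2 i a with Meetₜ.edge (Legs.meetₜ pushed (k≢2 ∘ sym)) (source∈ (path (legs i₂))) i a
  ... | inj₁ b              = contradiction b (foreign (k≢2 ∘ sym))
  ... | inj₂ (inj₂ (b , _)) = contradiction b (long-leg i₂)
  ... | inj₂ (inj₁ b)       = U.only ([ (λ { refl → contradiction a (no-loop G) }) , id ]′ (U.cover b)) a
  c-only : ∀ j {q} → q ∈ᵃ legs′ j → Adj G c q → q ≡ U.next
  c-only zero             = c-other zero λ ()
  c-only (suc zero)       = c-other i₁ λ ()
  c-only (suc (suc zero)) = U.only
  heads : Heads L head
  heads = record
    { heads-adj   = all-three y′₀ y₁ U.adj
    ; heads-fresh = all-three
        (λ j i → proj₂ (leg-old j (legs′⊆ j i)) refl)
        (λ j i → proj₁ (leg-old j (legs′⊆ j i)) refl)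
        (all-three (foreign λ ()) (foreign λ ()) U.fresh)
    ; heads-only  = λ {i} {j} i∈ a → inj₁ (all-three
        {P = λ i → ∀ j {q} → q ∈ᵃ legs′ j → Adj G (head i) q → q ≡ source (legs′ i)} y′-only y-only c-only i j i∈ a)
    }
  T : ThreePaths G
  T = attach L head heads
        (corners (pairwise {R = λ i j → Adj G (head i) (head j)} (adj-sym G) (adj-sym G pair) y′₂ y₂))
        (λ tip _ _ → contradiction (tip zero i₁) (adj⇒≢ G (adj-sym G pair)))
  old : ∀ j {p} → p ∈ᵃ legs j → p ≡ y ⊎ p ≡ y′ ⊎ (p ∈ᵗ base × p ≢ u)
  old j i = inj₂ (inj₂ ((j , legs⊆ j i) , leg≢u i))

-- The legs missed by `y` and `y′` differ, because each leg is seen by one of them. After they have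
-- been moved to the indices zero and one, the third leg decides: seen by both, it closes a
-- triangle; seen by one, that vertex is the new common start.
point-split : {y y′ : Fin m} (X : PointSplit H G u y y′) → let open PointSplit X in
              Misses H G u y (_∈ᵗ base) → Misses H G u y′ (_∈ᵗ base) → Lifted G u y y′ (_∈ᵗ base)
point-split {H = H} {G = G} {u = u} {y = y} {y′ = y′} X M M′ with PointSplit.missed X M
... | k , ¬yₖ = unpermute (exchange k) (exchange-involutive k) (PointSplit.base X)
      (first X₁ (subst (λ j → ¬ Adj G y (source (PointSplit.legs X j))) (sym (exchange-zero k)) ¬yₖ)
        (misses-resp {H = H} {G = G} {u = u} {y = y′} (∈-permute (exchange k) (exchange-involutive k) (PointSplit.base X)) M′))
  where
  X₁ : PointSplit H G u y y′
  X₁ = pointSplit-permute (exchange k) (exchange-involutive k) X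
  second : (X : PointSplit H G u y y′) → let open PointSplit X in
           ¬ Adj G y (source (legs zero)) → ¬ Adj G y′ (source (legs i₁)) → Lifted G u y y′ (_∈ᵗ base)
  second X ¬y₀ ¬y′₁ = result
    where
    open PointSplit X
    y₁ : Adj G y (source (legs i₁))
    y₁ = [ id , (λ a → contradiction a ¬y′₁) ]′ (near-spoke i₁)
    y′₀ : Adj G y′ (source (legs zero))
    y′₀ = [ (λ a → contradiction a ¬y₀) , id ]′ (near-spoke zero)
    result : Lifted G u y y′ (_∈ᵗ base)
    result with Graph._adj?_ G y (source (legs i₂)) | Graph._adj?_ G y′ (source (legs i₂))
    ... | yes y₂ | yes y′₂ = point-to-triangle X ¬y₀ y₁ y₂ ¬y′₁ y′₂
    ... | yes y₂ | no ¬y′₂ = point-to-point X ¬y₀ y₁ y₂ ¬y′₁ ¬y′₂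
    ... | no ¬y₂ | yes y′₂ = lifted-swap (unpermute (exchange i₁) (exchange-involutive i₁) base
            (point-to-point (pointSplit-permute (exchange i₁) (exchange-involutive i₁) (pointSplit-swap X))
              ¬y′₁ y′₀ y′₂ ¬y₀ ¬y₂))
    ... | no ¬y₂ | no ¬y′₂ = contradiction (near-spoke i₂) [ ¬y₂ , ¬y′₂ ]′
  first : (X : PointSplit H G u y y′) → let open PointSplit X in
          ¬ Adj G y (source (legs zero)) → Misses H G u y′ (_∈ᵗ base) → Lifted G u y y′ (_∈ᵗ base)
  first X ¬y₀ M′ with PointSplit.missed X M′
  ... | zero , ¬y′₀ = contradiction (PointSplit.near-spoke X zero) [ ¬y₀ , ¬y′₀ ]′
  ... | suc zero , ¬y′₁ = second X ¬y₀ ¬y′₁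
  ... | suc (suc zero) , ¬y′₂ = unpermute swap₁₂ swap₁₂-involutive (PointSplit.base X)
        (second (pointSplit-permute swap₁₂ swap₁₂-involutive X) ¬y₀ ¬y′₂)

-- Splitting a corner of a triangle

-- In the configuration `u` has exactly three neighbours: the source of its leg and the two other
-- corners. As corners are distinct, only the first alternative of `heads-only` is left.
record CornerSplit (H G : Graph (Fin m)) (u y y′ : Fin m) : Set where
  field
    threeSplit : ThreeSplit H G u y y′
  open ThreeSplit threeSplit public
  field
    source≡ : source (arcs zero) ≡ u
    side-adj  : ∀ {i j} → i ≢ j → Adj H (source (arcs i)) (source (arcs j))
  open Stripped (strip base) public hiding (cover; heads; split)

  leg≢u : ∀ {j p} → p ∈ᵃ legs j → p ≢ u
  leg≢u {j} i refl = heads-fresh zero j (subst (_∈ᵃ legs j) (sym source≡) i)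

  leg-old : ∀ j {p} → p ∈ᵃ legs j → Old p
  leg-old j i = avoid (j , legs⊆ j i) (leg≢u i)

  pushed : Legs G
  pushed = push-legs split rest leg-old

  spoke : Adj H u (source (legs zero))
  spoke = subst (λ p → Adj H p _) source≡ (heads-adj zero)

  side : ∀ {k} → zero ≢ k → Adj H u (source (arcs k))
  side 0≢k = subst (λ p → Adj H p _) source≡ (side-adj 0≢k)

  corner-old : ∀ {k} → zero ≢ k → Old (source (arcs k))
  corner-old {k} 0≢k = avoid (k , source∈ (path (arcs k))) (adj⇒≢ H (side 0≢k) ∘ sym)

  spoke-old : Old (source (legs zero))
  spoke-old = leg-old zero (source∈ (path (legs zero)))

  heads-only′ : ∀ {i j q} → q ∈ᵃ legs j → Adj H (source (arcs i)) q → q ≡ source (legs i)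
  heads-only′ {i} {j} i∈ a with heads-only {i} {j} i∈ a
  ... | inj₁ eq = eq
  ... | inj₂ (eq , q≡) with i Fin.≟ j
  ...   | yes refl = q≡
  ...   | no i≢j   = contradiction eq (adj⇒≢ H (side-adj i≢j))

  leg-only : ∀ {j q} → q ∈ᵃ legs j → Adj H u q → q ≡ source (legs zero)
  leg-only {j} i∈ a = heads-only′ {zero} {j} i∈ (subst (λ p → Adj H p _) (sym source≡) a)

  corner-only : ∀ {k} → zero ≢ k → ∀ {j q} → q ∈ᵃ legs j → Adj G (source (arcs k)) q → q ≡ source (legs k)
  corner-only 0≢k {j} i∈ a = heads-only′ {_} {j} i∈ (keep⁻ (corner-old 0≢k) (leg-old j i∈) a)

  corner-spoke : ∀ {k} → zero ≢ k → Adj G (source (arcs k)) (source (legs k))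
  corner-spoke {k} 0≢k = keep (corner-old 0≢k) (leg-old k (source∈ (path (legs k)))) (heads-adj k)

  opposite : Adj G (source (arcs i₁)) (source (arcs i₂))
  opposite = keep (corner-old λ ()) (corner-old λ ()) (side-adj λ ())

  missed : ∀ {w} → Misses H G u w (_∈ᵗ base) →
           ¬ (Adj G w (source (legs zero)) × Adj G w (source (arcs i₁)) × Adj G w (source (arcs i₂)))
  missed (q , (j , i) , a , ¬b) (b₀ , b₁ , b₂) with Stripped.cover (strip base) j i
  ... | inj₂ i′ = ¬b (subst (Adj G _) (sym (leg-only {j} i′ a)) b₀)
  missed (q , (zero , i) , a , ¬b)             (b₀ , b₁ , b₂) | inj₁ refl = adj⇒≢ H a (sym source≡)
  missed (q , (suc zero , i) , a , ¬b)         (b₀ , b₁ , b₂) | inj₁ refl = ¬b b₁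
  missed (q , (suc (suc zero) , i) , a , ¬b)   (b₀ , b₁ , b₂) | inj₁ refl = ¬b b₂

cornerSplit-swap : {y y′ : Fin m} → CornerSplit H G u y y′ → CornerSplit H G u y′ y
cornerSplit-swap X = record { threeSplit = threeSplit-swap threeSplit ; source≡ = source≡ ; side-adj = side-adj }
  where open CornerSplit X

cornerSplit-reflect : {y y′ : Fin m} → CornerSplit H G u y y′ → CornerSplit H G u y y′
cornerSplit-reflect X = record
  { threeSplit = threeSplit-permute swap₁₂ swap₁₂-involutive threeSplit
  ; source≡    = source≡
  ; side-adj     = λ i≢j → side-adj λ eq → i≢j
      (trans (sym (swap₁₂-involutive _)) (trans (cong swap₁₂ eq) (swap₁₂-involutive _)))
  }
  where open CornerSplit X

-- The triangle is kept with `y` as its corner, and `y′` lengthens leg zero.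
corner-to-corner : {y y′ : Fin m} (X : CornerSplit H G u y y′) → let open CornerSplit X in
                   ¬ Adj G y (source (legs zero)) → Adj G y (source (arcs i₁)) → Adj G y (source (arcs i₂)) →
                   Adj G y′ (source (legs zero)) → ¬ Adj G y′ (source (arcs i₁)) → ¬ Adj G y′ (source (arcs i₂)) →
                   Lifted G u y y′ (_∈ᵗ base)
corner-to-corner {m} {H = H} {G = G} {u = u} {y = y} {y′ = y′} X ¬y₀ y₁ y₂ y′₀ ¬y′₁ ¬y′₂ = record
  { config   = three-paths T
  ; sound    = λ
      { (zero , here eq) → inj₁ eq
      ; (zero , there (here eq)) → inj₂ (inj₁ eq)
      ; (zero , there (there i)) → old zero i
      ; (suc zero , here refl) → old-corner (λ ())
      ; (suc zero , there i) → old i₁ i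
      ; (suc (suc zero) , here refl) → old-corner (λ ())
      ; (suc (suc zero) , there i) → old i₂ i }
  ; complete = λ { (j , i) p≢u → complete j p≢u (Stripped.cover (strip base) j i) }
  ; hit      = inj₁ (zero , here refl)
  }
  where
  open CornerSplit X
  L : Legs G
  L = extend pushed zero y′₀ (λ j i → proj₂ (leg-old j i) refl)
        (λ {j} i a → leg-only {j} i (near-y′⁻ (leg-old j i) a))
  head : Fin 3 → Fin m
  head = three y (source (arcs i₁)) (source (arcs i₂))
  no-y : ∀ j {q} → q ∈ᵃ legs j → ¬ Adj G y q
  no-y j i a = ¬y₀ (subst (Adj G y) (leg-only {j} i (near-y⁻ (leg-old j i) a)) a)
  y-only : ∀ j {q} → q ∈ᵃ Legs.legs L j → Adj G y q → q ≡ y′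
  y-only zero (here eq) a = eq
  y-only zero (there i) a = contradiction a (no-y zero i)
  y-only (suc zero) i a = contradiction a (no-y i₁ i)
  y-only (suc (suc zero)) i a = contradiction a (no-y i₂ i)
  c-only : ∀ {k} → zero ≢ k → ¬ Adj G y′ (source (arcs k)) →
           ∀ j {q} → q ∈ᵃ Legs.legs L j → Adj G (source (arcs k)) q → q ≡ source (legs k)
  c-only 0≢k ¬a zero (here refl) a = contradiction (adj-sym G a) ¬a
  c-only 0≢k ¬a zero (there i) a = corner-only 0≢k {zero} i a
  c-only 0≢k ¬a (suc zero) i a = corner-only 0≢k {i₁} i a
  c-only 0≢k ¬a (suc (suc zero)) i a = corner-only 0≢k {i₂} i a
  c-fresh : ∀ {k} → zero ≢ k → ∀ j → source (arcs k) ∉ᵃ Legs.legs L j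
  c-fresh {k} 0≢k zero (here eq) = proj₂ (corner-old 0≢k) eq
  c-fresh {k} 0≢k zero (there i) = heads-fresh k zero i
  c-fresh {k} 0≢k (suc zero) i = heads-fresh k i₁ i
  c-fresh {k} 0≢k (suc (suc zero)) i = heads-fresh k i₂ i
  heads : Heads L head
  heads = record
    { heads-adj   = all-three pair (corner-spoke λ ()) (corner-spoke λ ())
    ; heads-fresh = all-three
        (all-three (λ { (here eq) → adj⇒≢ G pair eq ; (there i) → proj₁ (leg-old zero i) refl })
          (λ i → proj₁ (leg-old i₁ i) refl) (λ i → proj₁ (leg-old i₂ i) refl))
        (c-fresh λ ()) (c-fresh λ ())
    ; heads-only  = λ {i} {j} i∈ a → inj₁ (all-three
        {P = λ i → ∀ j {q} → q ∈ᵃ Legs.legs L j → Adj G (head i) q → q ≡ source (Legs.legs L i)}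
        y-only (c-only (λ ()) ¬y′₁) (c-only (λ ()) ¬y′₂) i j i∈ a)
    }
  T : ThreePaths G
  T = attach L head heads
        (corners (pairwise {R = λ i j → Adj G (head i) (head j)} (adj-sym G) y₁ y₂ opposite))
        (λ tip _ _ → contradiction (tip zero i₁) (adj⇒≢ G y₁))
  old : ∀ j {p} → p ∈ᵃ legs j → p ≡ y ⊎ p ≡ y′ ⊎ (p ∈ᵗ base × p ≢ u)
  old j i = inj₂ (inj₂ ((j , legs⊆ j i) , leg≢u {j} i))
  old-corner : ∀ {k} → zero ≢ k → source (arcs k) ≡ y ⊎ source (arcs k) ≡ y′ ⊎ (source (arcs k) ∈ᵗ base × source (arcs k) ≢ u)
  old-corner {k} 0≢k = inj₂ (inj₂ ((k , source∈ (path (arcs k))) , adj⇒≢ H (side 0≢k) ∘ sym))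
  complete : ∀ j {p} → p ≢ u → p ≡ source (arcs j) ⊎ p ∈ᵃ legs j → p ∈ᵗ T
  complete zero p≢u (inj₁ eq) = contradiction (trans eq source≡) p≢u
  complete zero p≢u (inj₂ i) = zero , there (there i)
  complete (suc zero) p≢u (inj₁ eq) = i₁ , here eq
  complete (suc zero) p≢u (inj₂ i) = i₁ , there i
  complete (suc (suc zero)) p≢u (inj₁ eq) = i₂ , here eq
  complete (suc (suc zero)) p≢u (inj₂ i) = i₂ , there i

-- Since `y` misses the second of the other corners, the triangle breaks up into a path with the
-- first one, `c₁`, in the middle. This `c₁` becomes a common start, and `y′` is left out. If the
-- targets form a point too, `strict` makes the result a trihedron.
corner-to-point : {y y′ : Fin m} (X : CornerSplit H G u y y′) → let open CornerSplit X in
                  Adj G y (source (legs zero)) → Adj G y (source (arcs i₁)) → ¬ Adj G y (source (arcs i₂)) →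
                  Lifted G u y y′ (_∈ᵗ base)
corner-to-point {m} {H = H} {G = G} {u = u} {y = y} {y′ = y′} X y₀ y₁ ¬y₂ = record
  { config   = three-paths T
  ; sound    = λ
      { (_ , here refl) → old-corner {i₁} (λ ())
      ; (zero , there (here eq)) → inj₁ eq
      ; (zero , there (there i)) → old zero i
      ; (suc zero , there i) → old i₁ i
      ; (suc (suc zero) , there (here refl)) → old-corner {i₂} (λ ())
      ; (suc (suc zero) , there (there i)) → old i₂ i }
  ; complete = λ { (j , i) p≢u → complete j p≢u (Stripped.cover (strip base) j i) }
  ; hit      = inj₁ (zero , there (here refl))
  }
  where
  open CornerSplit X
  c₁ : Fin m
  c₁ = source (arcs i₁)
  L₁ L : Legs G
  L₁ = extend pushed i₂ (corner-spoke λ ()) (heads-fresh i₂) (λ {j} → corner-only (λ ()) {j})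
  L = extend L₁ zero y₀ fresh (λ {j} i a → only j i a)
    where
    fresh : ∀ j → y ∉ᵃ Legs.legs L₁ j
    fresh zero i = proj₁ (leg-old zero i) refl
    fresh (suc zero) i = proj₁ (leg-old i₁ i) refl
    fresh (suc (suc zero)) (here eq) = proj₁ (corner-old {i₂} λ ()) (sym eq)
    fresh (suc (suc zero)) (there i) = proj₁ (leg-old i₂ i) refl
    only : ∀ j {q} → q ∈ᵃ Legs.legs L₁ j → Adj G y q → q ≡ source (legs zero)
    only zero i a = leg-only {zero} i (near-y⁻ (leg-old zero i) a)
    only (suc zero) i a = leg-only {i₁} i (near-y⁻ (leg-old i₁ i) a)
    only (suc (suc zero)) (here refl) a = contradiction a ¬y₂
    only (suc (suc zero)) (there i) a = leg-only {i₂} i (near-y⁻ (leg-old i₂ i) a)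
  short-tip : (∀ i j → target (arcs i) ≡ target (arcs j)) → ¬ Adj G c₁ (target (legs i₁))
  short-tip tip a = strict (inj₂ tip) i₁ (subst (Adj H c₁) (target≡ i₁)
    (keep⁻ (corner-old λ ()) (leg-old i₁ (target∈ (path (legs i₁)))) a))
  -- A vertex seen by `c₁` on another leg would be the source of leg one and the target of both
  -- legs. Then arc one would be a single edge to a common target, or two corners of the end
  -- triangle would coincide.
  foreign : ∀ j → i₁ ≢ j → ∀ {q} → q ∈ᵃ legs j → ¬ Adj G c₁ q
  foreign j 1≢j {q} i a with corner-only {i₁} (λ ()) {j} i a
  ... | refl with Meetₜ.apart (meetₜ 1≢j) (source∈ (path (legs i₁))) i
  ...   | t₁ , tⱼ with end
  ...     | point e   = short-tip e (subst (Adj G c₁) t₁ a)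
  ...     | corners e = adj⇒≢ H (e 1≢j) (trans (sym (target≡ i₁)) (trans (sym t₁) (trans tⱼ (target≡ j))))
  only-source : ∀ j {q} → q ∈ᵃ Legs.legs L j → Adj G c₁ q → q ≡ source (Legs.legs L j)
  only-source zero (here eq) a = eq
  only-source zero (there i) a = contradiction a (foreign zero (λ ()) i)
  only-source (suc zero) i a = corner-only (λ ()) {i₁} i a
  only-source (suc (suc zero)) (here eq) a = eq
  only-source (suc (suc zero)) (there i) a = contradiction a (foreign i₂ (λ ()) i)
  heads : Heads L (λ _ → c₁)
  heads = record
    { heads-adj   = all-three (adj-sym G y₁) (corner-spoke λ ()) opposite
    ; heads-fresh = λ _ → all-three
        (λ { (here eq) → proj₁ (corner-old {i₁} λ ()) eq ; (there i) → heads-fresh i₁ zero i })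
        (heads-fresh i₁ i₁)
        (λ { (here eq) → adj⇒≢ G opposite eq ; (there i) → heads-fresh i₁ i₂ i })
    ; heads-only  = λ {i} {j} i∈ a → inj₂ (refl , only-source j i∈ a)
    }
  targets : ∀ j → target (Legs.legs L j) ≡ target (arcs j)
  targets = all-three (target≡ zero) (target≡ i₁) (target≡ i₂)
  T : ThreePaths G
  T = attach L (λ _ → c₁) heads (point (λ _ _ → refl)) λ _ tip i a →
    short-tip (λ j k → trans (sym (targets j)) (trans (tip j k) (targets k))) (subst (Adj G c₁) (tip i i₁) a)
  old : ∀ j {p} → p ∈ᵃ legs j → p ≡ y ⊎ p ≡ y′ ⊎ (p ∈ᵗ base × p ≢ u)
  old j i = inj₂ (inj₂ ((j , legs⊆ j i) , leg≢u {j} i))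
  old-corner : ∀ {k} → zero ≢ k → source (arcs k) ≡ y ⊎ source (arcs k) ≡ y′ ⊎ (source (arcs k) ∈ᵗ base × source (arcs k) ≢ u)
  old-corner {k} 0≢k = inj₂ (inj₂ ((k , source∈ (path (arcs k))) , adj⇒≢ H (side 0≢k) ∘ sym))
  complete : ∀ j {p} → p ≢ u → p ≡ source (arcs j) ⊎ p ∈ᵃ legs j → p ∈ᵗ T
  complete zero p≢u (inj₁ eq) = contradiction (trans eq source≡) p≢u
  complete zero p≢u (inj₂ i) = zero , there (there i)
  complete (suc zero) p≢u (inj₁ eq) = zero , here eq
  complete (suc zero) p≢u (inj₂ i) = i₁ , there i
  complete (suc (suc zero)) p≢u (inj₁ eq) = i₂ , there (here eq)
  complete (suc (suc zero)) p≢u (inj₂ i) = i₂ , there (there i)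

corner-to-point′ : {y y′ : Fin m} (X : CornerSplit H G u y y′) → let open CornerSplit X in
                   Adj G y (source (legs zero)) → ¬ Adj G y (source (arcs i₁)) → Adj G y (source (arcs i₂)) →
                   Lifted G u y y′ (_∈ᵗ base)
corner-to-point′ X y₀ ¬y₁ y₂ = unpermute swap₁₂ swap₁₂-involutive (CornerSplit.base X)
  (corner-to-point (cornerSplit-reflect X) y₀ y₂ ¬y₁)

-- Neither of `y`, `y′` sees all three neighbours of `u`. One that sees the leg and a single corner
-- suffices on its own. Otherwise the one that sees the leg sees no corner, so the other sees both
-- corners and not the leg.
corner-split : {y y′ : Fin m} (X : CornerSplit H G u y y′) → let open CornerSplit X in
               Misses H G u y (_∈ᵗ base) → Misses H G u y′ (_∈ᵗ base) → Lifted G u y y′ (_∈ᵗ base)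
corner-split {H = H} {G = G} {u = u} {y = y} {y′ = y′} X M M′ = result
  where
  open CornerSplit X
  n₀ : Adj G y (source (legs zero)) ⊎ Adj G y′ (source (legs zero))
  n₀ = near spoke-old spoke
  n₁ : Adj G y (source (arcs i₁)) ⊎ Adj G y′ (source (arcs i₁))
  n₁ = near (corner-old λ ()) (side λ ())
  n₂ : Adj G y (source (arcs i₂)) ⊎ Adj G y′ (source (arcs i₂))
  n₂ = near (corner-old λ ()) (side λ ())
  result : Lifted G u y y′ (_∈ᵗ base)
  result with Graph._adj?_ G y (source (legs zero)) | Graph._adj?_ G y (source (arcs i₁)) | Graph._adj?_ G y (source (arcs i₂))
            | Graph._adj?_ G y′ (source (legs zero)) | Graph._adj?_ G y′ (source (arcs i₁)) | Graph._adj?_ G y′ (source (arcs i₂))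
  ... | yes a | yes b | yes c | _ | _ | _ = contradiction (a , b , c) (missed M)
  ... | yes a | yes b | no ¬c | _ | _ | _ = corner-to-point X a b ¬c
  ... | yes a | no ¬b | yes c | _ | _ | _ = corner-to-point′ X a ¬b c
  ... | _ | _ | _ | yes a | yes b | yes c = contradiction (a , b , c) (missed M′)
  ... | _ | _ | _ | yes a | yes b | no ¬c = lifted-swap (corner-to-point (cornerSplit-swap X) a b ¬c)
  ... | _ | _ | _ | yes a | no ¬b | yes c = lifted-swap (corner-to-point′ (cornerSplit-swap X) a ¬b c)
  ... | yes a | no ¬b | no ¬c | no ¬a | yes b | yes c =
        lifted-swap (corner-to-corner (cornerSplit-swap X) ¬a b c a ¬b ¬c)
  ... | no ¬a | yes b | yes c | yes a | no ¬b | no ¬c = corner-to-corner X ¬a b c a ¬b ¬c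
  ... | no ¬a | _ | _ | no ¬a′ | _ | _ = contradiction n₀ [ ¬a , ¬a′ ]′
  ... | _ | no ¬b | _ | _ | no ¬b′ | _ = contradiction n₁ [ ¬b , ¬b′ ]′
  ... | _ | _ | no ¬c | _ | _ | no ¬c′ = contradiction n₂ [ ¬c , ¬c′ ]′

-- Embeddings of configurations

record Embeds (H G : Graph (Fin m)) (P : Fin m → Set) (φ : Fin m → Fin m) : Set where
  field
    to  : ∀ {p q} → P p → P q → Adj H p q → Adj G (φ p) (φ q)
    from : ∀ {p q} → P p → P q → Adj G (φ p) (φ q) → Adj H p q
    inj : ∀ {p q} → P p → P q → φ p ≡ φ q → p ≡ q

∉-map : {P : Fin m → Set} {φ : Fin m → Fin m} → (∀ {p q} → P p → P q → φ p ≡ φ q → p ≡ q) →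
        P p → (∀ {q} → q ∈ ps → P q) → p ∉ ps → φ p ∉ map φ ps
∉-map inj Pp F n i with ∈-map⁻ _ i
... | q , j , eq = n (subst (_∈ _) (sym (inj Pp (F j) eq)) j)

map-path : {P : Fin m → Set} {φ : Fin m → Fin m} → Embeds H G P φ → (∀ {p} → p ∈ ps → P p) →
           InducedPath H f g ps → InducedPath G (φ f) (φ g) (map φ ps)
map-path E F stop = stop
map-path {G = G} {φ = φ} E F (step {f = f} {p = p} {ps = ps} a n u P) =
  step (to (F (here refl)) (F (there (source∈ P))) a) (∉-map inj (F (here refl)) (F ∘ there) n) only (map-path E (F ∘ there) P)
  where
  open Embeds E
  only : ∀ {q} → q ∈ map φ ps → Adj G (φ f) q → q ≡ φ p
  only i b with ∈-map⁻ φ i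
  ... | q , j , refl = cong φ (u j (from (F (here refl)) (F (there j)) b))

map-config : {φ : Fin m → Fin m} (C : Config H) → Embeds H G (_∈ᶜ C) φ →
             Σ (Config G) λ D → (∀ {q} → q ∈ᶜ D → ∃[ p ] p ∈ᶜ C × q ≡ φ p) × (∀ {p} → p ∈ᶜ C → φ p ∈ᶜ D)
map-config {m} {H = H} {G = G} {φ = φ} (wheel W) E = wheel W′ , ∈-map⁻ φ , ∈-map⁺ φ
  where
  open Embeds E
  open Wheel W
  open Rim rim
  only : ∀ {q} → q ∈ map φ ring → Adj G (φ apex) q → q ≡ φ first ⊎ q ≡ φ last
  only i a with ∈-map⁻ φ i
  ... | q , j , refl = [ (λ { refl → inj₁ refl }) , (λ { refl → inj₂ refl }) ]′
                         (apex-only j (from (there (here refl)) (there (there j)) a))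
  W′ : Wheel G
  W′ = record
    { rim  = record
      { ring-path  = map-path E (there ∘ there) ring-path
      ; first≢last = first≢last ∘ inj (there (there (source∈ ring-path))) (there (there (target∈ ring-path)))
      ; apex∉      = ∉-map inj (there (here refl)) (there ∘ there) apex∉
      ; apex-first = to (there (here refl)) (there (there (source∈ ring-path))) apex-first
      ; apex-last  = to (there (here refl)) (there (there (target∈ ring-path))) apex-last
      ; apex-only  = only
      }
    ; hub  = φ hub
    ; hub∉ = ∉-map inj (here refl) there hub∉
    ; feet = three-map φ (λ (i , a) → ∈-map⁺ φ i , to (here refl) (there i) a)
               (λ (i , _) (j , _) → inj (there i) (there j)) feet
    }
map-config {m} {H = H} {G = G} {φ = φ} (three-paths T) E = three-paths T′ , sound , (λ (j , i) → j , ∈-map⁺ φ i)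
  where
  open Embeds E
  open ThreePaths T
  arcs′ : Fin 3 → Arc G
  arcs′ i = record { path = map-path E (i ,_) (path (arcs i)) }
  joined : {ψ : Fin 3 → Fin m} → (∀ i → ψ i ∈ᵗ T) → Joined H ψ → Joined G (φ ∘ ψ)
  joined F (point e)   = point (λ i j → cong φ (e i j))
  joined F (corners c) = corners (λ {i} {j} i≢j → to (F i) (F j) (c i≢j))
  sources : ∀ i → source (arcs i) ∈ᵗ T
  sources i = i , source∈ (path (arcs i))
  targets : ∀ i → target (arcs i) ∈ᵗ T
  targets i = i , target∈ (path (arcs i))
  apart : ∀ {i j p} → i ≢ j → p ∈ᵃ arcs′ i → p ∈ᵃ arcs′ j →
          (p ≡ φ (source (arcs i)) × p ≡ φ (source (arcs j))) ⊎ (p ≡ φ (target (arcs i)) × p ≡ φ (target (arcs j)))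
  apart {i} {j} i≢j a b with ∈-map⁻ φ a | ∈-map⁻ φ b
  ... | p , a′ , refl | q , b′ , eq with inj (i , a′) (j , b′) eq
  ...   | refl with Meet.apart (meet i≢j) a′ b′
  ...     | inj₁ (c , d) = inj₁ (cong φ c , cong φ d)
  ...     | inj₂ (c , d) = inj₂ (cong φ c , cong φ d)
  edge : ∀ {i j p q} → i ≢ j → p ∈ᵃ arcs′ i → q ∈ᵃ arcs′ j → Adj G p q → Contact (arcs′ i) (arcs′ j) p q
  edge {i} {j} i≢j a b e with ∈-map⁻ φ a | ∈-map⁻ φ b
  ... | p , a′ , refl | q , b′ , refl with Meet.edge (meet i≢j) a′ b′ (from (i , a′) (j , b′) e)
  ...   | on-right c = on-right (∈-map⁺ φ c)
  ...   | on-left c  = on-left (∈-map⁺ φ c)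
  ...   | starts c d = starts (cong φ c) (cong φ d)
  ...   | ends c d   = ends (cong φ c) (cong φ d)
  T′ : ThreePaths G
  T′ = record
    { arcs  = arcs′
    ; meet  = λ i≢j → record { apart = apart i≢j ; edge = edge i≢j }
    ; start = joined sources start
    ; end   = joined targets end
    ; long  = λ i eq → long i (inj (sources i) (targets i) eq)
    ; thin  = λ s t i a → thin (λ j k → inj (sources j) (sources k) (s j k))
                (λ j k → inj (targets j) (targets k) (t j k)) i (from (sources i) (targets i) a)
    }
  sound : ∀ {q} → q ∈ᵗ T′ → ∃[ p ] p ∈ᵗ T × q ≡ φ p
  sound (j , i) with ∈-map⁻ φ i
  ... | p , i′ , eq = p , (j , i′) , eq

-- Lifting configurations along contractions

-- For two points `thin` says it all, and for two triangles the premise of `Strict` fails. A stamp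
-- with a path of length one is a wheel, once this path has index zero and the triangle is at the
-- start.
wheel-or-strict : (T : ThreePaths G) →
                  (∃[ W ] (∀ {p} → p ∈ᵗ T → p ∈ʷ W) × (∀ {p} → p ∈ʷ W → p ∈ᵗ T)) ⊎ Strict T
wheel-or-strict {G = G} T with ThreePaths.start T in s | ThreePaths.end T in e
... | point a | point b = inj₂ λ _ → ThreePaths.thin T a b
... | corners a | corners b = inj₂ λ
  { (inj₁ eq) → contradiction (eq zero i₁) (adj⇒≢ G (a λ ()))
  ; (inj₂ eq) → contradiction (eq zero i₁) (adj⇒≢ G (b λ ())) }
... | corners a | point b
  with Fin.any? (λ i → Graph._adj?_ G (source (ThreePaths.arcs T i)) (target (ThreePaths.arcs T i)))
...   | no ¬c = inj₂ λ _ i c → ¬c (i , c)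
...   | yes (i , c) with short⇒wheel (permute (exchange i) (exchange-involutive i) T)
          (λ j≢k → a λ eq → j≢k (trans (sym (exchange-involutive i _)) (trans (cong (exchange i) eq) (exchange-involutive i _))))
          (λ j k → b (exchange i j) (exchange i k))
          (subst (λ j → Adj G (source (ThreePaths.arcs T j)) (target (ThreePaths.arcs T j))) (sym (exchange-zero i)) c)
...     | W , to , from = inj₁ (W
          , (λ x → to (∈-permute (exchange i) (exchange-involutive i) T x))
          , (λ x → ∈-permute⁻ (exchange i) (exchange-involutive i) T (from x)))
wheel-or-strict {G = G} T | point b | corners a
  with Fin.any? (λ i → Graph._adj?_ G (target (ThreePaths.arcs T i)) (source (ThreePaths.arcs T i)))
...   | no ¬c = inj₂ λ _ i c → ¬c (i , adj-sym G c)
...   | yes (i , c) with short⇒wheel (permute (exchange i) (exchange-involutive i) (reverse-all T))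
          (λ j≢k → a λ eq → j≢k (trans (sym (exchange-involutive i _)) (trans (cong (exchange i) eq) (exchange-involutive i _))))
          (λ j k → b (exchange i j) (exchange i k))
          (subst (λ j → Adj G (target (ThreePaths.arcs T j)) (source (ThreePaths.arcs T j))) (sym (exchange-zero i)) c)
...     | W , to , from = inj₁ (W
          , (λ (j , x) → to (∈-permute (exchange i) (exchange-involutive i) (reverse-all T) (j , ∈-reverse (ThreePaths.arcs T j) x)))
          , (λ x → map₂ (λ {j} → ∈-reverse⁻ (ThreePaths.arcs T j)) (∈-permute⁻ (exchange i) (exchange-involutive i) (reverse-all T) (from x))))

wheel-split : {y y′ : Fin m} → Split H G u y y′ → (W : Wheel H) → Avoids y y′ u (_∈ʷ W) → u ∈ʷ W →
              Misses H G u y (_∈ʷ W) → Misses H G u y′ (_∈ʷ W) → Lifted G u y y′ (_∈ʷ W)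
wheel-split S W avoid (here refl) M M′ = hub-split S W refl avoid
wheel-split {H = H} {G = G} {u = u} {y = y} {y′ = y′} S W avoid (there i) M M′ with rotate (Wheel.rim W) i
... | R , apex≡ , to , from = lifted-resp under⁻ under (rim-split
        (record { split = S ; base = W′ ; apex≡ = apex≡ ; avoid = λ j → avoid (under⁻ j) })
        (misses-resp {H = H} {G = G} {u = u} {y = y} under M) (misses-resp {H = H} {G = G} {u = u} {y = y′} under M′))
  where
  open Wheel W
  W′ : Wheel H
  W′ = record
    { rim  = R
    ; hub  = hub
    ; hub∉ = hub∉ ∘ from
    ; feet = three-map id (λ (j , a) → to j , a) (λ _ _ → id) feet
    }
  under : ∀ {p} → p ∈ʷ W → p ∈ʷ W′
  under (here eq) = here eq
  under (there j) = there (to j)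
  under⁻ : ∀ {p} → p ∈ʷ W′ → p ∈ʷ W
  under⁻ (here eq) = here eq
  under⁻ (there j) = there (from j)

start-split : {y y′ : Fin m} (X : ThreeSplit H G u y y′) → let open ThreeSplit X in
              source (arcs zero) ≡ u → Misses H G u y (_∈ᵗ base) → Misses H G u y′ (_∈ᵗ base) →
              Lifted G u y y′ (_∈ᵗ base)
start-split X source≡ with ThreePaths.start (ThreeSplit.base X)
... | point e   = point-split (record { threeSplit = X ; sources = λ i → trans (e i zero) source≡ })
... | corners c = corner-split (record { threeSplit = X ; source≡ = source≡ ; side-adj = c })

three-split : {y y′ : Fin m} (X : ThreeSplit H G u y y′) → let open ThreeSplit X in
              u ∈ᵗ base → Misses H G u y (_∈ᵗ base) → Misses H G u y′ (_∈ᵗ base) → Lifted G u y y′ (_∈ᵗ base)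
three-split {H = H} {G = G} {u = u} {y = y} {y′ = y′} X (k , u∈) M M′ =
  unpermute (exchange k) (exchange-involutive k) base
    (first (threeSplit-permute (exchange k) (exchange-involutive k) X)
      (subst (λ j → u ∈ᵃ arcs j) (sym (exchange-zero k)) u∈)
      (misses-resp {H = H} {G = G} {u = u} {y = y} (∈-permute (exchange k) (exchange-involutive k) base) M)
      (misses-resp {H = H} {G = G} {u = u} {y = y′} (∈-permute (exchange k) (exchange-involutive k) base) M′))
  where
  open ThreeSplit X
  first : (X : ThreeSplit H G u y y′) → u ∈ᵃ ThreePaths.arcs (ThreeSplit.base X) zero →
          Misses H G u y (_∈ᵗ ThreeSplit.base X) → Misses H G u y′ (_∈ᵗ ThreeSplit.base X) →
          Lifted G u y y′ (_∈ᵗ ThreeSplit.base X)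
  first X u∈ M M′ with u Fin.≟ source (ThreePaths.arcs (ThreeSplit.base X) zero)
                     | u Fin.≟ target (ThreePaths.arcs (ThreeSplit.base X) zero)
  ... | yes eq | _      = start-split X (sym eq) M M′
  ... | no u≢s | no u≢t = interior-split X u∈ u≢s u≢t M M′
  ... | no _   | yes eq = lifted-resp back forth (start-split
          (record { split = X.split ; base = reverse-all X.base ; avoid = λ i → X.avoid (back i)
                  ; strict = λ eqs i a → X.strict (swap eqs) i (adj-sym H a) })
          (sym eq) (misses-resp {H = H} {G = G} {u = u} {y = y} forth M) (misses-resp {H = H} {G = G} {u = u} {y = y′} forth M′))
    where
    module X = ThreeSplit X
    forth : ∀ {p} → p ∈ᵗ X.base → p ∈ᵗ reverse-all X.base
    forth (j , i) = j , ∈-reverse (X.arcs j) i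
    back : ∀ {p} → p ∈ᵗ reverse-all X.base → p ∈ᵗ X.base
    back (j , i) = j , ∈-reverse⁻ (X.arcs j) i

proper-split : {y y′ : Fin m} → Split H G u y y′ → (C : Config H) → Avoids y y′ u (_∈ᶜ C) → u ∈ᶜ C →
               Misses H G u y (_∈ᶜ C) → Misses H G u y′ (_∈ᶜ C) → Lifted G u y y′ (_∈ᶜ C)
proper-split S (wheel W) avoid u∈ M M′ = wheel-split S W avoid u∈ M M′
proper-split {H = H} {G = G} {u = u} {y = y} {y′ = y′} S (three-paths T) avoid u∈ M M′ with wheel-or-strict T
... | inj₁ (W , to , from) = lifted-resp from to (wheel-split S W (avoid ∘ from) (to u∈)
        (misses-resp {H = H} {G = G} {u = u} {y = y} to M) (misses-resp {H = H} {G = G} {u = u} {y = y′} to M′))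
... | inj₂ strict = three-split (record { split = S ; base = T ; avoid = avoid ; strict = strict }) u∈ M M′

-- Renaming `u` to `y` is an embedding: `y` sees every neighbour of `u` in `C`, and it sees no
-- others because its neighbours were neighbours of `u`.
replace : {y y′ : Fin m} → Split H G u y y′ → (C : Config H) → Avoids y y′ u (_∈ᶜ C) → u ∈ᶜ C →
          (∀ {q} → q ∈ᶜ C → Adj H u q → Adj G y q) → Lifted G u y y′ (_∈ᶜ C)
replace {m} {H = H} {G = G} {u = u} {y = y} {y′ = y′} S C avoid u∈ full = record
  { config   = D
  ; sound    = λ i → let (p , p∈ , eq) = sound i in locate p p∈ eq
  ; complete = λ {p} p∈ p≢u → subst (_∈ᶜ D) (other p≢u) (complete p∈)
  ; hit      = inj₁ (subst (_∈ᶜ D) self (complete u∈))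
  }
  where
  open Split S
  φ : Fin m → Fin m
  φ = redirect u y
  other : ∀ {p} → p ≢ u → φ p ≡ p
  other {p} p≢u with p Fin.≟ u
  ... | yes eq = contradiction eq p≢u
  ... | no _   = refl
  self : φ u ≡ y
  self with u Fin.≟ u
  ... | yes _  = refl
  ... | no u≢u = contradiction refl u≢u
  to : ∀ {p q} → p ∈ᶜ C → q ∈ᶜ C → Adj H p q → Adj G (φ p) (φ q)
  to {p} {q} p∈ q∈ a with p Fin.≟ u | q Fin.≟ u
  ... | yes refl | yes refl = contradiction a (no-loop H)
  ... | yes refl | no _     = full q∈ a
  ... | no _     | yes refl = adj-sym G (full p∈ (adj-sym H a))
  ... | no p≢u   | no q≢u   = keep (avoid p∈ p≢u) (avoid q∈ q≢u) a
  from : ∀ {p q} → p ∈ᶜ C → q ∈ᶜ C → Adj G (φ p) (φ q) → Adj H p q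
  from {p} {q} p∈ q∈ a with p Fin.≟ u | q Fin.≟ u
  ... | yes refl | yes refl = contradiction a (no-loop G)
  ... | yes refl | no q≢u   = near-y⁻ (avoid q∈ q≢u) a
  ... | no p≢u   | yes refl = adj-sym H (near-y⁻ (avoid p∈ p≢u) (adj-sym G a))
  ... | no p≢u   | no q≢u   = keep⁻ (avoid p∈ p≢u) (avoid q∈ q≢u) a
  mapped : Σ (Config G) λ D → (∀ {q} → q ∈ᶜ D → ∃[ p ] p ∈ᶜ C × q ≡ φ p) × (∀ {p} → p ∈ᶜ C → φ p ∈ᶜ D)
  mapped = map-config C (record { to = to ; from = from
    ; inj = redirect-injective u y {P = _∈ᶜ C} (λ i p≢u → proj₁ (avoid i p≢u)) })
  D : Config G
  D = proj₁ mapped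
  sound : ∀ {q} → q ∈ᶜ D → ∃[ p ] p ∈ᶜ C × q ≡ φ p
  sound = proj₁ (proj₂ mapped)
  complete : ∀ {p} → p ∈ᶜ C → φ p ∈ᶜ D
  complete = proj₂ (proj₂ mapped)
  locate : ∀ {q} p → p ∈ᶜ C → q ≡ φ p → q ≡ y ⊎ q ≡ y′ ⊎ (q ∈ᶜ C × q ≢ u)
  locate p p∈ eq with p Fin.≟ u
  ... | yes _  = inj₁ eq
  ... | no p≢u = inj₂ (inj₂ (subst (_∈ᶜ C) (sym eq) p∈ , λ { refl → p≢u (sym eq) }))

misses-or-full : {y : Fin m} (H G : Graph (Fin m)) (C : Config H) →
                 Misses H G u y (_∈ᶜ C) ⊎ (∀ {q} → q ∈ᶜ C → Adj H u q → Adj G y q)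
misses-or-full {u = u} {y = y} H G C
  with Fin.any? (λ q → (q ∈ᶜ? C) ×-dec (Graph._adj?_ H u q) ×-dec ¬? (Graph._adj?_ G y q))
... | yes M = inj₁ M
... | no ¬M = inj₂ λ {q} i a → case Graph._adj?_ G y q of λ
  { (yes b) → b ; (no ¬b) → contradiction (q , i , a , ¬b) ¬M }

config-split : {y y′ : Fin m} → Split H G u y y′ → (C : Config H) → Avoids y y′ u (_∈ᶜ C) → u ∈ᶜ C →
               Lifted G u y y′ (_∈ᶜ C)
config-split {H = H} {G = G} S C avoid u∈ with misses-or-full H G C | misses-or-full H G C
... | inj₂ full | _         = replace S C avoid u∈ full
... | inj₁ _    | inj₂ full = lifted-swap (replace (split-swap S) C (λ i n → case avoid i n of λ { (a , b) → b , a }) u∈ full)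
... | inj₁ M    | inj₁ M′   = proper-split S C avoid u∈ M M′

-- Identification without a change of the vertex type: the vertices outside of the image of `π`
-- remain as isolated vertices.
quotient : (G : Graph (Fin m)) → (Fin m → Fin m) → Graph (Fin m)
quotient {m} G π = record
  { Adj    = λ p q → p ≢ q × ∃[ s ] ∃[ t ] π s ≡ p × π t ≡ q × Adj G s t
  ; sym    = λ (p≢q , s , t , s≡ , t≡ , a) → p≢q ∘ sym , t , s , t≡ , s≡ , adj-sym G a
  ; irrefl = λ p≡q (p≢q , _) → p≢q p≡q
  ; _adj?_ = λ p q → ¬? (p Fin.≟ q) ×-dec Fin.any? λ s → Fin.any? λ t →
      (π s Fin.≟ p) ×-dec (π t Fin.≟ q) ×-dec Graph._adj?_ G s t
  }

redirect-other : ∀ {u c p : Fin m} → p ≢ u → redirect u c p ≡ p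
redirect-other {u = u} {p = p} p≢u with p Fin.≟ u
... | yes eq = contradiction eq p≢u
... | no _   = refl

redirect-self : ∀ {u c : Fin m} → redirect u c u ≡ c
redirect-self {u = u} with u Fin.≟ u
... | yes _  = refl
... | no u≢u = contradiction refl u≢u

redirect⁻ : ∀ {u c : Fin m} p {q} → redirect u c p ≡ q → (p ≡ u × q ≡ c) ⊎ p ≡ q
redirect⁻ {u = u} p eq with p Fin.≟ u
... | yes p≡u = inj₁ (p≡u , sym eq)
... | no _    = inj₂ eq

-- Contracting the edge xv to x.
contraction-split : Adj G x v → Split (quotient G (redirect v x)) G x x v
contraction-split {G = G} {x = x} {v = v} xv = record
  { pair     = xv
  ; keep     = λ { (p≢x , _) (q≢x , _) (_ , s , t , s≡ , t≡ , a) → keep p≢x q≢x s t s≡ t≡ a }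
  ; keep⁻    = λ { (_ , p≢v) (_ , q≢v) a → adj⇒≢ G a , _ , _ , redirect-other p≢v , redirect-other q≢v , a }
  ; near     = λ { (q≢x , _) (_ , s , t , s≡ , t≡ , a) → near q≢x s t s≡ t≡ a }
  ; near-y⁻  = λ { (q≢x , q≢v) a → q≢x ∘ sym , x , _ , redirect-other (adj⇒≢ G xv) , redirect-other q≢v , a }
  ; near-y′⁻ = λ { (q≢x , q≢v) a → q≢x ∘ sym , v , _ , redirect-self {u = v} , redirect-other q≢v , a }
  }
  where
  keep : ∀ {p q} → p ≢ x → q ≢ x → ∀ s t → redirect v x s ≡ p → redirect v x t ≡ q → Adj G s t → Adj G p q
  keep p≢x q≢x s t s≡ t≡ a with redirect⁻ s s≡ | redirect⁻ t t≡
  ... | inj₁ (_ , eq) | _             = contradiction eq p≢x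
  ... | inj₂ _        | inj₁ (_ , eq) = contradiction eq q≢x
  ... | inj₂ refl     | inj₂ refl     = a
  near : ∀ {q} → q ≢ x → ∀ s t → redirect v x s ≡ x → redirect v x t ≡ q → Adj G s t → Adj G x q ⊎ Adj G v q
  near q≢x s t s≡ t≡ a with redirect⁻ s s≡ | redirect⁻ t t≡
  ... | _               | inj₁ (_ , eq) = contradiction eq q≢x
  ... | inj₁ (refl , _) | inj₂ refl     = inj₂ a
  ... | inj₂ refl       | inj₂ refl     = inj₁ a

-- The counterpart of `Lifted` for a connected set `D` contracted to `d`. Vertices of `D` may come
-- in only if the configuration contained `d`, and then at least one is present.
record Lift (G : Graph (Fin m)) (d : Fin m) (D : List (Fin m)) (P : Fin m → Set) : Set where
  field
    config   : Config G
    sound    : ∀ {p} → p ∈ᶜ config → P p ⊎ (p ∈ D × P d)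
    complete : ∀ {p} → P p → p ≢ d → p ∈ᶜ config
    hit      : P d → ∃[ p ] p ∈ D × p ∈ᶜ config

lift-edge : Adj G x v → (C : Config (quotient G (redirect v x))) → ¬ v ∈ᶜ C → Lift G x (v ∷ x ∷ []) (_∈ᶜ C)
lift-edge {m} {G = G} {x = x} {v = v} xv C v∉ with x ∈ᶜ? C
... | yes x∈ = record
  { config   = config
  ; sound    = λ i → case sound i of λ
      { (inj₁ refl) → inj₁ x∈ ; (inj₂ (inj₁ refl)) → inj₂ (here refl , x∈) ; (inj₂ (inj₂ (a , _))) → inj₁ a }
  ; complete = complete
  ; hit      = λ _ → [ (λ i → x , there (here refl) , i) , (λ i → v , here refl , i) ]′ hit
  }
  where
  lifted : Lifted G x x v (_∈ᶜ C)
  lifted = config-split (contraction-split xv) C (λ i p≢x → p≢x , λ { refl → v∉ i }) x∈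
  open Lifted lifted
... | no x∉ = record
  { config   = proj₁ mapped
  ; sound    = λ i → let (p , p∈ , eq) = proj₁ (proj₂ mapped) i in inj₁ (subst (_∈ᶜ C) (sym eq) p∈)
  ; complete = λ i _ → proj₂ (proj₂ mapped) i
  ; hit      = λ x∈ → contradiction x∈ x∉
  }
  where
  open Split (contraction-split {G = G} xv)
  old : ∀ {p} → p ∈ᶜ C → Old p
  old i = (λ { refl → x∉ i }) , (λ { refl → v∉ i })
  mapped : Σ (Config G) λ D → (∀ {q} → q ∈ᶜ D → ∃[ p ] p ∈ᶜ C × q ≡ p) × (∀ {p} → p ∈ᶜ C → p ∈ᶜ D)
  mapped = map-config C (record
    { to = λ i j → keep (old i) (old j) ; from = λ i j → keep⁻ (old i) (old j) ; inj = λ _ _ → id })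

-- Contracting connected sets

-- A connected set of vertices in an order in which it can be built up from d.
data Grown (G : Graph (Fin m)) (d : Fin m) : List (Fin m) → Set where
  root : Grown G d (d ∷ [])
  grow : Grown G d ps → v ∉ ps → x ∈ ps → Adj G x v → Grown G d (v ∷ ps)

root∈ : Grown G d ps → d ∈ ps
root∈ root           = here refl
root∈ (grow D _ _ _) = there (root∈ D)

-- On the vertices with `P`, `H` is `G` with `D` contracted to `d`; nothing is said about others. So
-- `contract` can keep `H` fixed while it replaces `G` by a quotient.
record Collapsed (G H : Graph (Fin m)) (d : Fin m) (D : List (Fin m)) (P : Fin m → Set) : Set where
  field
    outside : ∀ {p} → P p → p ≢ d → p ∉ D
    keep    : ∀ {p q} → P p → P q → p ≢ d → q ≢ d → Adj H p q → Adj G p q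
    keep⁻   : ∀ {p q} → P p → P q → p ≢ d → q ≢ d → Adj G p q → Adj H p q
    near    : ∀ {q} → P q → q ≢ d → Adj H d q → ∃[ z ] z ∈ D × Adj G z q
    near⁻   : ∀ {q z} → P q → q ≢ d → z ∈ D → Adj G z q → Adj H d q

grown-transfer : Grown G d ps → (∀ {p q} → p ∈ ps → q ∈ ps → Adj G p q → Adj H p q) → Grown H d ps
grown-transfer root             F = root
grown-transfer (grow D v∉ x∈ a) F =
  grow (grown-transfer D (λ i j → F (there i) (there j))) v∉ x∈ (F (there x∈) (here refl) a)

grown-quotient : Grown G d ps → v ∉ ps → Grown (quotient G (redirect v x)) d ps
grown-quotient {G = G} D v∉ = grown-transfer D λ i j a →
  adj⇒≢ G a , _ , _ , redirect-other (λ { refl → v∉ i }) , redirect-other (λ { refl → v∉ j }) , a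

-- Induction on the growth of `D`: the vertex `v` added last is contracted into its neighbour `x`,
-- the rest of `D` is treated in the quotient, and `lift-edge` undoes this one contraction.
contract : {D : List (Fin m)} → Grown G d D → (C : Config H) → Collapsed G H d D (_∈ᶜ C) → Lift G d D (_∈ᶜ C)
contract {m} {G = G} {d = d} {H = H} root C K = record
  { config   = proj₁ mapped
  ; sound    = λ i → let (p , p∈ , eq) = proj₁ (proj₂ mapped) i in inj₁ (subst (_∈ᶜ C) (sym eq) p∈)
  ; complete = λ i _ → proj₂ (proj₂ mapped) i
  ; hit      = λ i → d , here refl , proj₂ (proj₂ mapped) i
  }
  where
  open Collapsed K
  to-d : ∀ {q} → q ∈ᶜ C → Adj H d q → Adj G d q
  to-d q∈ a = case near q∈ (adj⇒≢ H a ∘ sym) a of λ { (_ , here refl , b) → b }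
  from-d : ∀ {q} → q ∈ᶜ C → Adj G d q → Adj H d q
  from-d q∈ a = near⁻ q∈ (adj⇒≢ G a ∘ sym) (here refl) a
  to : ∀ {p q} → p ∈ᶜ C → q ∈ᶜ C → Adj H p q → Adj G p q
  to {p} {q} p∈ q∈ a with p Fin.≟ d | q Fin.≟ d
  ... | yes refl | _        = to-d q∈ a
  ... | no _     | yes refl = adj-sym G (to-d p∈ (adj-sym H a))
  ... | no p≢d   | no q≢d   = keep p∈ q∈ p≢d q≢d a
  from : ∀ {p q} → p ∈ᶜ C → q ∈ᶜ C → Adj G p q → Adj H p q
  from {p} {q} p∈ q∈ a with p Fin.≟ d | q Fin.≟ d
  ... | yes refl | _        = from-d q∈ a
  ... | no _     | yes refl = adj-sym H (from-d p∈ (adj-sym G a))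
  ... | no p≢d   | no q≢d   = keep⁻ p∈ q∈ p≢d q≢d a
  mapped : Σ (Config G) λ D → (∀ {q} → q ∈ᶜ D → ∃[ p ] p ∈ᶜ C × q ≡ p) × (∀ {p} → p ∈ᶜ C → p ∈ᶜ D)
  mapped = map-config C (record { to = to ; from = from ; inj = λ _ _ → id })
contract {m} {G = G} {d = d} {H = H} (grow {ps = D} {v = v} {x = x} grown v∉ x∈ xv) C K = record
  { config   = second.config
  ; sound    = λ i → case second.sound i of λ
      { (inj₁ j) → weaken (first.sound j)
      ; (inj₂ (j , x∈C)) → inj₂ (pair j , Pd x∈C (first.sound x∈C)) }
  ; complete = λ i p≢d → second.complete (first.complete i p≢d) λ { refl → outside i p≢d (there x∈) }
  ; hit      = hit
  }
  where
  open Collapsed K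
  G₁ : Graph (Fin m)
  G₁ = quotient G (redirect v x)
  module S = Split (contraction-split {G = G} xv)
  old : ∀ {q} → q ∈ᶜ C → q ≢ d → S.Old q
  old i q≢d = (λ { refl → outside i q≢d (there x∈) }) , (λ { refl → outside i q≢d (here refl) })
  K₁ : Collapsed G₁ H d D (_∈ᶜ C)
  K₁ = record
    { outside = λ i p≢d j → outside i p≢d (there j)
    ; keep    = λ i j p≢d q≢d a → S.keep⁻ (old i p≢d) (old j q≢d) (keep i j p≢d q≢d a)
    ; keep⁻   = λ i j p≢d q≢d a → keep⁻ i j p≢d q≢d (S.keep (old i p≢d) (old j q≢d) a)
    ; near    = λ i q≢d a → case near i q≢d a of λ
        { (_ , here refl , b) → x , x∈ , S.near-y′⁻ (old i q≢d) b
        ; (z , there z∈ , b) → z , z∈ , within z∈ (old i q≢d) b }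
    ; near⁻   = λ i q≢d z∈ a → within⁻ i q≢d z∈ a
    }
    where
    within : ∀ {z q} → z ∈ D → S.Old q → Adj G z q → Adj G₁ z q
    within {z} z∈ o a with z Fin.≟ x
    ... | yes refl = S.near-y⁻ o a
    ... | no z≢x   = S.keep⁻ (z≢x , λ { refl → v∉ z∈ }) o a
    within⁻ : ∀ {z q} → q ∈ᶜ C → q ≢ d → z ∈ D → Adj G₁ z q → Adj H d q
    within⁻ {z} i q≢d z∈ a with z Fin.≟ x
    ... | no z≢x   = near⁻ i q≢d (there z∈) (S.keep (z≢x , λ { refl → v∉ z∈ }) (old i q≢d) a)
    ... | yes refl = [ near⁻ i q≢d (there z∈) , near⁻ i q≢d (here refl) ]′ (S.near (old i q≢d) a)
  module first = Lift (contract (grown-quotient {x = x} grown v∉) C K₁)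
  -- `lift-edge` applies only to configurations without `v`. The vertices here lie in `D` or in `C`,
  -- and apart from `d` the latter avoids `v ∷ D`.
  v∉C : ¬ v ∈ᶜ first.config
  v∉C i with first.sound i
  ... | inj₂ (j , _) = v∉ j
  ... | inj₁ j with v Fin.≟ d
  ...   | yes refl = v∉ (root∈ grown)
  ...   | no v≢d   = outside j v≢d (here refl)
  module second = Lift (lift-edge xv first.config v∉C)
  weaken : ∀ {p} → p ∈ᶜ C ⊎ (p ∈ D × d ∈ᶜ C) → p ∈ᶜ C ⊎ (p ∈ v ∷ D × d ∈ᶜ C)
  weaken (inj₁ i)       = inj₁ i
  weaken (inj₂ (i , j)) = inj₂ (there i , j)
  pair : ∀ {p} → p ∈ v ∷ x ∷ [] → p ∈ v ∷ D
  pair (here eq)           = here eq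
  pair (there (here refl)) = there x∈
  Pd : x ∈ᶜ first.config → x ∈ᶜ C ⊎ (x ∈ D × d ∈ᶜ C) → d ∈ᶜ C
  Pd _ (inj₂ (_ , j)) = j
  Pd _ (inj₁ i) with x Fin.≟ d
  ... | yes refl = i
  ... | no x≢d   = contradiction (there x∈) (outside i x≢d)
  hit : d ∈ᶜ C → ∃[ p ] p ∈ v ∷ D × p ∈ᶜ second.config
  hit i with first.hit i
  -- Undoing the edge may trade `x` for `v`, so a hit at `x` has to be renewed.
  ... | p , p∈ , p∈C with p Fin.≟ x
  ...   | yes refl = let (q , q∈ , q∈C) = second.hit p∈C in q , pair q∈ , q∈C
  ...   | no p≢x   = p , there p∈ , second.complete p∈C p≢x

collapse-map : List (Fin m) → Fin m → Fin m → Fin m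
collapse-map D d p with p ∈? D
... | yes _ = d
... | no _  = p

collapse : Graph (Fin m) → List (Fin m) → Fin m → Graph (Fin m)
collapse G D d = quotient G (collapse-map D d)

collapse-outside : ∀ {D} {d p : Fin m} → p ∉ D → collapse-map D d p ≡ p
collapse-outside {D = D} {p = p} p∉ with p ∈? D
... | yes p∈ = contradiction p∈ p∉
... | no _   = refl

collapse-inside : ∀ {D} {d p : Fin m} → p ∈ D → collapse-map D d p ≡ d
collapse-inside {D = D} {p = p} p∈ with p ∈? D
... | yes _ = refl
... | no p∉ = contradiction p∈ p∉

collapse⁻ : ∀ {D} {d : Fin m} p {q} → collapse-map D d p ≡ q → (p ∈ D × q ≡ d) ⊎ (p ∉ D × p ≡ q)
collapse⁻ {D = D} p eq with p ∈? D
... | yes p∈ = inj₁ (p∈ , sym eq)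
... | no p∉  = inj₂ (p∉ , eq)

collapsed : (G : Graph (Fin m)) {D : List (Fin m)} → d ∈ D → Collapsed G (collapse G D d) d D (λ p → p ≡ d ⊎ p ∉ D)
collapsed {m} {d = d} G {D} d∈ = record
  { outside = out
  ; keep    = λ i j p≢d q≢d (_ , s , t , s≡ , t≡ , a) → keep p≢d q≢d s t s≡ t≡ a
  ; keep⁻   = λ i j p≢d q≢d a → adj⇒≢ G a , _ , _ , collapse-outside (out i p≢d) , collapse-outside (out j q≢d) , a
  ; near    = λ i q≢d (_ , s , t , s≡ , t≡ , a) → near q≢d s t s≡ t≡ a
  ; near⁻   = λ i q≢d z∈ a → q≢d ∘ sym , _ , _ , collapse-inside z∈ , collapse-outside (out i q≢d) , a
  }
  where
  out : ∀ {p} → p ≡ d ⊎ p ∉ D → p ≢ d → p ∉ D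
  out (inj₁ p≡d) p≢d = contradiction p≡d p≢d
  out (inj₂ p∉)  _   = p∉
  keep : ∀ {p q} → p ≢ d → q ≢ d → ∀ s t → collapse-map D d s ≡ p → collapse-map D d t ≡ q → Adj G s t → Adj G p q
  keep p≢d q≢d s t s≡ t≡ a with collapse⁻ s s≡ | collapse⁻ t t≡
  ... | inj₁ (_ , eq)   | _               = contradiction eq p≢d
  ... | inj₂ _          | inj₁ (_ , eq)   = contradiction eq q≢d
  ... | inj₂ (_ , refl) | inj₂ (_ , refl) = a
  near : ∀ {q} → q ≢ d → ∀ s t → collapse-map D d s ≡ d → collapse-map D d t ≡ q → Adj G s t → ∃[ z ] z ∈ D × Adj G z q
  near q≢d s t s≡ t≡ a with collapse⁻ s s≡ | collapse⁻ t t≡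
  ... | _              | inj₁ (_ , eq)   = contradiction eq q≢d
  ... | inj₁ (s∈ , _)  | inj₂ (_ , refl) = s , s∈ , a
  ... | inj₂ (s∉ , refl) | inj₂ _          = contradiction d∈ s∉

collapsed-⊆ : {D : List (Fin m)} {P Q : Fin m → Set} → (∀ {p} → P p → Q p) → Collapsed G H d D Q → Collapsed G H d D P
collapsed-⊆ F K = record
  { outside = outside ∘ F ; keep = λ i j → keep (F i) (F j) ; keep⁻ = λ i j → keep⁻ (F i) (F j)
  ; near = near ∘ F ; near⁻ = near⁻ ∘ F }
  where open Collapsed K

-- The configurations from which the lifts start: K⁴, a square with a hub, and K₂,₃

clique-config : Adj G w x → Adj G w y → Adj G w z → Adj G x y → Adj G x z → Adj G y z →
                ConfigOn G (λ p → p ∈ w ∷ x ∷ y ∷ z ∷ [])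
clique-config {G = G} wx wy wz xy xz yz = wheel (record
  { rim  = record
    { ring-path  = edge-path yz
    ; first≢last = adj⇒≢ G yz
    ; apex∉      = λ { (here eq) → adj⇒≢ G xy eq ; (there (here eq)) → adj⇒≢ G xz eq }
    ; apex-first = xy
    ; apex-last  = xz
    ; apex-only  = λ { (here eq) _ → inj₁ eq ; (there (here eq)) _ → inj₂ eq }
    }
  ; hub  = _
  ; hub∉ = λ { (here eq) → adj⇒≢ G wx eq ; (there (here eq)) → adj⇒≢ G wy eq ; (there (there (here eq))) → adj⇒≢ G wz eq }
  ; feet = record
    { Pa = here refl , wx ; Pb = there (here refl) , wy ; Pc = there (there (here refl)) , wz
    ; a≢b = adj⇒≢ G xy ; a≢c = adj⇒≢ G xz ; b≢c = adj⇒≢ G yz }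
  }) , id , id

square-config : Adj G v p → Adj G p d → Adj G d q → Adj G q v → v ≢ d → ¬ Adj G v d → p ≢ q → ¬ Adj G p q →
                h ∉ v ∷ p ∷ d ∷ q ∷ [] → Three (λ r → r ∈ v ∷ p ∷ d ∷ q ∷ [] × Adj G h r) →
                ConfigOn G (λ r → r ∈ h ∷ v ∷ p ∷ d ∷ q ∷ [])
square-config {G = G} vp pd dq qv v≢d ¬vd p≢q ¬pq h∉ feet = wheel (record
  { rim  = record
    { ring-path  = step pd
        (λ { (here eq) → adj⇒≢ G pd eq ; (there (here eq)) → p≢q eq })
        (λ { (here eq) _ → eq ; (there (here refl)) a → contradiction a ¬pq })
        (edge-path dq)
    ; first≢last = p≢q
    ; apex∉      = λ { (here eq) → adj⇒≢ G vp eq ; (there (here eq)) → v≢d eq ; (there (there (here eq))) → adj⇒≢ G qv (sym eq) }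
    ; apex-first = vp
    ; apex-last  = adj-sym G qv
    ; apex-only  = λ { (here eq) _ → inj₁ eq ; (there (here refl)) a → contradiction a ¬vd ; (there (there (here eq))) _ → inj₂ eq }
    }
  ; hub  = _
  ; hub∉ = h∉
  ; feet = feet
  }) , id , id

theta-config : v ≢ d → ¬ Adj G v d → (φ : Fin 3 → Fin m) → (∀ i → Adj G v (φ i)) → (∀ i → Adj G (φ i) d) →
               (∀ {i j} → i ≢ j → φ i ≢ φ j × ¬ Adj G (φ i) (φ j)) →
               ConfigOn G (λ p → p ≡ v ⊎ p ≡ d ⊎ ∃[ i ] p ≡ φ i)
theta-config {m} {v = v} {d = d} {G = G} v≢d ¬vd φ vφ φd indep = three-paths T , sound , complete
  where
  arcs : Fin 3 → Arc G
  arcs i = record { path = step (vφ i)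
    (λ { (here eq) → adj⇒≢ G (vφ i) eq ; (there (here eq)) → v≢d eq })
    (λ { (here eq) _ → eq ; (there (here refl)) a → contradiction a ¬vd }) (edge-path (φd i)) }
  apart : ∀ {i j p} → i ≢ j → p ∈ᵃ arcs i → p ∈ᵃ arcs j → (p ≡ v × p ≡ v) ⊎ (p ≡ d × p ≡ d)
  apart i≢j (here eq)                 _                         = inj₁ (eq , eq)
  apart i≢j (there (there (here eq))) _                         = inj₂ (eq , eq)
  apart i≢j (there (here eq))         (here eq′)                = inj₁ (eq′ , eq′)
  apart i≢j (there (here eq))         (there (there (here eq′))) = inj₂ (eq′ , eq′)
  apart i≢j (there (here refl))       (there (here eq))         = contradiction eq (proj₁ (indep i≢j))
  edge : ∀ {i j p q} → i ≢ j → p ∈ᵃ arcs i → q ∈ᵃ arcs j → Adj G p q → Contact (arcs i) (arcs j) p q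
  edge i≢j (here eq)                 _                         _ = on-right (here eq)
  edge i≢j (there (there (here eq))) _                         _ = on-right (there (there (here eq)))
  edge i≢j (there (here _))          (here eq)                 _ = on-left (here eq)
  edge i≢j (there (here _))          (there (there (here eq))) _ = on-left (there (there (here eq)))
  edge i≢j (there (here refl))       (there (here refl))       a = contradiction a (proj₂ (indep i≢j))
  T : ThreePaths G
  T = record
    { arcs  = arcs
    ; meet  = λ i≢j → record { apart = apart i≢j ; edge = edge i≢j }
    ; start = point λ _ _ → refl
    ; end   = point λ _ _ → refl
    ; long  = λ _ → v≢d
    ; thin  = λ _ _ _ → ¬vd
    }
  sound : ∀ {p} → p ∈ᵗ T → p ≡ v ⊎ p ≡ d ⊎ ∃[ i ] p ≡ φ i
  sound (i , here eq)                 = inj₁ eq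
  sound (i , there (here eq))         = inj₂ (inj₂ (i , eq))
  sound (i , there (there (here eq))) = inj₂ (inj₁ eq)
  complete : ∀ {p} → p ≡ v ⊎ p ≡ d ⊎ (∃[ i ] p ≡ φ i) → p ∈ᵗ T
  complete (inj₁ eq)              = zero , here eq
  complete (inj₂ (inj₁ eq))       = zero , there (there (here eq))
  complete (inj₂ (inj₂ (i , eq))) = i , there (here eq)

-- Configurations through a vertex and three of its neighbours

-- By `only`, the three neighbours of `v` can be recovered from the configuration, which is what the
-- counting needs; `inside` serves the recursion on `U`.
record Through (G : Graph (Fin m)) (U : List (Fin m)) (v x y z : Fin m) : Set where
  field
    config : Config G
    inside : ∀ {p} → p ∈ᶜ config → p ∈ U
    only   : ∀ {p} → p ∈ᶜ config → Adj G v p → p ≡ x ⊎ p ≡ y ⊎ p ≡ z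
    v∈     : v ∈ᶜ config
    x∈     : x ∈ᶜ config
    y∈     : y ∈ᶜ config
    z∈     : z ∈ᶜ config

through-swap : {U : List (Fin m)} → Through G U v x y z → Through G U v y x z
through-swap T = record
  { config = config ; inside = inside
  ; only = λ i a → case only i a of λ { (inj₁ e) → inj₂ (inj₁ e) ; (inj₂ (inj₁ e)) → inj₁ e ; (inj₂ (inj₂ e)) → inj₂ (inj₂ e) }
  ; v∈ = v∈ ; x∈ = y∈ ; y∈ = x∈ ; z∈ = z∈ }
  where open Through T

through-rotate : {U : List (Fin m)} → Through G U v x y z → Through G U v y z x
through-rotate T = record
  { config = config ; inside = inside
  ; only = λ i a → case only i a of λ { (inj₁ e) → inj₂ (inj₂ e) ; (inj₂ (inj₁ e)) → inj₁ e ; (inj₂ (inj₂ e)) → inj₂ (inj₁ e) }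
  ; v∈ = v∈ ; x∈ = y∈ ; y∈ = z∈ ; z∈ = x∈ }
  where open Through T

through-⊆ : {U U′ : List (Fin m)} → U ⊆ U′ → Through G U v x y z → Through G U′ v x y z
through-⊆ F T = record
  { config = config ; inside = F ∘ inside ; only = only ; v∈ = v∈ ; x∈ = x∈ ; y∈ = y∈ ; z∈ = z∈ }
  where open Through T

-- Contracted to `hook`, the connected set `body` becomes a vertex that is not adjacent to `v` but
-- to every attached neighbour of `v`.
record Link (G : Graph (Fin m)) (U : List (Fin m)) (v : Fin m) : Set where
  field
    {hook}  : Fin m
    {body} : List (Fin m)
    grown   : Grown G hook body
    inside  : body ⊆ U
    far     : ∀ {p} → p ∈ body → p ≢ v × ¬ Adj G v p

  Attached : Fin m → Set
  Attached x = ∃[ a ] a ∈ body × Adj G a x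

link-⊆ : {U U′ : List (Fin m)} → U ⊆ U′ → Link G U v → Link G U′ v
link-⊆ F L = record { grown = grown ; inside = F ∘ inside ; far = far }
  where open Link L

clique-through : {U : List (Fin m)} → v ∈ U → x ∈ U → y ∈ U → z ∈ U → Adj G v x → Adj G v y → Adj G v z →
                 Adj G x y → Adj G x z → Adj G y z → Through G U v x y z
clique-through {G = G} v∈ x∈ y∈ z∈ vx vy vz xy xz yz with clique-config {G = G} vx vy vz xy xz yz
... | C , to , from = record
  { config = C
  ; inside = λ i → case to i of λ
      { (here refl) → v∈ ; (there (here refl)) → x∈ ; (there (there (here refl))) → y∈
      ; (there (there (there (here refl)))) → z∈ }
  ; only   = λ i a → case to i of λ
      { (here refl) → contradiction a (no-loop G) ; (there (here e)) → inj₁ e ; (there (there (here e))) → inj₂ (inj₁ e)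
      ; (there (there (there (here e)))) → inj₂ (inj₂ e) }
  ; v∈ = from (here refl) ; x∈ = from (there (here refl)) ; y∈ = from (there (there (here refl)))
  ; z∈ = from (there (there (there (here refl))))
  }

module AtLink {m : ℕ} {G : Graph (Fin m)} {U : List (Fin m)} {v : Fin m} (v∈U : v ∈ U) (L : Link G U v) where
  open Link L

  G′ : Graph (Fin m)
  G′ = collapse G body hook

  hook∈ : hook ∈ body
  hook∈ = root∈ grown

  open Collapsed (collapsed G hook∈)

  v∉ : v ∉ body
  v∉ i = proj₁ (far i) refl

  nbr∉ : Adj G v p → p ∉ body
  nbr∉ a i = proj₂ (far i) a

  ≢hook : p ∉ body → p ≢ hook
  ≢hook p∉ refl = p∉ hook∈

  down : p ∉ body → q ∉ body → Adj G p q → Adj G′ p q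
  down p∉ q∉ = keep⁻ (inj₂ p∉) (inj₂ q∉) (≢hook p∉) (≢hook q∉)

  up : p ∉ body → q ∉ body → Adj G′ p q → Adj G p q
  up p∉ q∉ = keep (inj₂ p∉) (inj₂ q∉) (≢hook p∉) (≢hook q∉)

  hook-adj : x ∉ body → Attached x → Adj G′ hook x
  hook-adj x∉ (a , a∈ , ax) = near⁻ (inj₂ x∉) (≢hook x∉) a∈ ax

  ¬v-hook : ¬ Adj G′ v hook
  ¬v-hook a with near (inj₂ v∉) (≢hook v∉) (adj-sym G′ a)
  ... | z , z∈ , b = proj₂ (far z∈) (adj-sym G b)

  -- The vertices added by the lift lie in `body`, where `v` has no neighbour, so `only` is not
  -- affected. Being different from `hook`, the vertices `v`, `x`, `y`, `z` all survive.
  through : {P : Fin m → Set} → ConfigOn G′ P → (∀ {p} → P p → p ≡ v ⊎ p ≡ x ⊎ p ≡ y ⊎ p ≡ z ⊎ p ≡ hook) →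
            P v → P x → P y → P z → x ∈ U → y ∈ U → z ∈ U → Adj G v x → Adj G v y → Adj G v z → Through G U v x y z
  through {x = x} {y = y} {z = z} (C , to , from) F Pv Px Py Pz x∈ y∈ z∈ vx vy vz = record
    { config = config
    ; inside = λ i → within (sound i)
    ; only   = λ i a → neighbour a (sound i)
    ; v∈     = complete (from Pv) (≢hook v∉)
    ; x∈     = complete (from Px) (≢hook (nbr∉ vx))
    ; y∈     = complete (from Py) (≢hook (nbr∉ vy))
    ; z∈     = complete (from Pz) (≢hook (nbr∉ vz))
    }
    where
    lifted : Lift G hook body (_∈ᶜ C)
    lifted = contract grown C (collapsed-⊆
      (λ i → case F (to i) of λ
        { (inj₁ refl) → inj₂ v∉
        ; (inj₂ (inj₁ refl)) → inj₂ (nbr∉ vx)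
        ; (inj₂ (inj₂ (inj₁ refl))) → inj₂ (nbr∉ vy)
        ; (inj₂ (inj₂ (inj₂ (inj₁ refl)))) → inj₂ (nbr∉ vz)
        ; (inj₂ (inj₂ (inj₂ (inj₂ eq)))) → inj₁ eq })
      (collapsed G hook∈))
    open Lift lifted
    within : ∀ {p} → p ∈ᶜ C ⊎ (p ∈ body × hook ∈ᶜ C) → p ∈ U
    within (inj₂ (i , _)) = inside i
    within (inj₁ i) with F (to i)
    ... | inj₁ refl                      = v∈U
    ... | inj₂ (inj₁ refl)               = x∈
    ... | inj₂ (inj₂ (inj₁ refl))        = y∈
    ... | inj₂ (inj₂ (inj₂ (inj₁ refl))) = z∈
    ... | inj₂ (inj₂ (inj₂ (inj₂ refl))) = inside hook∈
    neighbour : ∀ {p} → Adj G v p → p ∈ᶜ C ⊎ (p ∈ body × hook ∈ᶜ C) → p ≡ x ⊎ p ≡ y ⊎ p ≡ z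
    neighbour a (inj₂ (i , _)) = contradiction i (nbr∉ a)
    neighbour a (inj₁ i) with F (to i)
    ... | inj₁ refl                      = contradiction a (no-loop G)
    ... | inj₂ (inj₁ e)                  = inj₁ e
    ... | inj₂ (inj₂ (inj₁ e))           = inj₂ (inj₁ e)
    ... | inj₂ (inj₂ (inj₂ (inj₁ e)))    = inj₂ (inj₂ e)
    ... | inj₂ (inj₂ (inj₂ (inj₂ refl))) = contradiction hook∈ (nbr∉ a)

  -- The hub z and the cycle v x hook y.
  wheel-through : x ∈ U → y ∈ U → z ∈ U → Adj G v x → Adj G v y → Adj G v z → x ≢ y → ¬ Adj G x y →
                  Adj G z x → Adj G z y → Attached x → Attached y → Through G U v x y z
  wheel-through {x = x} {y = y} {z = z} x∈ y∈ z∈ vx vy vz x≢y ¬xy zx zy ax ay = through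
    (square-config {G = G′} (down v∉ x∉ vx) (adj-sym G′ (hook-adj x∉ ax)) (hook-adj y∉ ay) (down y∉ v∉ (adj-sym G vy))
      (≢hook v∉) ¬v-hook x≢y (¬xy ∘ up x∉ y∉)
      (λ { (here eq) → adj⇒≢ G vz (sym eq) ; (there (here eq)) → adj⇒≢ G zx eq
         ; (there (there (here eq))) → ≢hook z∉ eq ; (there (there (there (here eq)))) → adj⇒≢ G zy eq })
      (record { Pa  = here refl , down z∉ v∉ (adj-sym G vz)
              ; Pb  = there (here refl) , down z∉ x∉ zx
              ; Pc  = there (there (there (here refl))) , down z∉ y∉ zy
              ; a≢b = adj⇒≢ G vx ; a≢c = adj⇒≢ G vy ; b≢c = x≢y }))
    (λ { (here e) → inj₂ (inj₂ (inj₂ (inj₁ e))) ; (there (here e)) → inj₁ e ; (there (there (here e))) → inj₂ (inj₁ e)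
       ; (there (there (there (here e)))) → inj₂ (inj₂ (inj₂ (inj₂ e)))
       ; (there (there (there (there (here e))))) → inj₂ (inj₂ (inj₁ e)) })
    (there (here refl)) (there (there (here refl))) (there (there (there (there (here refl))))) (here refl)
    x∈ y∈ z∈ vx vy vz
    where
    x∉ : x ∉ body
    x∉ = nbr∉ vx
    y∉ : y ∉ body
    y∉ = nbr∉ vy
    z∉ : z ∉ body
    z∉ = nbr∉ vz

  -- The hub x and the cycle v z hook y.
  edge-through : x ∈ U → y ∈ U → z ∈ U → Adj G v x → Adj G v y → Adj G v z → Adj G x z → y ≢ z → ¬ Adj G y z →
                 x ≢ y → Attached x → Attached y → Attached z → Through G U v x y z
  edge-through {x = x} {y = y} {z = z} x∈ y∈ z∈ vx vy vz xz y≢z ¬yz x≢y ax ay az = through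
    (square-config {G = G′} (down v∉ z∉ vz) (adj-sym G′ (hook-adj z∉ az)) (hook-adj y∉ ay) (down y∉ v∉ (adj-sym G vy))
      (≢hook v∉) ¬v-hook (y≢z ∘ sym) (¬yz ∘ adj-sym G ∘ up z∉ y∉)
      (λ { (here eq) → adj⇒≢ G vx (sym eq) ; (there (here eq)) → adj⇒≢ G xz eq
         ; (there (there (here eq))) → ≢hook x∉ eq ; (there (there (there (here eq)))) → x≢y eq })
      (record { Pa  = here refl , down x∉ v∉ (adj-sym G vx)
              ; Pb  = there (here refl) , down x∉ z∉ xz
              ; Pc  = there (there (here refl)) , adj-sym G′ (hook-adj x∉ ax)
              ; a≢b = adj⇒≢ G vz ; a≢c = ≢hook v∉ ; b≢c = ≢hook z∉ }))
    (λ { (here e) → inj₂ (inj₁ e) ; (there (here e)) → inj₁ e ; (there (there (here e))) → inj₂ (inj₂ (inj₂ (inj₁ e)))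
       ; (there (there (there (here e)))) → inj₂ (inj₂ (inj₂ (inj₂ e)))
       ; (there (there (there (there (here e))))) → inj₂ (inj₂ (inj₁ e)) })
    (there (here refl)) (here refl) (there (there (there (there (here refl))))) (there (there (here refl)))
    x∈ y∈ z∈ vx vy vz
    where
    x∉ : x ∉ body
    x∉ = nbr∉ vx
    y∉ : y ∉ body
    y∉ = nbr∉ vy
    z∉ : z ∉ body
    z∉ = nbr∉ vz

  theta-through : x ∈ U → y ∈ U → z ∈ U → Adj G v x → Adj G v y → Adj G v z → x ≢ y → x ≢ z → y ≢ z →
                  ¬ Adj G x y → ¬ Adj G x z → ¬ Adj G y z → Attached x → Attached y → Attached z → Through G U v x y z
  theta-through {x = x} {y = y} {z = z} x∈ y∈ z∈ vx vy vz x≢y x≢z y≢z ¬xy ¬xz ¬yz ax ay az = through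
    (theta-config {G = G′} (≢hook v∉) ¬v-hook φ
      (all-three (down v∉ x∉ vx) (down v∉ y∉ vy) (down v∉ z∉ vz))
      (all-three (adj-sym G′ (hook-adj x∉ ax)) (adj-sym G′ (hook-adj y∉ ay)) (adj-sym G′ (hook-adj z∉ az)))
      (pairwise {R = λ i j → φ i ≢ φ j × ¬ Adj G′ (φ i) (φ j)} (λ (a , b) → a ∘ sym , b ∘ adj-sym G′)
        (x≢y , ¬xy ∘ up x∉ y∉) (x≢z , ¬xz ∘ up x∉ z∉) (y≢z , ¬yz ∘ up y∉ z∉)))
    (λ { (inj₁ e) → inj₁ e ; (inj₂ (inj₁ e)) → inj₂ (inj₂ (inj₂ (inj₂ e)))
       ; (inj₂ (inj₂ (zero , e))) → inj₂ (inj₁ e) ; (inj₂ (inj₂ (suc zero , e))) → inj₂ (inj₂ (inj₁ e))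
       ; (inj₂ (inj₂ (suc (suc zero) , e))) → inj₂ (inj₂ (inj₂ (inj₁ e))) })
    (inj₁ refl) (inj₂ (inj₂ (zero , refl))) (inj₂ (inj₂ (i₁ , refl))) (inj₂ (inj₂ (i₂ , refl)))
    x∈ y∈ z∈ vx vy vz
    where
    φ : Fin 3 → Fin m
    φ = three x y z
    x∉ : x ∉ body
    x∉ = nbr∉ vx
    y∉ : y ∉ body
    y∉ = nbr∉ vy
    z∉ : z ∉ body
    z∉ = nbr∉ vz

  -- Distinguishes by the number of edges among `x`, `y`, `z`. Three give K⁴ with `v`. With two,
  -- their common vertex is a hub; with one, an end of the edge is a hub. Without edges there are
  -- three paths.
  triple-through : x ∈ U → y ∈ U → z ∈ U → Adj G v x → Adj G v y → Adj G v z → x ≢ y → x ≢ z → y ≢ z →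
                   Attached x → Attached y → Attached z → Through G U v x y z
  triple-through {x = x} {y = y} {z = z} x∈ y∈ z∈ vx vy vz x≢y x≢z y≢z ax ay az
    with Graph._adj?_ G x y | Graph._adj?_ G x z | Graph._adj?_ G y z
  ... | yes xy | yes xz | yes yz = clique-through v∈U x∈ y∈ z∈ vx vy vz xy xz yz
  ... | yes xy | yes xz | no ¬yz = through-rotate (through-rotate
        (wheel-through y∈ z∈ x∈ vy vz vx y≢z ¬yz xy xz ay az))
  ... | yes xy | no ¬xz | yes yz = through-rotate
        (wheel-through z∈ x∈ y∈ vz vx vy (x≢z ∘ sym) (¬xz ∘ adj-sym G) yz (adj-sym G xy) az ax)
  ... | no ¬xy | yes xz | yes yz = wheel-through x∈ y∈ z∈ vx vy vz x≢y ¬xy (adj-sym G xz) (adj-sym G yz) ax ay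
  ... | no ¬xy | yes xz | no ¬yz = edge-through x∈ y∈ z∈ vx vy vz xz y≢z ¬yz x≢y ax ay az
  ... | yes xy | no ¬xz | no ¬yz = through-rotate (through-swap
        (edge-through x∈ z∈ y∈ vx vz vy xy (y≢z ∘ sym) (¬yz ∘ adj-sym G) x≢z ax az ay))
  ... | no ¬xy | no ¬xz | yes yz = through-swap
        (edge-through y∈ x∈ z∈ vy vx vz yz x≢z ¬xz (x≢y ∘ sym) ay ax az)
  ... | no ¬xy | no ¬xz | no ¬yz = theta-through x∈ y∈ z∈ vx vy vz x≢y x≢z y≢z ¬xy ¬xz ¬yz ax ay az

-- A vertex every three neighbours of which lie in a configuration

record Rich (G : Graph (Fin m)) (U : List (Fin m)) (v : Fin m) : Set where
  field
    -- The recursion needs pairs besides triples: a triple that is not confined to one side of the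
    -- partition in `extend-rich` reduces to its two vertices on the same side.
    pair   : ∀ {x y} → x ∈ U → y ∈ U → Adj G v x → Adj G v y → x ≢ y →
             Adj G x y ⊎ Σ (Link G U v) λ L → Link.Attached L x × Link.Attached L y
    triple : ∀ {x y z} → x ∈ U → y ∈ U → z ∈ U → Adj G v x → Adj G v y → Adj G v z →
             x ≢ y → x ≢ z → y ≢ z → Through G U v x y z

filter-shrinks : {P Q : Fin m → Set} (P? : ∀ p → Dec (P p)) (Q? : ∀ p → Dec (Q p)) →
                 (∀ {p} → P p → Q p) → ∀ ps → z ∈ ps → Q z → ¬ P z →
                 length (filter P? ps) < length (filter Q? ps)
filter-shrinks {m} {P = P} {Q = Q} P? Q? F = shrinks
  where
  weakly : ∀ ps → length (filter P? ps) ≤ length (filter Q? ps)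
  weakly [] = z≤n
  weakly (p ∷ ps) with P? p | Q? p
  ... | yes _ | yes _ = s≤s (weakly ps)
  ... | yes a | no ¬b = contradiction (F a) ¬b
  ... | no _  | yes _ = ℕ.m≤n⇒m≤1+n (weakly ps)
  ... | no _  | no _  = weakly ps
  shrinks : ∀ {z} ps → z ∈ ps → Q z → ¬ P z → length (filter P? ps) < length (filter Q? ps)
  shrinks (p ∷ ps) (here refl) b ¬a with P? p | Q? p
  ... | yes a | _     = contradiction a ¬a
  ... | no _  | no ¬b = contradiction b ¬b
  ... | no _  | yes _ = s≤s (weakly ps)
  shrinks (p ∷ ps) (there i) b ¬a with P? p | Q? p
  ... | yes _ | yes _ = s≤s (shrinks ps i b ¬a)
  ... | yes a | no ¬b = contradiction (F a) ¬b
  ... | no _  | yes _ = ℕ.m<n⇒m<1+n (shrinks ps i b ¬a)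
  ... | no _  | no _  = shrinks ps i b ¬a

module Richness {m : ℕ} (G : Graph (Fin m)) where
  _~?_ : (p q : Fin m) → Dec (Adj G p q)
  _~?_ = Graph._adj?_ G

  Touches : List (Fin m) → Fin m → Set
  Touches D p = ∃[ a ] a ∈ D × Adj G a p

  touches? : ∀ D p → Dec (Touches D p)
  touches? D p = Fin.any? λ a → (a ∈? D) ×-dec (a ~? p)

  Away : List (Fin m) → Fin m → Set
  Away D p = p ∉ D × ¬ Touches D p

  away? : ∀ D p → Dec (Away D p)
  away? D p = ¬? (p ∈? D) ×-dec ¬? (touches? D p)

  away : List (Fin m) → List (Fin m) → List (Fin m)
  away D U = filter (away? D) U

  away⊆ : ∀ {U} D → away D U ⊆ U
  away⊆ {U} D i = proj₁ (∈-filter⁻ (away? D) {xs = U} i)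

  clique-rich : ∀ {U v} → v ∈ U → (∀ {p q} → p ∈ U → q ∈ U → p ≢ q → Adj G p q) → Rich G U v
  clique-rich v∈ complete = record
    { pair   = λ x∈ y∈ _ _ x≢y → inj₁ (complete x∈ y∈ x≢y)
    ; triple = λ x∈ y∈ z∈ vx vy vz x≢y x≢z y≢z → clique-through v∈ x∈ y∈ z∈ vx vy vz
        (complete x∈ y∈ x≢y) (complete x∈ z∈ x≢z) (complete y∈ z∈ y≢z)
    }

  -- All vertices away from D are adjacent to all neighbours of D, so a rich vertex
  -- among the former is rich in U.
  extend-rich : ∀ {U D d v} → Grown G d D → D ⊆ U → v ∈ away D U → Rich G (away D U) v →
                (∀ {z f} → z ∈ U → z ∉ D → Touches D z → f ∈ away D U → Adj G z f) → Rich G U v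
  extend-rich {U} {D} {d} {v} grown D⊆U v∈ rich complete = record { pair = pair ; triple = triple }
    where
    v-away : Away D v
    v-away = proj₂ (∈-filter⁻ (away? D) {xs = U} v∈)
    v∈U : v ∈ U
    v∈U = away⊆ D v∈
    -- `D` is connected and `v` is away from it, so `D` itself links all neighbours of `v` that
    -- touch it.
    L : Link G U v
    L = record { grown = grown ; inside = D⊆U
               ; far = λ i → (λ { refl → proj₁ v-away i }) , λ a → proj₂ v-away (_ , i , adj-sym G a) }
    nbr∉ : ∀ {p} → Adj G v p → p ∉ D
    nbr∉ a i = proj₂ v-away (_ , i , adj-sym G a)
    kind : ∀ {p} → p ∈ U → Adj G v p → Touches D p ⊎ p ∈ away D U
    kind {p} p∈ a with touches? D p
    ... | yes t = inj₁ t
    ... | no ¬t = inj₂ (∈-filter⁺ (away? D) p∈ (nbr∉ a , ¬t))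
    pair : ∀ {x y} → x ∈ U → y ∈ U → Adj G v x → Adj G v y → x ≢ y →
           Adj G x y ⊎ Σ (Link G U v) λ L → Link.Attached L x × Link.Attached L y
    pair x∈ y∈ vx vy x≢y with kind x∈ vx | kind y∈ vy
    ... | inj₁ x-t | inj₁ y-t = inj₂ (L , x-t , y-t)
    ... | inj₁ x-t | inj₂ y-a = inj₁ (complete x∈ (nbr∉ vx) x-t y-a)
    ... | inj₂ x-a | inj₁ y-t = inj₁ (adj-sym G (complete y∈ (nbr∉ vy) y-t x-a))
    ... | inj₂ x-a | inj₂ y-a with Rich.pair rich x-a y-a vx vy x≢y
    ...   | inj₁ a             = inj₁ a
    ...   | inj₂ (L′ , ax , ay) = inj₂ (link-⊆ (away⊆ D) L′ , ax , ay)
    -- `z` is on the other side of the partition than `x` and `y`, so it sees both. What matters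
    -- then is whether `x` and `y` are adjacent or only linked.
    mixed : ∀ {x y z} → x ∈ U → y ∈ U → z ∈ U → Adj G v x → Adj G v y → Adj G v z → x ≢ y →
            Adj G z x → Adj G z y → Through G U v x y z
    mixed {x} {y} x∈ y∈ z∈ vx vy vz x≢y zx zy with x ~? y
    ... | yes xy = clique-through v∈U x∈ y∈ z∈ vx vy vz xy (adj-sym G zx) (adj-sym G zy)
    ... | no ¬xy with pair x∈ y∈ vx vy x≢y
    ...   | inj₁ xy             = contradiction xy ¬xy
    ...   | inj₂ (L′ , ax , ay) = AtLink.wheel-through v∈U L′ x∈ y∈ z∈ vx vy vz x≢y ¬xy zx zy ax ay
    triple : ∀ {x y z} → x ∈ U → y ∈ U → z ∈ U → Adj G v x → Adj G v y → Adj G v z →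
             x ≢ y → x ≢ z → y ≢ z → Through G U v x y z
    triple {x} {y} {z} x∈ y∈ z∈ vx vy vz x≢y x≢z y≢z with kind x∈ vx | kind y∈ vy | kind z∈ vz
    ... | inj₁ a | inj₁ b | inj₁ c = AtLink.triple-through v∈U L x∈ y∈ z∈ vx vy vz x≢y x≢z y≢z a b c
    ... | inj₂ a | inj₂ b | inj₂ c = through-⊆ (away⊆ D) (Rich.triple rich a b c vx vy vz x≢y x≢z y≢z)
    ... | inj₁ a | inj₁ b | inj₂ c = mixed x∈ y∈ z∈ vx vy vz x≢y
            (adj-sym G (complete x∈ (nbr∉ vx) a c)) (adj-sym G (complete y∈ (nbr∉ vy) b c))
    ... | inj₂ a | inj₂ b | inj₁ c = mixed x∈ y∈ z∈ vx vy vz x≢y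
            (complete z∈ (nbr∉ vz) c a) (complete z∈ (nbr∉ vz) c b)
    ... | inj₁ a | inj₂ b | inj₁ c = through-rotate (mixed z∈ x∈ y∈ vz vx vy (x≢z ∘ sym)
            (adj-sym G (complete z∈ (nbr∉ vz) c b)) (adj-sym G (complete x∈ (nbr∉ vx) a b)))
    ... | inj₂ a | inj₁ b | inj₂ c = through-rotate (mixed z∈ x∈ y∈ vz vx vy (x≢z ∘ sym)
            (complete y∈ (nbr∉ vy) b c) (complete y∈ (nbr∉ vy) b a))
    ... | inj₂ a | inj₁ b | inj₁ c = through-rotate (through-rotate (mixed y∈ z∈ x∈ vy vz vx y≢z
            (adj-sym G (complete y∈ (nbr∉ vy) b a)) (adj-sym G (complete z∈ (nbr∉ vz) c a))))
    ... | inj₁ a | inj₂ b | inj₂ c = through-rotate (through-rotate (mixed y∈ z∈ x∈ vy vz vx y≢z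
            (complete x∈ (nbr∉ vx) a b) (complete x∈ (nbr∉ vx) a c)))

  rest : List (Fin m) → List (Fin m) → List (Fin m)
  rest D U = filter (λ p → ¬? (p ∈? D)) U

  -- A connected set D with vertices away from it is enlarged as long as this is possible.
  rich-vertex : ∀ n U {u} → length U ≤ n → u ∈ U → ∃[ v ] v ∈ U × Rich G U v
  rich-away : ∀ n k U {D d w} → length U ≤ suc n → Grown G d D → D ⊆ U → w ∈ away D U →
              length (rest D U) ≤ k → ∃[ v ] v ∈ U × Rich G U v
  rich-vertex zero    (_ ∷ _) ()
  rich-vertex (suc n) U {u} U≤n u∈
    -- If all vertices are adjacent, any of them is rich. Otherwise one of two nonadjacent vertices
    -- starts `D`, and the other is away from it.
    with Fin.any? (λ d → Fin.any? λ w → (d ∈? U) ×-dec (w ∈? U) ×-dec ¬? (d Fin.≟ w) ×-dec ¬? (d ~? w))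
  ... | no all = u , u∈ , clique-rich u∈ complete
    where
    complete : ∀ {p q} → p ∈ U → q ∈ U → p ≢ q → Adj G p q
    complete {p} {q} p∈ q∈ p≢q with p ~? q
    ... | yes a = a
    ... | no ¬a = contradiction (p , q , p∈ , q∈ , p≢q , ¬a) all
  ... | yes (d , w , d∈ , w∈ , d≢w , ¬dw) = rich-away n _ U U≤n root (λ { (here refl) → d∈ })
    (∈-filter⁺ (away? (d ∷ [])) w∈ ((λ { (here refl) → d≢w refl }) , λ { (_ , here refl , a) → ¬dw a })) ℕ.≤-refl
  rich-away n k U {D} {d} {w} U≤n grown D⊆U w∈ D≤k
    -- If `z` touches `D` but misses some `f` away from `D`, it can be added, because `f` stays
    -- away. If there is no such `z`, the hypothesis of `extend-rich` holds.
    with Fin.any? (λ z → Fin.any? λ f → (z ∈? U) ×-dec ¬? (z ∈? D) ×-dec touches? D z ×-dec (f ∈? away D U) ×-dec ¬? (z ~? f))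
  ... | no all = case rich-vertex n (away D U) smaller w∈ of λ
    { (v , v∈ , rich) → v , away⊆ D v∈ , extend-rich grown D⊆U v∈ rich complete }
    where
    -- The root of `D` lies in `U` but is not away from `D`.
    smaller : length (away D U) ≤ n
    smaller = ℕ.≤-pred (ℕ.≤-trans (ℕ.≤-trans
      (filter-shrinks (away? D) (λ _ → yes tt) _ U (D⊆U (root∈ grown)) tt (λ a → proj₁ a (root∈ grown)))
      (length-filter (λ _ → yes tt) U)) U≤n)
    complete : ∀ {z f} → z ∈ U → z ∉ D → Touches D z → f ∈ away D U → Adj G z f
    complete {z} {f} z∈ z∉ t f∈ with z ~? f
    ... | yes a = a
    ... | no ¬a = contradiction (z , f , z∈ , z∉ , t , f∈ , ¬a) all
  ... | yes (z , f , z∈ , z∉ , (a , a∈ , az) , f∈ , ¬zf) = grow-on k D≤k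
    where
    f-away : Away D f
    f-away = proj₂ (∈-filter⁻ (away? D) {xs = U} f∈)
    shrinks : length (rest (z ∷ D) U) < length (rest D U)
    shrinks = filter-shrinks _ _ (λ n i → n (there i)) U z∈ z∉ (λ n → n (here refl))
    f∈′ : f ∈ away (z ∷ D) U
    f∈′ = ∈-filter⁺ (away? (z ∷ D)) {xs = U} (away⊆ {U} D f∈)
      ((λ { (here refl) → proj₂ f-away (a , a∈ , az) ; (there i) → proj₁ f-away i })
      , λ { (_ , here refl , b) → ¬zf b ; (b , there i , c) → proj₂ f-away (b , i , c) })
    grow-on : ∀ k → length (rest D U) ≤ k → ∃[ v ] v ∈ U × Rich G U v
    grow-on zero    D≤0 = contradiction (ℕ.<-≤-trans shrinks D≤0) ℕ.n≮0
    grow-on (suc k) D≤k = rich-away n k U U≤n (grow grown z∉ a∈ az)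
      (λ { (here refl) → z∈ ; (there i) → D⊆U i }) f∈′ (ℕ.≤-pred (ℕ.<-≤-trans shrinks D≤k))

-- Configurations in a model of the complete graph on four vertices

record Model (G : Graph (Fin m)) (d : Fin 4 → Fin m) (D : Fin 4 → List (Fin m)) : Set where
  field
    grown    : ∀ i → Grown G (d i) (D i)
    disjoint : ∀ {i j p} → i ≢ j → p ∈ D i → p ∉ D j
    linked   : ∀ {i j} → i ≢ j → ∃[ a ] ∃[ b ] a ∈ D i × b ∈ D j × Adj G a b

record Meets (G : Graph (Fin m)) (D : Fin 4 → List (Fin m)) : Set where
  field
    config : Config G
    inside : ∀ {p} → p ∈ᶜ config → ∃[ i ] p ∈ D i
    meets  : ∀ i → ∃[ p ] p ∈ D i × p ∈ᶜ config

-- The decision is an argument, so that proofs can split on it for one index without touching the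
-- others.
single : (Fin 4 → Fin m) → (Fin 4 → List (Fin m)) → ∀ i j → Dec (j ≡ i) → List (Fin m)
single d D i j (yes _) = d j ∷ []
single d D i j (no _)  = D j

singled : (Fin 4 → Fin m) → Fin 4 → (Fin 4 → List (Fin m)) → Fin 4 → List (Fin m)
singled d i D j = single d D i j (j Fin.≟ i)

-- The blocks are contracted one at a time. After all four of them the model is a K⁴ on the roots,
-- from which `expand` leads back step by step.
module CollapseBlock {m : ℕ} {G : Graph (Fin m)} {d : Fin 4 → Fin m} {D : Fin 4 → List (Fin m)}
  (M : Model G d D) (i : Fin 4) where
  open Model M

  G′ : Graph (Fin m)
  G′ = collapse G (D i) (d i)

  dᵢ∈ : d i ∈ D i
  dᵢ∈ = root∈ (grown i)

  open Collapsed (collapsed G dᵢ∈)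

  other∉ : ∀ {j p} → j ≢ i → p ∈ D j → p ∉ D i
  other∉ j≢i = disjoint j≢i

  other≢ : ∀ {j p} → j ≢ i → p ∈ D j → p ≢ d i
  other≢ j≢i p∈ refl = disjoint j≢i p∈ dᵢ∈

  down : ∀ {j k p q} → j ≢ i → k ≢ i → p ∈ D j → q ∈ D k → Adj G p q → Adj G′ p q
  down j≢i k≢i p∈ q∈ = keep⁻ (inj₂ (other∉ j≢i p∈)) (inj₂ (other∉ k≢i q∈)) (other≢ j≢i p∈) (other≢ k≢i q∈)

  single⊆ : ∀ j (e : Dec (j ≡ i)) → single d D i j e ⊆ D j
  single⊆ j (yes refl) (here refl) = dᵢ∈
  single⊆ j (no _)     p∈          = p∈

  model : Model G′ d (singled d i D)
  model = record
    { grown    = λ j → grown′ j (j Fin.≟ i)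
    ; disjoint = λ {j} {k} j≢k p∈ q∈ → disjoint j≢k (single⊆ j (j Fin.≟ i) p∈) (single⊆ k (k Fin.≟ i) q∈)
    ; linked   = λ {j} {k} j≢k → linked′ j k (j Fin.≟ i) (k Fin.≟ i) j≢k
    }
    where
    grown′ : ∀ j e → Grown G′ (d j) (single d D i j e)
    grown′ j (yes _)  = root
    grown′ j (no j≢i) = grown-transfer (grown j) (down j≢i j≢i)
    to-hook : ∀ k → i ≢ k → ∃[ b ] b ∈ D k × Adj G′ (d i) b
    to-hook k i≢k = let (a , b , a∈ , b∈ , e) = linked i≢k in
      b , b∈ , near⁻ (inj₂ (other∉ (i≢k ∘ sym) b∈)) (other≢ (i≢k ∘ sym) b∈) a∈ e
    linked′ : ∀ j k e e′ → j ≢ k → ∃[ a ] ∃[ b ] a ∈ single d D i j e × b ∈ single d D i k e′ × Adj G′ a b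
    linked′ j k (yes refl) (yes refl) j≢k = contradiction refl j≢k
    linked′ j k (yes refl) (no _)     j≢k = let (b , b∈ , e) = to-hook k j≢k in d i , b , here refl , b∈ , e
    linked′ j k (no _)     (yes refl) j≢k =
      let (b , b∈ , e) = to-hook j (j≢k ∘ sym) in b , d i , b∈ , here refl , adj-sym G′ e
    linked′ j k (no j≢i)   (no k≢i)   j≢k =
      let (a , b , a∈ , b∈ , e) = linked j≢k in a , b , a∈ , b∈ , down j≢i k≢i a∈ b∈ e

  -- The vertices of the other blocks differ from `d i` and survive the lift, while block `i` is met
  -- because of `hit`.
  expand : Meets G′ (singled d i D) → Meets G D
  expand X = record
    { config = config
    ; inside = λ p∈ → case sound p∈ of λ
        { (inj₁ q∈) → let (j , r) = X.inside q∈ in j , single⊆ j (j Fin.≟ i) r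
        ; (inj₂ (q∈ , _)) → i , q∈ }
    ; meets  = λ j → meets′ j (j Fin.≟ i) (X.meets j)
    }
    where
    module X = Meets X
    place : ∀ {p} j (e : Dec (j ≡ i)) → p ∈ single d D i j e → p ≡ d i ⊎ p ∉ D i
    place j (yes refl) (here eq) = inj₁ eq
    place j (no j≢i)   p∈        = inj₂ (other∉ j≢i p∈)
    lifted : Lift G (d i) (D i) (_∈ᶜ X.config)
    lifted = contract (grown i) X.config (collapsed-⊆
      (λ p∈ → let (j , r) = X.inside p∈ in place j (j Fin.≟ i) r) (collapsed G dᵢ∈))
    open Lift lifted
    meets′ : ∀ j e → ∃[ p ] p ∈ single d D i j e × p ∈ᶜ X.config → ∃[ p ] p ∈ D j × p ∈ᶜ config
    meets′ j (yes refl) (_ , here refl , q) = hit q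
    meets′ j (no j≢i)   (p , p∈ , q)        = p , p∈ , complete q (other≢ j≢i p∈)

meets-singletons : {d : Fin 4 → Fin m} {D : Fin 4 → List (Fin m)} → Model G d D → (∀ i → D i ≡ d i ∷ []) → Meets G D
meets-singletons {m} {G = G} {d = d} {D = D} M eq = record
  { config = proj₁ clique
  ; inside = λ i → inside (proj₁ (proj₂ clique) i)
  ; meets  = λ i → d i , d∈ i , proj₂ (proj₂ clique) (listed i)
  }
  where
  open Model M hiding (disjoint)
  d∈ : ∀ i → d i ∈ D i
  d∈ i = subst (d i ∈_) (sym (eq i)) (here refl)
  is-d : ∀ {i p} → p ∈ D i → p ≡ d i
  is-d {i} p∈ = case subst (_ ∈_) (eq i) p∈ of λ { (here e) → e }
  adj : ∀ {i j} → i ≢ j → Adj G (d i) (d j)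
  adj {i} {j} i≢j with linked i≢j
  ... | a , b , a∈ , b∈ , e with is-d {i} a∈ | is-d {j} b∈
  ...   | refl | refl = e
  ds : List (Fin m)
  ds = d zero ∷ d (suc zero) ∷ d (suc (suc zero)) ∷ d (suc (suc (suc zero))) ∷ []
  clique : ConfigOn G (_∈ ds)
  clique = clique-config (adj λ ()) (adj λ ()) (adj λ ()) (adj λ ()) (adj λ ()) (adj λ ())
  listed : ∀ i → d i ∈ ds
  listed zero                   = here refl
  listed (suc zero)             = there (here refl)
  listed (suc (suc zero))       = there (there (here refl))
  listed (suc (suc (suc zero))) = there (there (there (here refl)))
  inside : ∀ {p} → p ∈ ds → ∃[ i ] p ∈ D i
  inside (here refl)                         = zero , d∈ zero
  inside (there (here refl))                 = suc zero , d∈ _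
  inside (there (there (here refl)))         = suc (suc zero) , d∈ _
  inside (there (there (there (here refl)))) = suc (suc (suc zero)) , d∈ _

model-meets : {d : Fin 4 → Fin m} {D : Fin 4 → List (Fin m)} → Model G d D → Meets G D
model-meets {d = d} {D = D} M =
  C₀.expand (C₁.expand (C₂.expand (C₃.expand (meets-singletons C₃.model all-single))))
  where
  module C₀ = CollapseBlock M zero
  module C₁ = CollapseBlock C₀.model (suc zero)
  module C₂ = CollapseBlock C₁.model (suc (suc zero))
  module C₃ = CollapseBlock C₂.model (suc (suc (suc zero)))
  all-single : ∀ i → singled d (suc (suc (suc zero))) (singled d (suc (suc zero)) (singled d (suc zero) (singled d zero D))) i ≡ d i ∷ []
  all-single zero                   = refl
  all-single (suc zero)             = refl
  all-single (suc (suc zero))       = refl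
  all-single (suc (suc (suc zero))) = refl

-- Configurations are solids

-- The path in the subgraph is built from simplicity alone. Inducedness matters for the field
-- `edges` of `Realised`, which takes it as an argument.
data SimplePath (G : Graph (Fin m)) : Fin m → Fin m → List (Fin m) → Set where
  stop : SimplePath G f f (f ∷ [])
  step : Adj G f p → f ∉ ps → SimplePath G p g ps → SimplePath G f g (f ∷ ps)

simple : InducedPath G f g ps → SimplePath G f g ps
simple stop           = stop
simple (step a n _ P) = step a n (simple P)

len≥1 : {W : Set} {G : Graph W} {x y : W} (P : Path G x y) → x ≢ y → 1 ≤ len P
len≥1 record { len = zero ; start = s ; end = e } x≢y = contradiction (trans (sym s) e) x≢y
len≥1 record { len = suc _ }                      x≢y = s≤s z≤n

len≥2 : {W : Set} {G : Graph W} {x y : W} (P : Path G x y) → x ≢ y → ¬ Adj G x y → 2 ≤ len P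
len≥2 record { len = zero ; start = s ; end = e }                  x≢y ¬xy = contradiction (trans (sym s) e) x≢y
len≥2 {G = G} record { len = suc zero ; start = s ; end = e ; step = a } x≢y ¬xy =
  contradiction (subst (λ p → Adj G p _) s (subst (Adj G _) e (a zero))) ¬xy
len≥2 record { len = suc (suc _) }                                 x≢y ¬xy = s≤s (s≤s z≤n)

cons-path : {W : Set} {G : Graph W} {x y z : W} (P : Path G y z) → Adj G x y → ¬ OnPath P x → Path G x z
cons-path {W} {G} {x} P a x∉ = record
  { len       = suc P.len
  ; vertex    = vertex
  ; injective = injective
  ; start     = refl
  ; end       = P.end
  ; step      = λ { zero → subst (Adj G x) (sym P.start) a ; (suc i) → P.step i }
  }
  where
  module P = Path P
  vertex : Fin (suc (suc P.len)) → W
  vertex zero    = x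
  vertex (suc i) = P.vertex i
  injective : ∀ {i j} → vertex i ≡ vertex j → i ≡ j
  injective {zero}  {zero}  _  = refl
  injective {zero}  {suc j} eq = contradiction (j , sym eq) x∉
  injective {suc i} {zero}  eq = contradiction (i , eq) x∉
  injective {suc i} {suc j} eq = cong suc (P.injective eq)

module Realise {m : ℕ} (G : Graph (Fin m)) (S : Subset m) where
  W : Set
  W = ∃[ v ] v Subset.∈ S

  W≡ : {x y : W} → proj₁ x ≡ proj₁ y → x ≡ y
  W≡ {x , a} {.x , b} refl = cong (x ,_) ([]=-irrelevant a b)

  record Realised (f g : W) (ps : List (Fin m)) : Set where
    field
      path  : Path (G [ S ]) f g
      on    : ∀ {w} → OnPath path w → proj₁ w ∈ ps
      on⁻   : ∀ {w} → proj₁ w ∈ ps → OnPath path w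
      edges : ∀ {u v} → InducedPath G (proj₁ f) (proj₁ g) ps →
              proj₁ u ∈ ps → proj₁ v ∈ ps → Adj G (proj₁ u) (proj₁ v) → PathEdge path u v

  realise : SimplePath G f g ps → (∀ {p} → p ∈ ps → p Subset.∈ S) → (a : f Subset.∈ S) (b : g Subset.∈ S) → Realised (f , a) (g , b) ps
  realise {f = f} stop F a b = record
    { path  = record
      { len = zero ; vertex = λ _ → f , a ; injective = λ { {zero} {zero} _ → refl } ; start = refl ; end = W≡ refl ; step = λ () }
    ; on    = λ { (_ , refl) → here refl }
    ; on⁻   = λ { (here eq) → zero , W≡ (sym eq) }
    ; edges = λ { _ (here refl) (here refl) e → contradiction e (no-loop G) }
    }
  realise {f = f} (step {p = p} {ps = ps} e n P) F a b = record
    { path  = longer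
    ; on    = λ { (zero , refl) → here refl ; (suc i , eq) → there (R.on (i , eq)) }
    ; on⁻   = λ { (here eq) → zero , W≡ (sym eq) ; (there i) → let (j , eq) = R.on⁻ i in suc j , eq }
    ; edges = edges
    }
    where
    p∈ : SimplePath G p _ ps → p ∈ ps
    p∈ stop         = here refl
    p∈ (step _ _ _) = here refl
    module R = Realised (realise P (F ∘ there) (F (there (p∈ P))) b)
    longer : Path (G [ S ]) (f , a) (_ , b)
    longer = cons-path R.path e (λ o → n (R.on o))
    edges : ∀ {u v} → InducedPath G f _ (f ∷ ps) → proj₁ u ∈ f ∷ ps → proj₁ v ∈ f ∷ ps →
            Adj G (proj₁ u) (proj₁ v) → PathEdge longer u v
    edges I (here refl) (here refl) e = contradiction e (no-loop G)
    -- The same list is given as a simple and as an induced path; `only` identifies the second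
    -- vertices of the two.
    edges (step e′ _ only I) (here refl) (there j) e′′ = zero , inj₁ (W≡ refl ,
      trans (Path.start R.path) (W≡ (trans (only (p∈ P) e) (sym (only j e′′)))))
    edges (step e′ _ only I) (there i) (here refl) e′′ = zero , inj₂ (W≡ refl ,
      trans (Path.start R.path) (W≡ (trans (only (p∈ P) e) (sym (only i (adj-sym G e′′))))))
    edges (step {p = p′} e′ _ only I) (there i) (there j) e′′
      with R.edges (resource (sym (only (p∈ P) e)) I) i j e′′
    ... | k , inj₁ (a , b) = suc k , inj₁ (a , b)
    ... | k , inj₂ (a , b) = suc k , inj₂ (a , b)

  module OfWheel (X : Wheel G) (to : ∀ {p} → p Subset.∈ S → p ∈ʷ X) (from : ∀ {p} → p ∈ʷ X → p Subset.∈ S) where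
    open Wheel X
    open Rim rim
    apex-in : apex Subset.∈ S
    apex-in = from (there (here refl))
    last-in : last Subset.∈ S
    last-in = from (there (there (target∈ ring-path)))
    module I = Realised (realise (simple ring-path) (from ∘ there ∘ there) (from (there (there (source∈ ring-path)))) last-in)
    apex-off : ¬ OnPath I.path (apex , apex-in)
    apex-off o = apex∉ (I.on o)
    round : Path (G [ S ]) (apex , apex-in) (last , last-in)
    round = cons-path I.path apex-first apex-off
    on : ∀ {w} → OnPath round w → proj₁ w ∈ circle
    on (zero , refl) = here refl
    on (suc i , eq)  = there (I.on (i , eq))
    on⁻ : ∀ {w} → proj₁ w ∈ circle → OnPath round w
    on⁻ (here eq) = zero , W≡ (sym eq)
    on⁻ (there i) = let (j , eq) = I.on⁻ i in suc j , eq
    cycle : Cycle (G [ S ])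
    cycle = record { path = round ; long = s≤s (len≥1 I.path (λ eq → first≢last (cong proj₁ eq))) ; closing = adj-sym G apex-last }
    module F = Three feet
    foot : Fin 3 → W
    foot = three (F.a , from (there (proj₁ F.Pa))) (F.b , from (there (proj₁ F.Pb))) (F.c , from (there (proj₁ F.Pc)))
    distinct : ∀ {i j} → i ≢ j → foot i ≢ foot j
    distinct = pairwise {R = λ i j → foot i ≢ foot j} (λ n → n ∘ sym)
      (F.a≢b ∘ cong proj₁) (F.a≢c ∘ cong proj₁) (F.b≢c ∘ cong proj₁)
    circle-edge : ∀ {u v : W} → proj₁ u ∈ circle → proj₁ v ∈ circle → Adj G (proj₁ u) (proj₁ v) → CycleEdge cycle u v
    circle-edge (here refl) (here refl) e = contradiction e (no-loop G)
    circle-edge (here refl) (there j) e = case apex-only j e of λ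
      { (inj₁ refl) → inj₁ (zero , inj₁ (W≡ refl , trans (Path.start I.path) (W≡ refl)))
      ; (inj₂ refl) → inj₂ (inj₂ (W≡ refl , W≡ refl)) }
    circle-edge (there i) (here refl) e = case apex-only i (adj-sym G e) of λ
      { (inj₁ refl) → inj₁ (zero , inj₂ (W≡ refl , trans (Path.start I.path) (W≡ refl)))
      ; (inj₂ refl) → inj₂ (inj₁ (W≡ refl , W≡ refl)) }
    circle-edge (there i) (there j) e = case I.edges ring-path i j e of λ { (k , c) → inj₁ (suc k , c) }
    pyramid : Pyramid (G [ S ])
    pyramid = record
      { C            = cycle
      ; w            = hub , from (here refl)
      ; w∉C          = hub∉ ∘ on
      ; foot         = foot
      ; foot-inj     = λ {i} {j} eq → case i Fin.≟ j of λ { (yes e) → e ; (no n) → contradiction eq (distinct n) }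
      ; foot∈C       = all-three (on⁻ (proj₁ F.Pa)) (on⁻ (proj₁ F.Pb)) (on⁻ (proj₁ F.Pc))
      ; spoke        = all-three (proj₂ F.Pa) (proj₂ F.Pb) (proj₂ F.Pc)
      ; all-vertices = λ v → case to (proj₂ v) of λ { (here eq) → inj₁ (W≡ eq) ; (there i) → inj₂ (on⁻ i) }
      ; all-edges    = λ {u} {v} e → all-edges (to (proj₂ u)) (to (proj₂ v)) e
      }
      where
      all-edges : ∀ {u v : W} → proj₁ u ∈ʷ X → proj₁ v ∈ʷ X → Adj G (proj₁ u) (proj₁ v) →
                  CycleEdge cycle u v ⊎ (u ≡ (hub , from (here refl)) × OnCycle cycle v) ⊎ (v ≡ (hub , from (here refl)) × OnCycle cycle u)
      all-edges (here refl) (here refl) e = contradiction e (no-loop G)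
      all-edges (here eq) (there j) e = inj₂ (inj₁ (W≡ eq , on⁻ j))
      all-edges (there i) (here eq) e = inj₂ (inj₂ (W≡ eq , on⁻ i))
      all-edges (there i) (there j) e = inj₁ (circle-edge i j e)

  module OfThreePaths (T : ThreePaths G) (to : ∀ {p} → p Subset.∈ S → p ∈ᵗ T) (from : ∀ {p} → p ∈ᵗ T → p Subset.∈ S) where
    open ThreePaths T

    sourceʷ targetʷ : Fin 3 → W
    sourceʷ i = source (arcs i) , from (i , source∈ (path (arcs i)))
    targetʷ i = target (arcs i) , from (i , target∈ (path (arcs i)))

    realise-arc : ∀ i {f g : W} → source (arcs i) ≡ proj₁ f → target (arcs i) ≡ proj₁ g → Realised f g (verts (arcs i))
    realise-arc i s≡ t≡ = realise (simple (resource s≡ (retarget t≡ (path (arcs i))))) (λ p∈ → from (i , p∈)) _ _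

    off : ∀ {i j p} → i ≢ j → p ∈ᵃ arcs i → p ∈ᵃ arcs j →
          (p ≡ source (arcs i) × p ≡ source (arcs j)) ⊎ (p ≡ target (arcs i) × p ≡ target (arcs j))
    off i≢j = Meet.apart (meet i≢j)

    trihedron : (∀ i j → source (arcs i) ≡ source (arcs j)) → (∀ i j → target (arcs i) ≡ target (arcs j)) → Trihedron (G [ S ])
    trihedron s t = record
      { x≢y          = λ eq → long zero (cong proj₁ eq)
      ; P            = R.path
      -- This is the purpose of `thin`: the paths of a trihedron must have length at least two.
      ; long         = λ i → len≥2 (R.path i) (λ eq → long zero (cong proj₁ eq)) (thin s t zero)
      ; disjoint     = λ {i} {j} i≢j (o , v≢x , v≢y) o′ → case off i≢j (R.on i o) (R.on j o′) of λ
          { (inj₁ (eq , _)) → v≢x (W≡ (trans eq (s i zero))) ; (inj₂ (eq , _)) → v≢y (W≡ (trans eq (t i zero))) }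
      ; all-vertices = λ v → let (i , p∈) = to (proj₂ v) in i , R.on⁻ i p∈
      ; all-edges    = λ {u} {v} e → all-edges (to (proj₂ u)) (to (proj₂ v)) e
      }
      where
      realised : ∀ i → Realised (sourceʷ zero) (targetʷ zero) (verts (arcs i))
      realised i = realise-arc i (s i zero) (t i zero)
      module R i = Realised (realised i)
      along : ∀ i {u v : W} → proj₁ u ∈ᵃ arcs i → proj₁ v ∈ᵃ arcs i → Adj G (proj₁ u) (proj₁ v) → ∃[ i ] PathEdge (R.path i) u v
      along i p∈ q∈ e = i , R.edges i (resource (s i zero) (retarget (t i zero) (path (arcs i)))) p∈ q∈ e
      -- With common ends every contact between two arcs has a vertex on both of them, so the edge
      -- runs within a single arc.
      all-edges : ∀ {u v : W} → proj₁ u ∈ᵗ T → proj₁ v ∈ᵗ T → Adj G (proj₁ u) (proj₁ v) → ∃[ i ] PathEdge (R.path i) u v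
      all-edges (i , p∈) (j , q∈) e with i Fin.≟ j
      ... | yes refl = along i p∈ q∈ e
      ... | no i≢j with Meet.edge (meet i≢j) p∈ q∈ e
      ...   | on-right a    = along j a q∈ e
      ...   | on-left a     = along i p∈ a e
      ...   | starts refl b = along j (subst (_∈ᵃ arcs j) (s j i) (source∈ (path (arcs j)))) q∈ e
      ...   | ends refl b   = along j (subst (_∈ᵃ arcs j) (t j i) (target∈ (path (arcs j)))) q∈ e

    triangle : (φ : Fin 3 → W) → (∀ {i j} → i ≢ j → Adj G (proj₁ (φ i)) (proj₁ (φ j))) → Triangle (G [ S ])
    triangle φ a = record { corner = φ ; adj = a }

    stamp : (∀ {i j} → i ≢ j → Adj G (source (arcs i)) (source (arcs j))) → (∀ i j → target (arcs i) ≡ target (arcs j)) → Stamp (G [ S ])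
    stamp s t = record
      { T            = triangle sourceʷ s
      ; x            = targetʷ zero
      ; x∉T          = λ (i , eq) → long i (trans (cong proj₁ eq) (t zero i))
      ; P            = R.path
      ; long         = λ i → len≥1 (R.path i) (λ eq → long i (trans (cong proj₁ eq) (t zero i)))
      ; disjoint     = λ {i} {j} i≢j v≢x o o′ → case off i≢j (R.on i o) (R.on j o′) of λ
          { (inj₁ (eq , eq′)) → adj⇒≢ G (s i≢j) (trans (sym eq) eq′) ; (inj₂ (eq , _)) → v≢x (W≡ (trans eq (t i zero))) }
      ; P∩T          = λ { i o (j , refl) → corner-of i j (R.on i o) }
      ; all-vertices = λ v → let (i , p∈) = to (proj₂ v) in i , R.on⁻ i p∈
      ; all-edges    = λ {u} {v} e → all-edges (to (proj₂ u)) (to (proj₂ v)) e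
      }
      where
      module R i = Realised (realise-arc i {sourceʷ i} {targetʷ zero} refl (t i zero))
      corner-of : ∀ i j → source (arcs j) ∈ᵃ arcs i → sourceʷ j ≡ sourceʷ i
      corner-of i j p∈ with i Fin.≟ j
      ... | yes refl = refl
      ... | no i≢j with off i≢j p∈ (source∈ (path (arcs j)))
      ...   | inj₁ (eq , _)  = contradiction (sym eq) (adj⇒≢ G (s i≢j))
      ...   | inj₂ (_ , eq′) = contradiction eq′ (long j)
      along : ∀ i {u v : W} → proj₁ u ∈ᵃ arcs i → proj₁ v ∈ᵃ arcs i → Adj G (proj₁ u) (proj₁ v) → ∃[ i ] PathEdge (R.path i) u v
      along i p∈ q∈ e = i , R.edges i (retarget (t i zero) (path (arcs i))) p∈ q∈ e
      all-edges : ∀ {u v : W} → proj₁ u ∈ᵗ T → proj₁ v ∈ᵗ T → Adj G (proj₁ u) (proj₁ v) →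
                  ((∃[ i ] sourceʷ i ≡ u) × (∃[ i ] sourceʷ i ≡ v)) ⊎ ∃[ i ] PathEdge (R.path i) u v
      all-edges (i , p∈) (j , q∈) e with i Fin.≟ j
      ... | yes refl = inj₂ (along i p∈ q∈ e)
      ... | no i≢j with Meet.edge (meet i≢j) p∈ q∈ e
      ...   | on-right a = inj₂ (along j a q∈ e)
      ...   | on-left a  = inj₂ (along i p∈ a e)
      ...   | starts a b = inj₁ ((i , W≡ (sym a)) , (j , W≡ (sym b)))
      ...   | ends a b   = contradiction (trans a (trans (t i j) (sym b))) (adj⇒≢ G e)

    prism : (∀ {i j} → i ≢ j → Adj G (source (arcs i)) (source (arcs j))) →
            (∀ {i j} → i ≢ j → Adj G (target (arcs i)) (target (arcs j))) → Prism (G [ S ])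
    prism s t = record
      { T            = triangle sourceʷ s
      ; T′           = triangle targetʷ t
      ; T∩T′         = λ { (i , refl) (j , eq) → apart i j (cong proj₁ eq) }
      ; P            = R.path
      ; disjoint     = λ {i} {j} i≢j o o′ → case off i≢j (R.on i o) (R.on j o′) of λ
          { (inj₁ (eq , eq′)) → adj⇒≢ G (s i≢j) (trans (sym eq) eq′) ; (inj₂ (eq , eq′)) → adj⇒≢ G (t i≢j) (trans (sym eq) eq′) }
      ; all-vertices = λ v → let (i , p∈) = to (proj₂ v) in i , R.on⁻ i p∈
      ; all-edges    = λ {u} {v} e → all-edges (to (proj₂ u)) (to (proj₂ v)) e
      }
      where
      module R i = Realised (realise-arc i {sourceʷ i} {targetʷ i} refl refl)
      apart : ∀ i j → ¬ target (arcs j) ≡ source (arcs i)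
      apart i j eq with i Fin.≟ j
      ... | yes refl = long i (sym eq)
      ... | no i≢j with off i≢j (source∈ (path (arcs i))) (subst (_∈ᵃ arcs j) eq (target∈ (path (arcs j))))
      ...   | inj₁ (_ , e) = adj⇒≢ G (s i≢j) e
      ...   | inj₂ (e , _) = long i e
      along : ∀ i {u v : W} → proj₁ u ∈ᵃ arcs i → proj₁ v ∈ᵃ arcs i → Adj G (proj₁ u) (proj₁ v) → ∃[ i ] PathEdge (R.path i) u v
      along i p∈ q∈ e = i , R.edges i (path (arcs i)) p∈ q∈ e
      all-edges : ∀ {u v : W} → proj₁ u ∈ᵗ T → proj₁ v ∈ᵗ T → Adj G (proj₁ u) (proj₁ v) →
                  ((∃[ i ] sourceʷ i ≡ u) × (∃[ i ] sourceʷ i ≡ v)) ⊎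
                  ((∃[ i ] targetʷ i ≡ u) × (∃[ i ] targetʷ i ≡ v)) ⊎ ∃[ i ] PathEdge (R.path i) u v
      all-edges (i , p∈) (j , q∈) e with i Fin.≟ j
      ... | yes refl = inj₂ (inj₂ (along i p∈ q∈ e))
      ... | no i≢j with Meet.edge (meet i≢j) p∈ q∈ e
      ...   | on-right a = inj₂ (inj₂ (along j a q∈ e))
      ...   | on-left a  = inj₂ (inj₂ (along i p∈ a e))
      ...   | starts a b = inj₁ ((i , W≡ (sym a)) , (j , W≡ (sym b)))
      ...   | ends a b   = inj₂ (inj₁ ((i , W≡ (sym a)) , (j , W≡ (sym b))))

  -- The kinds of the two ends decide between trihedron, stamp and prism; a stamp with its triangle
  -- at the targets is reversed.
  solid-graph : (C : Config G) → (∀ {p} → p Subset.∈ S → p ∈ᶜ C) → (∀ {p} → p ∈ᶜ C → p Subset.∈ S) → SolidGraph (G [ S ])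
  solid-graph (wheel X) to from = inj₁ (OfWheel.pyramid X to from)
  solid-graph (three-paths T) to from with ThreePaths.start T | ThreePaths.end T
  ... | point s   | point t   = inj₂ (inj₁ (OfThreePaths.trihedron T to from s t))
  ... | corners s | point t   = inj₂ (inj₂ (inj₁ (OfThreePaths.stamp T to from s t)))
  ... | corners s | corners t = inj₂ (inj₂ (inj₂ (OfThreePaths.prism T to from s t)))
  ... | point s   | corners t = inj₂ (inj₂ (inj₁ (OfThreePaths.stamp (reverse-all T)
          (λ i → map₂ (λ {j} → ∈-reverse (ThreePaths.arcs T j)) (to i))
          (λ i → from (map₂ (λ {j} → ∈-reverse⁻ (ThreePaths.arcs T j)) i)) t s)))

support : {G : Graph (Fin m)} → Config G → Subset m
support C = Vec.tabulate λ p → does (p ∈ᶜ? C)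

∈-support : (C : Config G) → p ∈ᶜ C → p Subset.∈ support C
∈-support {p = p} C p∈ = lookup⇒[]= p _ (trans (lookup∘tabulate _ p) (dec-true (p ∈ᶜ? C) p∈))

∈-support⁻ : (C : Config G) → p Subset.∈ support C → p ∈ᶜ C
∈-support⁻ {p = p} C p∈ with p ∈ᶜ? C | trans (sym (lookup∘tabulate (λ q → does (q ∈ᶜ? C)) p)) ([]=⇒lookup p∈)
... | yes i | _ = i
... | no _  | ()

support-solid : (C : Config G) → IsSolid G (support C)
support-solid {G = G} C = _ , G [ support C ] , Realise.solid-graph G (support C) C (∈-support⁻ C) (∈-support C) ,
  record { vertices = ↔-id _ ; adjacent = λ _ _ → mk⇔ id id }

-- Counting

open import Data.Nat.Combinatorics using (_C_; nCk≡nC[n∸k]; nCn≡1; k>n⇒nCk≡0; nCk+nC[k+1]≡[n+1]C[k+1])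

take⊆ : {A : Set} (n : ℕ) (xs : List A) → take n xs ⊆ xs
take⊆ n xs i = subst (_ ∈_) (take++drop≡id n xs) (∈-++⁺ˡ i)

length-take≤ : {A : Set} {n : ℕ} {xs : List A} → n ≤ length xs → length (take n xs) ≡ n
length-take≤ {n = n} {xs = xs} n≤ = trans (length-take n xs) (ℕ.m≤n⇒m⊓n≡m n≤)

unique-⊆-length : {A : Set} {xs ys : List A} → Unique ys → ys ⊆ xs → length ys ≤ length xs
unique-⊆-length [] F = z≤n
unique-⊆-length {ys = y ∷ ys} (y∉ ∷ U) F with ∈-∃++ (F (here refl))
... | as , bs , refl = begin
  suc (length ys)                ≤⟨ s≤s (unique-⊆-length U others) ⟩
  suc (length (as ++ bs))        ≡⟨ cong suc (length-++ as) ⟩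
  suc (length as + length bs)    ≡⟨ sym (ℕ.+-suc (length as) (length bs)) ⟩
  length as + length (y ∷ bs)    ≡⟨ sym (length-++ as) ⟩
  length (as ++ y ∷ bs)          ∎
  where
  open ℕ.≤-Reasoning
  others : ys ⊆ as ++ bs
  others i with ∈-++⁻ as (F (there i))
  ... | inj₁ j           = ∈-++⁺ˡ j
  ... | inj₂ (there j)   = ∈-++⁺ʳ as j
  ... | inj₂ (here refl) = contradiction refl (All.lookup y∉ i)

nC0≡1 : ∀ n → n C 0 ≡ 1
nC0≡1 n = trans (nCk≡nC[n∸k] {n = n} z≤n) (nCn≡1 n)

-- The recursion is Pascal's rule: the subsets that hit x and those that do not are distinct.
many-subsets : {X : Set} {Hit : X → Subset m → Set} {Good : Subset m → Set} (xs : List X) → Unique xs → ∀ k →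
               (∀ {c} → Unique c → c ⊆ xs → length c ≡ k →
                ∃[ S ] Good S × (∀ {x} → x ∈ xs → (x ∈ c → Hit x S) × (Hit x S → x ∈ c))) →
               ∃[ Ss ] Unique Ss × All Good Ss × length Ss ≡ length xs C k
many-subsets xs U zero F with F [] (λ ()) refl
... | S , good , _ = S ∷ [] , ([] ∷ []) , (good ∷ []) , sym (nC0≡1 (length xs))
many-subsets [] U (suc k) F = [] , [] , [] , sym (k>n⇒nCk≡0 {n = 0} {k = suc k} (s≤s z≤n))
many-subsets {Hit = Hit} {Good = Good} (x ∷ xs) (x∉ ∷ U) (suc k) F
  -- Whether `x` is hit becomes part of `Good`, which makes the two lists disjoint.
  with many-subsets {Hit = Hit} {Good = λ S → Good S × Hit x S} xs U k with-x
     | many-subsets {Hit = Hit} {Good = λ S → Good S × ¬ Hit x S} xs U (suc k) without-x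
  where
  fresh : x ∉ xs
  fresh i = All.lookup x∉ i refl
  with-x : ∀ {c} → Unique c → c ⊆ xs → length c ≡ k →
           ∃[ S ] (Good S × Hit x S) × (∀ {y} → y ∈ xs → (y ∈ c → Hit y S) × (Hit y S → y ∈ c))
  with-x {c} Uc c⊆ len with F {x ∷ c} (All.tabulate (λ i → λ { refl → fresh (c⊆ i) }) ∷ Uc)
                              (λ { (here eq) → here eq ; (there i) → there (c⊆ i) }) (cong suc len)
  ... | S , good , trace = S , (good , proj₁ (trace (here refl)) (here refl)) , λ i →
    proj₁ (trace (there i)) ∘ there ,
    λ h → case proj₂ (trace (there i)) h of λ { (here refl) → contradiction i fresh ; (there j) → j }
  without-x : ∀ {c} → Unique c → c ⊆ xs → length c ≡ suc k →
              ∃[ S ] (Good S × ¬ Hit x S) × (∀ {y} → y ∈ xs → (y ∈ c → Hit y S) × (Hit y S → y ∈ c))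
  without-x Uc c⊆ len with F Uc (there ∘ c⊆) len
  ... | S , good , trace = S , (good , λ h → fresh (c⊆ (proj₂ (trace (here refl)) h))) , λ i → trace (there i)
... | Ss , Us , goods , lenS | Ts , Ut , goodt , lenT =
  Ss ++ Ts
  , ++⁺ Us Ut (λ (i , j) → proj₂ (All.lookup goodt j) (proj₂ (All.lookup goods i)))
  , All.++⁺ (All.map proj₁ goods) (All.map proj₁ goodt)
  , trans (length-++ Ss) (trans (cong₂ _+_ lenS lenT) (nCk+nC[k+1]≡[n+1]C[k+1] (length xs) k))

-- The chromatic number

infix 4 _∈ℕ?_
_∈ℕ?_ : (n : ℕ) (ns : List ℕ) → Dec (n ∈ ns)
_∈ℕ?_ = DecMembership._∈?_ ℕ._≟_

-- A colouring of the subgraph on `U`, but given by a total function into the natural numbers, so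
-- that it needs no transport when `U` or `k` changes.
record Colouring (G : Graph (Fin m)) (U : List (Fin m)) (k : ℕ) : Set where
  field
    colour : Fin m → ℕ
    bound  : ∀ {p} → p ∈ U → colour p < k
    proper : ∀ {p q} → p ∈ U → q ∈ U → Adj G p q → colour p ≢ colour q

without : Fin m → List (Fin m) → List (Fin m)
without v = filter (λ p → ¬? (p Fin.≟ v))

add-colour : {U : List (Fin m)} {k l : ℕ} (c : Colouring G (without v U) k) → k ≤ l → ∀ j → j < l →
             (∀ {p} → p ∈ U → Adj G v p → Colouring.colour c p ≢ j) → Colouring G U l
add-colour {m} {G = G} {v = v} {U = U} c k≤l j j<l new = record { colour = colour′ ; bound = bound′ ; proper = proper′ }
  where
  open Colouring c
  colour′ : Fin m → ℕ
  colour′ p with p Fin.≟ v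
  ... | yes _ = j
  ... | no _  = colour p
  kept : ∀ {p} → p ∈ U → p ≢ v → p ∈ without v U
  kept = ∈-filter⁺ (λ p → ¬? (p Fin.≟ v))
  bound′ : ∀ {p} → p ∈ U → colour′ p < _
  bound′ {p} i with p Fin.≟ v
  ... | yes _  = j<l
  ... | no p≢v = ℕ.<-≤-trans (bound (kept i p≢v)) k≤l
  proper′ : ∀ {p q} → p ∈ U → q ∈ U → Adj G p q → colour′ p ≢ colour′ q
  proper′ {p} {q} i i′ a with p Fin.≟ v | q Fin.≟ v
  ... | yes refl | yes refl = contradiction a (no-loop G)
  ... | yes refl | no _     = new i′ a ∘ sym
  ... | no _     | yes refl = new i (adj-sym G a)
  ... | no p≢v   | no q≢v   = proper (kept i p≢v) (kept i′ q≢v) a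

add-new-colour : {U : List (Fin m)} {k : ℕ} → Colouring G (without v U) k → Colouring G U (suc k)
add-new-colour {G = G} {v = v} {k = k} c = add-colour c (ℕ.n≤1+n k) k ℕ.≤-refl
  λ {p} i a eq → ℕ.<-irrefl eq (Colouring.bound c (∈-filter⁺ (λ p → ¬? (p Fin.≟ v)) i (adj⇒≢ G a ∘ sym)))

-- Greedy colouring: fewer than `k` neighbours of `v` leave one of the `k` colours free.
add-old-colour : {U : List (Fin m)} {k : ℕ} → length (filter (Graph._adj?_ G v) U) < k →
                 Colouring G (without v U) k → Colouring G U k
add-old-colour {G = G} {v = v} {U = U} {k = k} few-nbrs c
  with ℕ.anyUpTo? (λ j → ¬? (j ∈ℕ? map (Colouring.colour c) (filter (Graph._adj?_ G v) U))) k
... | yes (j , j<k , j∉) = add-colour c ℕ.≤-refl j j<k λ i a eq →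
  j∉ (subst (_∈ _) eq (∈-map⁺ (Colouring.colour c) (∈-filter⁺ (Graph._adj?_ G v) i a)))
... | no none-free = contradiction few-nbrs (ℕ.≤⇒≯ (begin
  k                                                                        ≡⟨ sym (length-upTo k) ⟩
  length (upTo k)                                                          ≤⟨ unique-⊆-length (upTo⁺ k) used ⟩
  length (map (Colouring.colour c) (filter (Graph._adj?_ G v) U))          ≡⟨ length-map _ (filter (Graph._adj?_ G v) U) ⟩
  length (filter (Graph._adj?_ G v) U)                                     ∎))
  where
  open ℕ.≤-Reasoning
  used : upTo k ⊆ map (Colouring.colour c) (filter (Graph._adj?_ G v) U)
  used {j} i with j ∈ℕ? map (Colouring.colour c) (filter (Graph._adj?_ G v) U)
  ... | yes j∈ = j∈
  ... | no j∉  = contradiction (j , ∈-upTo⁻ i , j∉) none-free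

SolidIn : Graph (Fin m) → List (Fin m) → Subset m → Set₁
SolidIn G U S = IsSolid G S × (∀ {p} → p Subset.∈ S → p ∈ U)

support-in : {U : List (Fin m)} (X : Config G) → (∀ {p} → p ∈ᶜ X → p ∈ U) → SolidIn G U (support X)
support-in X X⊆ = support-solid X , λ i → X⊆ (∈-support⁻ X i)

-- By the field `only` of `Through`, the trace of each solid on the neighbours of `v` is the triple
-- it was built for, so distinct triples give distinct solids.
through-solids : {U : List (Fin m)} → Unique U → Rich G U v → v ∈ U → ∀ k → k ≤ length (filter (Graph._adj?_ G v) U) →
                 ∃[ Cs ] Unique Cs × All (λ S → ∃[ X ] S ≡ support {G = G} X × (∀ {p} → p ∈ᶜ X → p ∈ U) × v ∈ᶜ X) Cs × length Cs ≡ k C 3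
through-solids {m} {G = G} {v = v} {U = U} UU rich v∈ k k≤ =
  let (Ss , Us , goods , len) = many-subsets {Hit = λ p S → p Subset.∈ S} nbrs (take⁺ k (filter⁺ (Graph._adj?_ G v) UU)) 3 triple
  in Ss , Us , goods , trans len (cong (_C 3) (length-take≤ k≤))
  where
  nbrs : List (Fin m)
  -- Choosing from exactly `k` neighbours gives the exact count `k C 3`.
  nbrs = take k (filter (Graph._adj?_ G v) U)
  nbr : ∀ {p} → p ∈ nbrs → p ∈ U × Adj G v p
  nbr i = ∈-filter⁻ (Graph._adj?_ G v) {xs = U} (take⊆ k _ i)
  triple : ∀ {c} → Unique c → c ⊆ nbrs → length c ≡ 3 →
           ∃[ S ] (∃[ X ] S ≡ support {G = G} X × (∀ {p} → p ∈ᶜ X → p ∈ U) × v ∈ᶜ X) ×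
             (∀ {x} → x ∈ nbrs → (x ∈ c → x Subset.∈ S) × (x Subset.∈ S → x ∈ c))
  triple {x ∷ y ∷ z ∷ []} ((x≢y ∷ x≢z ∷ []) ∷ (y≢z ∷ []) ∷ _) c⊆ refl
    with nbr (c⊆ (here refl)) | nbr (c⊆ (there (here refl))) | nbr (c⊆ (there (there (here refl))))
  ... | x∈ , vx | y∈ , vy | z∈ , vz = traced (Rich.triple rich x∈ y∈ z∈ vx vy vz x≢y x≢z y≢z)
    where
    traced : Through G U v x y z →
             ∃[ S ] (∃[ X ] S ≡ support {G = G} X × (∀ {p} → p ∈ᶜ X → p ∈ U) × v ∈ᶜ X) ×
               (∀ {w} → w ∈ nbrs → (w ∈ x ∷ y ∷ z ∷ [] → w Subset.∈ S) × (w Subset.∈ S → w ∈ x ∷ y ∷ z ∷ []))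
    traced record { config = config ; inside = inside ; only = only ; v∈ = v∈C ; x∈ = x∈C ; y∈ = y∈C ; z∈ = z∈C } =
      support config , (config , refl , inside , v∈C) , λ i →
      (λ { (here refl) → ∈-support config x∈C ; (there (here refl)) → ∈-support config y∈C
         ; (there (there (here refl))) → ∈-support config z∈C })
      , λ j → case only (∈-support⁻ config j) (proj₂ (nbr i)) of λ
        { (inj₁ e) → here e ; (inj₂ (inj₁ e)) → there (here e) ; (inj₂ (inj₂ e)) → there (there (here e)) }

-- Induction on the length of `U`. Here `k` is one less than the `n` of the theorem, which explains
-- `suc k C 4`. Confining the solids to `U` separates those of the smaller set from those through
-- the deleted vertex.
chromatic-solids : (G : Graph (Fin m)) → ∀ n {U} → length U ≤ n → Unique U → ∀ k → ¬ Colouring G U k →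
                   ∃[ Ss ] Unique Ss × All (SolidIn G U) Ss × suc k C 4 ≤ length Ss
chromatic-solids G n {[]} U≤n UU k ¬c = contradiction
  (record { colour = λ _ → 0 ; bound = λ () ; proper = λ () }) ¬c
chromatic-solids G (suc n) {U@(_ ∷ _)} U≤n UU k ¬c with Richness.rich-vertex G (suc n) U U≤n (here refl)
... | v , v∈ , rich = found (length (filter (Graph._adj?_ G v) U) ℕ.<? k)
  where
  kept : ∀ {p} → p ∈ without v U → p ∈ U × p ≢ v
  kept = ∈-filter⁻ (λ p → ¬? (p Fin.≟ v)) {xs = U}
  smaller : length (without v U) ≤ n
  smaller = ℕ.≤-pred (ℕ.≤-trans (ℕ.≤-trans
    (filter-shrinks (λ p → ¬? (p Fin.≟ v)) (λ _ → yes tt) _ U v∈ tt (λ v≢v → v≢v refl))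
    (length-filter (λ _ → yes tt) U)) U≤n)
  UU′ : Unique (without v U)
  UU′ = filter⁺ (λ p → ¬? (p Fin.≟ v)) UU
  weaken : ∀ {S} → SolidIn G (without v U) S → SolidIn G U S
  weaken (solid , S⊆) = solid , λ i → proj₁ (kept (S⊆ i))
  beyond : ∀ k → ¬ Colouring G U k → k ≤ length (filter (Graph._adj?_ G v) U) →
           ∃[ Ss ] Unique Ss × All (SolidIn G U) Ss × suc k C 4 ≤ length Ss
  -- `1 C 4` is zero, so the empty list suffices.
  beyond zero    ¬c k≤ = [] , [] , [] , z≤n
  -- Since `v` could receive a colour of its own, the other vertices have no colouring with `j`
  -- colours.
  beyond (suc j) ¬c k≤ with chromatic-solids G n smaller UU′ j (¬c ∘ add-new-colour)
                          | through-solids UU rich v∈ (suc j) k≤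
  ... | Ss , Us , goods , lenS | Ts , Ut , goodt , lenT =
    Ts ++ Ss
    -- The solids in `Ts` contain `v`, whereas those in `Ss` lie in `without v U`.
    , ++⁺ Ut Us (λ (i , i′) → case All.lookup goodt i of λ
        { (X , refl , _ , v∈C) → proj₂ (kept (proj₂ (All.lookup goods i′) (∈-support X v∈C))) refl })
    , All.++⁺ (All.map (λ { (X , refl , X⊆ , _) → support-in X X⊆ }) goodt) (All.map weaken goods)
    , (begin
        suc (suc j) C 4                ≡⟨ sym (nCk+nC[k+1]≡[n+1]C[k+1] (suc j) 3) ⟩
        suc j C 3 + suc j C 4          ≤⟨ ℕ.+-mono-≤ (ℕ.≤-reflexive (sym lenT)) lenS ⟩
        length Ts + length Ss          ≡⟨ sym (length-++ Ts) ⟩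
        length (Ts ++ Ss)              ∎)
    where open ℕ.≤-Reasoning
  found : Dec (length (filter (Graph._adj?_ G v) U) < k) →
          ∃[ Ss ] Unique Ss × All (SolidIn G U) Ss × suc k C 4 ≤ length Ss
  found (yes few-nbrs) with chromatic-solids G n smaller UU′ k (¬c ∘ add-old-colour few-nbrs)
  ... | Ss , Us , goods , lenS = Ss , Us , All.map weaken goods , lenS
  found (no ¬few) = beyond k ¬c (ℕ.≮⇒≥ ¬few)

-- The Hadwiger number

-- The vertices of the walk are added in order, skipping those already listed; each new one is
-- adjacent to its predecessor on the walk, which is listed by then.
grow-along : {B : Subset m} {D : List (Fin m)} {a b : ∃[ p ] p Subset.∈ B} → Star (Adj (G [ B ])) a b → Grown G d D →
             (∀ {p} → p ∈ D → p Subset.∈ B) → proj₁ a ∈ D →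
             ∃[ E ] Grown G d E × (∀ {p} → p ∈ E → p Subset.∈ B) × D ⊆ E × proj₁ b ∈ E
grow-along ε grown D⊆ a∈ = _ , grown , D⊆ , id , a∈
grow-along {D = D} (_◅_ {j = c , c∈B} e walk) grown D⊆ a∈ with c ∈? D
... | yes c∈ = grow-along walk grown D⊆ c∈
... | no c∉ with grow-along walk (grow grown c∉ a∈ e) (λ { (here refl) → c∈B ; (there i) → D⊆ i }) (here refl)
...   | E , grown′ , E⊆ , D⊆E , b∈ = E , grown′ , E⊆ , D⊆E ∘ there , b∈

grow-cover : {B : Subset m} → Connected (G [ B ]) → (r : ∃[ p ] p Subset.∈ B) → ∀ ts → (∀ {p} → p ∈ ts → p Subset.∈ B) →
             ∃[ D ] Grown G (proj₁ r) D × (∀ {p} → p ∈ D → p Subset.∈ B) × ts ⊆ D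
grow-cover conn (r , r∈) [] ts⊆ = r ∷ [] , root , (λ { (here refl) → r∈ }) , λ ()
grow-cover conn r (t ∷ ts) ts⊆ with grow-cover conn r ts (ts⊆ ∘ there)
... | D , grown , D⊆ , ts⊆D with grow-along (conn r (t , ts⊆ (here refl))) grown D⊆ (root∈ grown)
...   | E , grown′ , E⊆ , D⊆E , t∈ = E , grown′ , E⊆ , λ { (here refl) → t∈ ; (there i) → D⊆E (ts⊆D i) }

grow-all : {B : Subset m} → Connected (G [ B ]) → (r : ∃[ p ] p Subset.∈ B) →
           ∃[ D ] Grown G (proj₁ r) D × (∀ {p} → p ∈ D → p Subset.∈ B) × (∀ {p} → p Subset.∈ B → p ∈ D)
grow-all {m} {B = B} conn r with grow-cover conn r (filter (_∈ˢ? B) (allFin m))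
                                   (λ i → proj₂ (∈-filter⁻ (_∈ˢ? B) {xs = allFin m} i))
... | D , grown , D⊆ , all⊆ = D , grown , D⊆ , λ p∈ → all⊆ (∈-filter⁺ (_∈ˢ? B) (∈-allFin _) p∈)

lookup-distinct : {A : Set} {xs : List A} → Unique xs → ∀ {i j} → i ≢ j → lookup xs i ≢ lookup xs j
lookup-distinct (_ ∷ _)  {zero}  {zero}  i≢j = contradiction refl i≢j
lookup-distinct (x∉ ∷ _) {zero}  {suc j} i≢j = All.lookup x∉ (∈-lookup j)
lookup-distinct (x∉ ∷ _) {suc i} {zero}  i≢j = All.lookup x∉ (∈-lookup i) ∘ sym
lookup-distinct (_ ∷ U)  {suc i} {suc j} i≢j = lookup-distinct U (i≢j ∘ cong suc)

minor-solids : {G : Graph (Fin m)} {t n : ℕ} → K t ≼ G → n ≤ t → ∃[ Ss ] Unique Ss × All (IsSolid G) Ss × length Ss ≡ n C 4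
minor-solids {m} {G = G} {t} {n} M n≤t =
  let (Ss , Us , goods , len) = many-subsets {Hit = Hit} chosen (take⁺ n (allFin⁺ t)) 4 quadruple
  in Ss , Us , All.map (λ { (X , refl) → support-solid X }) goods
     , trans len (cong (_C 4) (length-take≤ (ℕ.≤-trans n≤t (ℕ.≤-reflexive (sym (length-tabulate {n = t} id))))))
  where
  open _≼_ M
  -- The elements to be recovered from a solid are the branch sets that it meets.
  Hit : Fin t → Subset m → Set
  Hit i S = ∃[ p ] p Subset.∈ branch i × p Subset.∈ S
  chosen : List (Fin t)
  chosen = take n (allFin t)
  block : ∀ i → ∃[ D ] Grown G (proj₁ (nonempty i)) D × (∀ {p} → p ∈ D → p Subset.∈ branch i) × (∀ {p} → p Subset.∈ branch i → p ∈ D)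
  block i = grow-all (connected i) (nonempty i)
  quadruple : ∀ {c} → Unique c → c ⊆ chosen → length c ≡ 4 →
              ∃[ S ] (∃[ X ] S ≡ support {G = G} X) × (∀ {x} → x ∈ chosen → (x ∈ c → Hit x S) × (Hit x S → x ∈ c))
  quadruple {c@(_ ∷ _ ∷ _ ∷ _ ∷ [])} Uc _ refl = traced (model-meets model)
    where
    idx : Fin 4 → Fin t
    idx = lookup c
    D : Fin 4 → List (Fin m)
    D i = proj₁ (block (idx i))
    D⊆ : ∀ i {p} → p ∈ D i → p Subset.∈ branch (idx i)
    D⊆ i = proj₁ (proj₂ (proj₂ (block (idx i))))
    ⊆D : ∀ i {p} → p Subset.∈ branch (idx i) → p ∈ D i
    ⊆D i = proj₂ (proj₂ (proj₂ (block (idx i))))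
    model : Model G (λ i → proj₁ (nonempty (idx i))) D
    model = record
      { grown    = λ i → proj₁ (proj₂ (block (idx i)))
      ; disjoint = λ {i} {j} i≢j p∈ q∈ → disjoint (lookup-distinct Uc i≢j) (D⊆ i p∈) (D⊆ j q∈)
      ; linked   = λ {i} {j} i≢j → let (a , b , a∈ , b∈ , e) = linked (lookup-distinct Uc i≢j) in
                     a , b , ⊆D i a∈ , ⊆D j b∈ , e
      }
    traced : Meets G D → ∃[ S ] (∃[ X ] S ≡ support {G = G} X) × (∀ {x} → x ∈ chosen → (x ∈ c → Hit x S) × (Hit x S → x ∈ c))
    traced record { config = config ; inside = inside ; meets = meets } =
      support config , (config , refl) , λ _ → hits , hit⁻
      where
      hit-idx : ∀ i → Hit (idx i) (support config)
      hit-idx i = let (p , p∈ , q) = meets i in p , D⊆ i p∈ , ∈-support config q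
      hits : ∀ {x} → x ∈ c → Hit x (support config)
      hits x∈ = subst (λ y → Hit y (support config)) (sym (lookup-index x∈)) (hit-idx (index x∈))
      hit⁻ : ∀ {x} → Hit x (support config) → x ∈ c
      hit⁻ {x} (p , p∈ , q) with inside (∈-support⁻ config q)
      -- The vertex lies in the branch set of `x` and in that of `idx i`; as different branch sets
      -- are disjoint, the two indices agree.
      ... | i , r with x Fin.≟ idx i
      ...   | yes refl = ∈-lookup {xs = c} i
      ...   | no x≢    = contradiction (D⊆ i r) (disjoint x≢ p∈)

colouring⇒colourable : {k : ℕ} → Colouring G (allFin m) k → Colourable G k
colouring⇒colourable c = (λ p → fromℕ< (bound (∈-allFin p)))
  , λ {p} {q} a eq → proper (∈-allFin p) (∈-allFin q) a
      (trans (sym (Fin.toℕ-fromℕ< _)) (trans (cong toℕ eq) (Fin.toℕ-fromℕ< _)))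
  where open Colouring c

theorem5p1p2 : ∀ {m : ℕ} (G : Graph (Fin m)) → Connected G →
    ∀ (n : ℕ) → n > 0 →
    ∀ (∣S∣ χ h : ℕ) → HasCardinality (IsSolid G) ∣S∣ → IsChromaticNumber G χ → IsHadwigerNumber G h →
    ∣S∣ < n C 4 → χ ⊔ h < n
theorem5p1p2 {m} G _ n@(suc k) _ ∣S∣ χ h (solids , _ , all-solids , refl) (_ , χ-least) (minor , _) few-solids =
  ℕ.⊔-pres-<m (ℕ.≰⇒> χ-small) (ℕ.≰⇒> h-small)
  where
  -- The given enumeration contains every solid, so it is at least as long as any list of distinct
  -- solids.
  bounded : ∀ {Ss} → Unique Ss → All (IsSolid G) Ss → ¬ n C 4 ≤ length Ss
  bounded {Ss} U goods n≤ = ℕ.<⇒≱ few-solids (ℕ.≤-trans n≤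
    (unique-⊆-length U λ i → Equivalence.from (all-solids _) (All.lookup goods i)))
  χ-small : ¬ n ≤ χ
  -- As `n` is `suc k`, the inequality `n ≤ χ` excludes a colouring with `k` colours.
  χ-small n≤χ with chromatic-solids G m {allFin m} (ℕ.≤-reflexive (length-tabulate id)) (allFin⁺ m) k
                     (λ c → ℕ.<⇒≱ n≤χ (χ-least k (colouring⇒colourable c)))
  ... | Ss , U , goods , len = bounded U (All.map proj₁ goods) len
  h-small : ¬ n ≤ h
  h-small n≤h with minor-solids minor n≤h
  ... | Ss , U , goods , len = bounded U goods (ℕ.≤-reflexive (sym len))
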